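{- Suppose there exists a function $g:\mathbb{N}\times\mathbb{N}\times\mathbb{R}_{>0}\to\mathbb{R}_{\ge0}$ such that, for each $n,T\in\mathbb{N}$, $\varepsilon>0$, and any $\varepsilon$-well-behaved IIK instance with $n$ items and $T$ times, one can compute in time $g(n,T,\varepsilon)$ a feasible solution whose profit is at least $(1-2\varepsilon)$ times the maximum profit of a 1-in feasible solution. Then, for any IIK instance with $n$ items and $T$ times, one can compute a feasible solution of profit at least $(1-4\varepsilon)$ times the optimum in time $O\big(T+n(n+g(n,T,\varepsilon))\big)$.
   Context: An IIK instance consists of items $[n]$ with profits $p_i>0$ and weights $w_i>0$, a number $T$ of times and nondecreasing nonnegative capacities $b_1\le\dots\le b_T$. A feasible solution is $x=(x_1,\dots,x_T)$ with $x_t\in\{0,1\}^n$, $w^Tx_t\le b_t$ for $t\in[T]$ and $x_t\le x_{t+1}$ componentwise for $t\in[T-1]$; its profit is $\sum_{t\in[T]}p^Tx_t$. Profits are normalized (by scaling) and items indexed so that $1=p_1\ge p_2\ge\dots\ge p_n$. A feasible solution is 1-in if $x_{T,i}=1$ for some item $i$ with $p_i=p_1=1$. For $\varepsilon>0$, a (normalized) instance is $\varepsilon$-well-behaved if: ($\varepsilon$1) for every $i\in[n]$, either $p_i=(1+\varepsilon)^{ -j}$ for some integer $0\le j\le\lceil\log_{1+\varepsilon}(T/\varepsilon)\rceil$, or $p_i\le \varepsilon/T$; and ($\varepsilon$2) setting $b_0=0$, one has $b_t=b_{t-1}$ for every $t\in[T]$ such that $\lceil(1+\varepsilon)^{j-1}\rceil<T-t+1<\lceil(1+\varepsilon)^{j}\rceil$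 for some integer $1\le j\le\lfloor\log_{1+\varepsilon}T\rfloor$. -}

module Defs where

open import Level using (Level) renaming (suc to lsuc; _⊔_ to _⊔ˡ_)
open import Algebra.Bundles.Raw using (RawSemiring)
open import Algebra.Structures using (IsCommutativeRing)
import Algebra.Definitions.RawSemiring as RawSemiringOps
open import Data.Bool.Base as Bool using (Bool; true; false; if_then_else_)
open import Data.Fin.Base as Fin using (Fin; zero; suc; toℕ; inject₁)
open import Data.Integer.Base as ℤ using (ℤ; +_; -[1+_])
open import Data.Nat.Base as ℕ using (ℕ; zero; suc)
import Data.Nat.Properties as ℕₚ
open import Data.Product.Base using (∃-syntax; ∃₂; _×_)
open import Data.Sum.Base using (_⊎_)
open import Relation.Binary.PropositionalEquality using (_≡_; _≢_)
open import Relation.Binary.Structures using (IsDecTotalOrder)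
import Relation.Binary.Construct.NonStrictToStrict as ToStrict
open import Relation.Nullary.Decidable using (does)

-- The numbers of the problem live in an arbitrary Archimedean ordered field
-- with decidable order.  Classically ℝ is one; constructively ℚ is one.
record ArchimedeanOrderedField (c ℓ : Level) : Set (lsuc (c ⊔ˡ ℓ)) where
  infix  8 -_
  infix  9 _⁻¹
  infixl 7 _*_
  infixl 6 _+_
  infix  4 _≤_
  field
    Carrier           : Set c
    _+_ _*_           : Carrier → Carrier → Carrier
    -_ _⁻¹            : Carrier → Carrier
    0# 1#             : Carrier
    _≤_               : Carrier → Carrier → Set ℓ
    isCommutativeRing : IsCommutativeRing _≡_ _+_ _*_ -_ 0# 1#
    isDecTotalOrder   : IsDecTotalOrder _≡_ _≤_
    0≢1               : 0# ≢ 1#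
    *-inverseʳ        : ∀ x → x ≢ 0# → x * x ⁻¹ ≡ 1#
    0⁻¹≡0             : 0# ⁻¹ ≡ 0#
    +-monoˡ-≤         : ∀ z {x y} → x ≤ y → x + z ≤ y + z
    *-nonNeg          : ∀ {x y} → 0# ≤ x → 0# ≤ y → 0# ≤ x * y

  rawSemiring : RawSemiring c c
  rawSemiring = record
    { Carrier = Carrier ; _≈_ = _≡_ ; _+_ = _+_ ; _*_ = _*_ ; 0# = 0# ; 1# = 1# }

  open RawSemiringOps rawSemiring public using (sum; _^_) renaming (_×_ to _·_)

  fromℕ : ℕ → Carrier
  fromℕ n = n · 1#

  field
    archimedean : ∀ x → ∃[ n ] x ≤ fromℕ n

  open ToStrict _≡_ _≤_ public using (_<_)
  open IsDecTotalOrder isDecTotalOrder public using (_≤?_)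

  infixl 6 _-_
  infixl 7 _/_
  infixr 8 _^ᶻ_

  _-_ _/_ : Carrier → Carrier → Carrier
  x - y = x + (- y)
  x / y = x * y ⁻¹

  _^ᶻ_ : Carrier → ℤ → Carrier
  x ^ᶻ (+ n)    = x ^ n
  x ^ᶻ -[1+ n ] = (x ⁻¹) ^ suc n

  -- The field need not contain logarithms, so rounded logarithms are
  -- described by the powers of the base they lie between.

  -- m ≡ ⌊ x ⌋
  IsFloor : Carrier → ℕ → Set (c ⊔ˡ ℓ)
  IsFloor x m = fromℕ m ≤ x × x < fromℕ (suc m)

  -- m ≡ ⌈ x ⌉, for x > -1
  IsCeil : Carrier → ℕ → Set (c ⊔ˡ ℓ)
  IsCeil x m = x ≤ fromℕ m × fromℕ m < x + 1#

  -- m ≡ ⌊ log_β x ⌋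
  IsFloorLog : Carrier → Carrier → ℤ → Set (c ⊔ˡ ℓ)
  IsFloorLog β x m = 1# < β × β ^ᶻ m ≤ x × x < β ^ᶻ (ℤ.suc m)

  -- m ≡ ⌈ log_β x ⌉
  IsCeilLog : Carrier → Carrier → ℤ → Set (c ⊔ˡ ℓ)
  IsCeilLog β x m = 1# < β × β ^ᶻ (ℤ.pred m) < x × x ≤ β ^ᶻ m


module Knapsack {c ℓ} (K : ArchimedeanOrderedField c ℓ) where
  open ArchimedeanOrderedField K

  -- Time t ∈ {1,…,T} is the element t-1 of Fin T; likewise for items.
  record Instance (n T : ℕ) : Set (c ⊔ˡ ℓ) where
    field
      p w   : Fin n → Carrier
      b     : Fin T → Carrier
      p-pos : ∀ i → 0# < p i
      w-pos : ∀ i → 0# < w i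
      b-nonNeg : ∀ t → 0# ≤ b t
      b-mono   : ∀ {s t} → s Fin.≤ t → b s ≤ b t

  Solution : ℕ → ℕ → Set
  Solution n T = Fin T → Fin n → Bool

  infix 8 _ᵀ_
  _ᵀ_ : ∀ {n} → (Fin n → Carrier) → (Fin n → Bool) → Carrier
  v ᵀ z = sum (λ i → v i * (if z i then 1# else 0#))

  module _ {n T : ℕ} (I : Instance n T) where
    open Instance I

    record Feasible (x : Solution n T) : Set (c ⊔ˡ ℓ) where
      field
        capacity : ∀ t → w ᵀ x t ≤ b t
        nested   : ∀ s t → toℕ t ≡ suc (toℕ s) → ∀ i → x s i Bool.≤ x t i

    profit : Solution n T → Carrier
    profit x = sum (λ t → p ᵀ x t)

    record Normalized : Set (c ⊔ˡ ℓ) where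
      field
        first≡1    : ∀ i → toℕ i ≡ 0 → p i ≡ 1#
        decreasing : ∀ {i j} → i Fin.≤ j → p j ≤ p i

    OneIn : Solution n T → Set c
    OneIn x = ∃₂ λ t i → suc (toℕ t) ≡ T × x t i ≡ true × p i ≡ 1#

    IsMaximum : (Solution n T → Set (c ⊔ˡ ℓ)) → Carrier → Set (c ⊔ˡ ℓ)
    IsMaximum S v = (∃[ x ] S x × profit x ≡ v) × (∀ x → S x → profit x ≤ v)

    -- If no solution satisfies S, there is no maximum and nothing is required.
    AtLeast_TimesMaxOf : Carrier → (Solution n T → Set (c ⊔ˡ ℓ)) →
                         Solution n T → Set (c ⊔ˡ ℓ)
    AtLeast α TimesMaxOf S y = ∀ v → IsMaximum S v → α * v ≤ profit y

    -- b_{t-1}, with b₀ = 0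
    previous : Fin T → Carrier
    previous t = go t b
      where
      go : ∀ {m} → Fin m → (Fin m → Carrier) → Carrier
      go zero    _ = 0#
      go (suc t) f = f (inject₁ t)

    record WellBehaved (ε : Carrier) : Set (c ⊔ˡ ℓ) where
      field
        normalized : Normalized
        ε1 : ∀ i →
          (∃₂ λ (j : ℕ) (m : ℤ) →
             IsCeilLog (1# + ε) (fromℕ T / ε) m × + j ℤ.≤ m ×
             p i ≡ (1# + ε) ^ᶻ (ℤ.- (+ j)))
          ⊎ p i ≤ ε / fromℕ T
        -- As t counts from 0, T ∸ toℕ t is the number of times from t on.
        ε2 : ∀ t →
          (∃₂ λ (j : ℕ) (m : ℤ) → ∃₂ λ (lo hi : ℕ) →
             IsFloorLog (1# + ε) (fromℕ T) m × 1 ℕ.≤ j × + j ℤ.≤ m ×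
             IsCeil ((1# + ε) ^ (j ℕ.∸ 1)) lo × IsCeil ((1# + ε) ^ j) hi ×
             lo ℕ.< T ℕ.∸ toℕ t × T ℕ.∸ toℕ t ℕ.< hi) →
          b t ≡ previous t


-- A unit-cost random access machine, programmed in a while language.  Memory
-- consists of arrays of naturals and arrays of field elements, both named by
-- numerals, so a program refers to finitely many arrays.  A scalar variable is
-- cell 0 of an array.  Next to arithmetic and comparison, powers with natural
-- exponent, ⌊_⌋ and ⌊log_⌋ are unit-cost operations: rounding numbers to powers
-- of 1+ε is otherwise not possible in a number of steps independent of ε.
module Machine {c ℓ} (K : ArchimedeanOrderedField c ℓ) where
  open ArchimedeanOrderedField K

  record Memory : Set c where
    constructor mem
    field
      natural : ℕ → ℕ → ℕ
      real    : ℕ → ℕ → Carrier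
  open Memory public

  update : ∀ {a} {A : Set a} → (ℕ → ℕ → A) → ℕ → ℕ → A → ℕ → ℕ → A
  update f a i v a′ i′ =
    if does (a′ ℕₚ.≟ a) Bool.∧ does (i′ ℕₚ.≟ i) then v else f a′ i′

  infixl 6 _⊕_ _⊖_
  infixl 7 _⊗_ _⊘_
  infixr 8 _↑_

  data NExp : Set where
    lit     : ℕ → NExp
    _[_]    : ℕ → NExp → NExp
    _⊕_ _⊖_ _⊗_ : NExp → NExp → NExp

  data RExp : Set where
    nat     : NExp → RExp
    _[_]    : ℕ → NExp → RExp
    _⊕_ _⊖_ _⊗_ _⊘_ : RExp → RExp → RExp
    _↑_     : RExp → NExp → RExp

  infix 4 _≤ᴺ_ _≤ᴿ_

  data Test : Set where
    _≤ᴺ_ : NExp → NExp → Test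
    _≤ᴿ_ : RExp → RExp → Test

  infix  3 _[_]≔ᴺ_ _[_]≔ᴿ_ _[_]≔⌊_⌋ _[_]≔⌊log_,_⌋
  infixr 2 _⨟_

  data Program : Set where
    skip           : Program
    _[_]≔ᴺ_        : ℕ → NExp → NExp → Program
    _[_]≔ᴿ_        : ℕ → NExp → RExp → Program
    _[_]≔⌊_⌋       : ℕ → NExp → RExp → Program
    _[_]≔⌊log_,_⌋  : ℕ → NExp → RExp → RExp → Program
    _⨟_            : Program → Program → Program
    when_then_else_ : Test → Program → Program → Program
    while_loop_      : Test → Program → Program

  ⟦_⟧ᴺ : NExp → Memory → ℕ
  ⟦ lit k ⟧ᴺ   σ = k
  ⟦ a [ e ] ⟧ᴺ σ = natural σ a (⟦ e ⟧ᴺ σ)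
  ⟦ d ⊕ e ⟧ᴺ   σ = ⟦ d ⟧ᴺ σ ℕ.+ ⟦ e ⟧ᴺ σ
  ⟦ d ⊖ e ⟧ᴺ   σ = ⟦ d ⟧ᴺ σ ℕ.∸ ⟦ e ⟧ᴺ σ
  ⟦ d ⊗ e ⟧ᴺ   σ = ⟦ d ⟧ᴺ σ ℕ.* ⟦ e ⟧ᴺ σ

  ⟦_⟧ᴿ : RExp → Memory → Carrier
  ⟦ nat e ⟧ᴿ   σ = fromℕ (⟦ e ⟧ᴺ σ)
  ⟦ a [ e ] ⟧ᴿ σ = real σ a (⟦ e ⟧ᴺ σ)
  ⟦ d ⊕ e ⟧ᴿ   σ = ⟦ d ⟧ᴿ σ + ⟦ e ⟧ᴿ σ
  ⟦ d ⊖ e ⟧ᴿ   σ = ⟦ d ⟧ᴿ σ - ⟦ e ⟧ᴿ σ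
  ⟦ d ⊗ e ⟧ᴿ   σ = ⟦ d ⟧ᴿ σ * ⟦ e ⟧ᴿ σ
  ⟦ d ⊘ e ⟧ᴿ   σ = ⟦ d ⟧ᴿ σ / ⟦ e ⟧ᴿ σ
  ⟦ d ↑ e ⟧ᴿ   σ = ⟦ d ⟧ᴿ σ ^ ⟦ e ⟧ᴺ σ

  ⟦_⟧ᵀ : Test → Memory → Bool
  ⟦ d ≤ᴺ e ⟧ᵀ σ = does (⟦ d ⟧ᴺ σ ℕₚ.≤? ⟦ e ⟧ᴺ σ)
  ⟦ d ≤ᴿ e ⟧ᵀ σ = does (⟦ d ⟧ᴿ σ ≤? ⟦ e ⟧ᴿ σ)

  -- The cost of an evaluation is the number of nodes of the expression.
  costᴺ : NExp → ℕ
  costᴺ (lit k)   = 1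
  costᴺ (a [ e ]) = suc (costᴺ e)
  costᴺ (d ⊕ e)   = suc (costᴺ d ℕ.+ costᴺ e)
  costᴺ (d ⊖ e)   = suc (costᴺ d ℕ.+ costᴺ e)
  costᴺ (d ⊗ e)   = suc (costᴺ d ℕ.+ costᴺ e)

  costᴿ : RExp → ℕ
  costᴿ (nat e)   = suc (costᴺ e)
  costᴿ (a [ e ]) = suc (costᴺ e)
  costᴿ (d ⊕ e)   = suc (costᴿ d ℕ.+ costᴿ e)
  costᴿ (d ⊖ e)   = suc (costᴿ d ℕ.+ costᴿ e)
  costᴿ (d ⊗ e)   = suc (costᴿ d ℕ.+ costᴿ e)
  costᴿ (d ⊘ e)   = suc (costᴿ d ℕ.+ costᴿ e)
  costᴿ (d ↑ e)   = suc (costᴿ d ℕ.+ costᴺ e)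

  costᵀ : Test → ℕ
  costᵀ (d ≤ᴺ e) = suc (costᴺ d ℕ.+ costᴺ e)
  costᵀ (d ≤ᴿ e) = suc (costᴿ d ℕ.+ costᴿ e)

  writeᴺ : Memory → ℕ → ℕ → ℕ → Memory
  writeᴺ (mem N R) a i v = mem (update N a i v) R

  writeᴿ : Memory → ℕ → ℕ → Carrier → Memory
  writeᴿ (mem N R) a i v = mem N (update R a i v)

  -- P ∣ σ ⇓ σ′ ∣ k : started in σ, P halts in σ′ after k steps.  ⌊log_⌋ is only
  -- executable when its result is a natural number, ⌊_⌋ likewise.
  infix 1 _∣_⇓_∣_
  data _∣_⇓_∣_ : Program → Memory → Memory → ℕ → Set (c ⊔ˡ ℓ) where

    ⇓skip : ∀ {σ} → skip ∣ σ ⇓ σ ∣ 1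

    ⇓assignᴺ : ∀ {σ a i e} →
      a [ i ]≔ᴺ e ∣ σ ⇓ writeᴺ σ a (⟦ i ⟧ᴺ σ) (⟦ e ⟧ᴺ σ) ∣ suc (costᴺ i ℕ.+ costᴺ e)

    ⇓assignᴿ : ∀ {σ a i e} →
      a [ i ]≔ᴿ e ∣ σ ⇓ writeᴿ σ a (⟦ i ⟧ᴺ σ) (⟦ e ⟧ᴿ σ) ∣ suc (costᴺ i ℕ.+ costᴿ e)

    ⇓floor : ∀ {σ a i e m} → IsFloor (⟦ e ⟧ᴿ σ) m →
      a [ i ]≔⌊ e ⌋ ∣ σ ⇓ writeᴺ σ a (⟦ i ⟧ᴺ σ) m ∣ suc (costᴺ i ℕ.+ costᴿ e)

    ⇓log : ∀ {σ a i d e m} → IsFloorLog (⟦ d ⟧ᴿ σ) (⟦ e ⟧ᴿ σ) (+ m) →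
      a [ i ]≔⌊log d , e ⌋ ∣ σ ⇓ writeᴺ σ a (⟦ i ⟧ᴺ σ) m
        ∣ suc (costᴺ i ℕ.+ (costᴿ d ℕ.+ costᴿ e))

    ⇓seq : ∀ {P Q σ σ₁ σ₂ k₁ k₂} →
      P ∣ σ ⇓ σ₁ ∣ k₁ → Q ∣ σ₁ ⇓ σ₂ ∣ k₂ → P ⨟ Q ∣ σ ⇓ σ₂ ∣ k₁ ℕ.+ k₂

    ⇓when-true : ∀ {t P Q σ σ₁ k} → ⟦ t ⟧ᵀ σ ≡ true →
      P ∣ σ ⇓ σ₁ ∣ k → when t then P else Q ∣ σ ⇓ σ₁ ∣ costᵀ t ℕ.+ k

    ⇓when-false : ∀ {t P Q σ σ₁ k} → ⟦ t ⟧ᵀ σ ≡ false →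
      Q ∣ σ ⇓ σ₁ ∣ k → when t then P else Q ∣ σ ⇓ σ₁ ∣ costᵀ t ℕ.+ k

    ⇓while-true : ∀ {t P σ σ₁ σ₂ k₁ k₂} → ⟦ t ⟧ᵀ σ ≡ true →
      P ∣ σ ⇓ σ₁ ∣ k₁ → while t loop P ∣ σ₁ ⇓ σ₂ ∣ k₂ →
      while t loop P ∣ σ ⇓ σ₂ ∣ costᵀ t ℕ.+ (k₁ ℕ.+ k₂)

    ⇓while-false : ∀ {t P σ} → ⟦ t ⟧ᵀ σ ≡ false →
      while t loop P ∣ σ ⇓ σ ∣ costᵀ t


module Computation {c ℓ} (K : ArchimedeanOrderedField c ℓ) where
  open ArchimedeanOrderedField K public
  open Knapsack K public
  open Machine K public

  -- Input: n and T in cell 0 of the natural arrays 0 and 1, ε in cell 0 of the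
  -- real array 0, and p, w, b in the real arrays 1, 2, 3.
  record Holds {n T : ℕ} (σ : Memory) (ε : Carrier) (I : Instance n T) : Set c where
    open Instance I
    field
      n-cell : natural σ 0 0 ≡ n
      T-cell : natural σ 1 0 ≡ T
      ε-cell : real σ 0 0 ≡ ε
      p-cell : ∀ i → real σ 1 (toℕ i) ≡ p i
      w-cell : ∀ i → real σ 2 (toℕ i) ≡ w i
      b-cell : ∀ t → real σ 3 (toℕ t) ≡ b t

  -- Output: writing out T × n bits would by itself exceed the time allowed, so
  -- a solution is output as the n insertion times of the items, counted from 0,
  -- in the natural array 2.  Items with an insertion time ≥ T are never used.
  output : ∀ {n T} → Memory → Solution n T
  output σ t i = does (natural σ 2 (toℕ i) ℕₚ.≤? toℕ t)

  -- Outside the input cells the initial memory is arbitrary.  As with a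
  -- read-only input, the input has to be in place when the program halts.
  ComputesWithin : ∀ {n T} → Program → Carrier → (I : Instance n T) →
                   Carrier → (Solution n T → Set (c ⊔ˡ ℓ)) → Set (c ⊔ˡ ℓ)
  ComputesWithin P ε I time Good =
    ∀ σ → Holds σ ε I →
    ∃₂ λ σ′ k → (P ∣ σ ⇓ σ′ ∣ k) × fromℕ k ≤ time × Holds σ′ ε I ×
                Feasible I (output σ′) × Good (output σ′)

-- For every item k, guess that k is the most profitable item used in an optimal
-- solution x, scale its profit to 1 and cut larger profits to 1.  Write β = 1 + ε.
-- Rounding the other profits up to powers of β ⁻¹ costs a factor β.  Capacities
-- may only change when the number of remaining times is ⌈β^j⌉ for some j; keeping
-- them constant in between delays an item inserted with s times remaining until
-- ⌈β^j⌉ times remain, where β^j ≤ s < β^(j+1), and so costs another factor β.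
-- The given algorithm loses 1 - 2ε, and β² (1 - 4ε) ≤ 1 - 2ε.
--
-- Sorting takes time O(n²), the capacities O(T), and each guess O(n) besides the
-- call.  A call may overwrite any array, so the arrays of the given program are
-- renamed first; its insertion times are evaluated against the original profits
-- and the best ones are kept.

module Submission where

open import Defs
open import Data.Nat.Base as ℕ using (ℕ; zero; suc; NonZero; _≡ᵇ_)
open import Data.Product.Base using (∃; ∃₂; ∃-syntax; _×_; _,_; proj₁; proj₂)

open import Level using (Level; _⊔_)
open import Algebra.Bundles using (CommutativeRing)
import Algebra.Properties.CommutativeMonoid.Sum as CommutativeMonoidSum
import Algebra.Properties.Monoid.Mult as MonoidMult
import Algebra.Properties.Ring as RingProperties
import Algebra.Properties.Semiring.Mult as SemiringMult
import Algebra.Properties.Semiring.Sum as SemiringSum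
open import Data.Bool.Base as Bool using (Bool; true; false; if_then_else_; not; _∨_)
import Data.Bool.Properties as Boolₚ
open import Data.Fin.Base as Fin using (Fin; zero; suc; toℕ; inject₁)
import Data.Fin.Permutation as Perm
open Perm using (Permutation′; _⟨$⟩ʳ_; _⟨$⟩ˡ_; inverseʳ; inverseˡ; transpose; _∘ₚ_)
import Data.Fin.Permutation.Components as Components
import Data.Fin.Properties as Finₚ
open import Data.Integer.Base as ℤ using (+_)
open import Data.List.Base using (List; []; _∷_; cartesianProductWith)
open import Data.List.Relation.Unary.All as All using (All; []; _∷_)
open import Data.List.Relation.Unary.Any using (Any; here; there)
import Data.List.Relation.Unary.Any.Properties as Anyₚ
import Data.Nat.Properties as ℕₚ
open import Data.Nat.Tactic.RingSolver using (solve-∀)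
open import Data.Sum.Base using (_⊎_; inj₁; inj₂)
open import Data.Unit.Base using (tt)
import Data.Vec.Functional as Vector
open import Function.Base using (_∘_; _$_; id)
open import Relation.Binary.Bundles using (Poset)
import Relation.Binary.Construct.NonStrictToStrict as ToStrict
open import Relation.Binary.PropositionalEquality
  using (_≡_; _≢_; refl; sym; trans; cong; cong₂; subst; subst₂)
import Relation.Binary.Reasoning.PartialOrder as PosetReasoning
open import Relation.Binary.Structures using (IsDecTotalOrder)
open import Relation.Nullary using (¬_; yes; no; Dec; contradiction; does)
open import Relation.Nullary.Decidable using (_×-dec_; _→-dec_; map′; dec-true; dec-false)
open import Relation.Unary using (Pred; Decidable)

-- The given algorithm competes with 1-in solutions only, so a solution whose first used item in
-- sorted order is `k` has to stay 1-in after it is carried over to the instance of guess `k`. It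
-- does: `k` itself gets profit 1, and the last time, with one time remaining, is never skipped. The
-- two factors β are lost on different sides: the optimal solution pays for the delay on its way
-- into the guessed instance, the returned solution pays for the rounding on its way back. The
-- returned solution needs no repair, since reduced capacities never exceed the original ones.
--
-- T enters the bound only additively, for three reasons: the reduced capacities are the same for
-- all guesses, a call leaves its input in place, and a solution with insertion times a is evaluated
-- item by item, as the sum of the p i (T ∸ a i).
--
-- The guarantee is relative to a maximum, so a maximum must be exhibited before it can be used; the
-- proof, not the program, enumerates all solutions for this.

module FieldProperties {c ℓ : Level} (K : ArchimedeanOrderedField c ℓ) where
  open ArchimedeanOrderedField K

  -- Arithmetic in an ordered field

  commutativeRing : CommutativeRing c c
  commutativeRing = record { isCommutativeRing = isCommutativeRing }

  open CommutativeRing commutativeRing public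
    using ( +-assoc; +-comm; +-identityˡ; +-identityʳ; -‿inverseˡ; -‿inverseʳ
          ; *-assoc; *-comm; *-identityˡ; *-identityʳ; distribˡ; distribʳ
          ; zeroˡ; zeroʳ; ring; semiring; +-commutativeMonoid; +-monoid)
  open RingProperties ring public using (-‿distribˡ-*; -‿involutive; -‿+-comm)
  open SemiringSum semiring public using (*-distribˡ-sum)
  open CommutativeMonoidSum +-commutativeMonoid public using (∑-comm; sum-permute; sum-cong-≗)

  open IsDecTotalOrder isDecTotalOrder public
    using (_≟_) renaming (refl to ≤-refl; trans to ≤-trans; antisym to ≤-antisym;
           reflexive to ≤-reflexive; total to ≤-total)

  poset : Poset c c ℓ
  poset = record { isPartialOrder = IsDecTotalOrder.isPartialOrder isDecTotalOrder }

  module ≤-Reasoning = PosetReasoning poset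
  open ≤-Reasoning

  <⇒≤ : ∀ {x y} → x < y → x ≤ y
  <⇒≤ = ToStrict.<⇒≤ _≡_ _≤_

  <⇒≱ : ∀ {x y} → x < y → ¬ y ≤ x
  <⇒≱ = ToStrict.<⇒≱ _≡_ _≤_ ≤-antisym

  ≰⇒> : ∀ {x y} → ¬ x ≤ y → y < x
  ≰⇒> = ToStrict.≰⇒> _≡_ _≤_ sym ≤-reflexive ≤-total

  ≰⇒≥ : ∀ {x y} → ¬ x ≤ y → y ≤ x
  ≰⇒≥ = <⇒≤ ∘ ≰⇒>

  <-≤-trans : ∀ {x y z} → x < y → y ≤ z → x < z
  <-≤-trans = ToStrict.<-≤-trans _≡_ _≤_ sym ≤-trans ≤-antisym (subst (_ ≤_))

  ≤-<-trans : ∀ {x y z} → x ≤ y → y < z → x < z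
  ≤-<-trans = ToStrict.≤-<-trans _≡_ _≤_ ≤-trans ≤-antisym (subst (_≤ _))

  <-irrefl : ∀ {x} → ¬ x < x
  <-irrefl x<x = proj₂ x<x refl

  +-mono-≤ : ∀ {x y u v} → x ≤ y → u ≤ v → x + u ≤ y + v
  +-mono-≤ {x} {y} {u} {v} x≤y u≤v = begin
    x + u ≤⟨ +-monoˡ-≤ u x≤y ⟩
    y + u ≡⟨ +-comm y u ⟩
    u + y ≤⟨ +-monoˡ-≤ y u≤v ⟩
    v + y ≡⟨ +-comm v y ⟩
    y + v ∎

  +-monoʳ-≤ : ∀ z {x y} → x ≤ y → z + x ≤ z + y
  +-monoʳ-≤ z = +-mono-≤ ≤-refl

  +-cancelʳ : ∀ x z → (x + z) - z ≡ x
  +-cancelʳ x z = trans (+-assoc x z (- z)) (trans (cong (λ u → x + u) (-‿inverseʳ z)) (+-identityʳ x))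

  -‿cancelʳ : ∀ x z → (x - z) + z ≡ x
  -‿cancelʳ x z = trans (+-assoc x (- z) z) (trans (cong (λ u → x + u) (-‿inverseˡ z)) (+-identityʳ x))

  +-nonNeg : ∀ {x y} → 0# ≤ x → 0# ≤ y → 0# ≤ x + y
  +-nonNeg 0≤x 0≤y = subst (_≤ _) (+-identityˡ 0#) (+-mono-≤ 0≤x 0≤y)

  x≤x+y : ∀ {x y} → 0# ≤ y → x ≤ x + y
  x≤x+y {x} {y} 0≤y = subst (_≤ x + y) (+-identityʳ x) (+-monoʳ-≤ x 0≤y)

  x≤y+x : ∀ {x y} → 0# ≤ y → x ≤ y + x
  x≤y+x {x} {y} 0≤y = subst (x ≤_) (+-comm x y) (x≤x+y 0≤y)

  x≤y⇒0≤y-x : ∀ {x y} → x ≤ y → 0# ≤ y - x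
  x≤y⇒0≤y-x {x} x≤y = subst (_≤ _) (-‿inverseʳ x) (+-monoˡ-≤ (- x) x≤y)

  x<x+y : ∀ {x y} → 0# < y → x < x + y
  x<x+y {x} {y} 0<y = x≤x+y (<⇒≤ 0<y) , λ x≡x+y → proj₂ 0<y $ sym $
    trans (sym (+-cancelʳ y x)) (trans (cong (_- x) (trans (+-comm y x) (sym x≡x+y))) (-‿inverseʳ x))

  *-monoˡ-≤ : ∀ {z x y} → 0# ≤ z → x ≤ y → z * x ≤ z * y
  *-monoˡ-≤ {z} {x} {y} 0≤z x≤y = subst₂ _≤_ (+-identityˡ _) eq
    (+-monoˡ-≤ (z * x) (*-nonNeg 0≤z (x≤y⇒0≤y-x x≤y)))
    where
    eq : z * (y - x) + z * x ≡ z * y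
    eq = trans (sym (distribˡ z (y - x) x)) (cong (λ u → z * u) (-‿cancelʳ y x))

  *-monoʳ-≤ : ∀ {z x y} → 0# ≤ z → x ≤ y → x * z ≤ y * z
  *-monoʳ-≤ {z} {x} {y} 0≤z x≤y = subst₂ _≤_ (*-comm z x) (*-comm z y) (*-monoˡ-≤ 0≤z x≤y)

  *-mono-≤ : ∀ {x y u v} → 0# ≤ x → 0# ≤ v → x ≤ y → u ≤ v → x * u ≤ y * v
  *-mono-≤ 0≤x 0≤v x≤y u≤v = ≤-trans (*-monoˡ-≤ 0≤x u≤v) (*-monoʳ-≤ 0≤v x≤y)

  >⇒≢0 : ∀ {x} → 0# < x → x ≢ 0#
  >⇒≢0 0<x x≡0 = proj₂ 0<x (sym x≡0)

  *-inverseˡ : ∀ {x} → x ≢ 0# → x ⁻¹ * x ≡ 1#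
  *-inverseˡ {x} x≢0 = trans (*-comm (x ⁻¹) x) (*-inverseʳ x x≢0)

  *-pos : ∀ {x y} → 0# < x → 0# < y → 0# < x * y
  *-pos {x} {y} 0<x 0<y = *-nonNeg (<⇒≤ 0<x) (<⇒≤ 0<y) , λ 0≡xy → >⇒≢0 0<y (begin-equality
    y               ≡⟨ sym (*-identityˡ y) ⟩
    1# * y          ≡⟨ cong (_* y) (sym (*-inverseˡ (>⇒≢0 0<x))) ⟩
    x ⁻¹ * x * y    ≡⟨ *-assoc (x ⁻¹) x y ⟩
    x ⁻¹ * (x * y)  ≡⟨ cong (λ u → x ⁻¹ * u) (sym 0≡xy) ⟩
    x ⁻¹ * 0#       ≡⟨ zeroʳ (x ⁻¹) ⟩
    0#              ∎)

  neg*neg : ∀ x y → (- x) * (- y) ≡ x * y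
  neg*neg x y = begin-equality
    (- x) * (- y)  ≡⟨ sym (-‿distribˡ-* x (- y)) ⟩
    - (x * (- y))  ≡⟨ cong -_ (*-comm x (- y)) ⟩
    - ((- y) * x)  ≡⟨ cong -_ (sym (-‿distribˡ-* y x)) ⟩
    - (- (y * x))  ≡⟨ -‿involutive (y * x) ⟩
    y * x          ≡⟨ *-comm y x ⟩
    x * y          ∎

  0≤1 : 0# ≤ 1#
  0≤1 with ≤-total 0# 1#
  ... | inj₁ 0≤1′ = 0≤1′
  ... | inj₂ 1≤0 = subst (0# ≤_) (trans (neg*neg 1# 1#) (*-identityˡ 1#)) (*-nonNeg 0≤-1 0≤-1)
    where
    0≤-1 : 0# ≤ - 1#
    0≤-1 = subst (0# ≤_) (+-identityˡ (- 1#)) (x≤y⇒0≤y-x 1≤0)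

  0<1 : 0# < 1#
  0<1 = 0≤1 , 0≢1

  ⁻¹-pos : ∀ {x} → 0# < x → 0# < x ⁻¹
  ⁻¹-pos {x} 0<x with ≤-total 0# (x ⁻¹)
  ... | inj₁ 0≤x⁻¹ = 0≤x⁻¹ , λ 0≡x⁻¹ →
    0≢1 (trans (sym (zeroʳ x)) (trans (cong (λ u → x * u) 0≡x⁻¹) (*-inverseʳ x (>⇒≢0 0<x))))
  ... | inj₂ x⁻¹≤0 = contradiction
    (subst₂ _≤_ (*-inverseʳ x (>⇒≢0 0<x)) (zeroʳ x) (*-monoˡ-≤ (<⇒≤ 0<x) x⁻¹≤0)) (<⇒≱ 0<1)

  *-cancelˡ-≤ : ∀ {z x y} → 0# < z → z * x ≤ z * y → x ≤ y
  *-cancelˡ-≤ {z} {x} {y} 0<z p = subst₂ _≤_ (eq x) (eq y) (*-monoˡ-≤ (<⇒≤ (⁻¹-pos 0<z)) p)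
    where
    eq : ∀ u → z ⁻¹ * (z * u) ≡ u
    eq u = trans (sym (*-assoc (z ⁻¹) z u)) (trans (cong (_* u) (*-inverseˡ (>⇒≢0 0<z))) (*-identityˡ u))

  *-monoˡ-< : ∀ {z x y} → 0# < z → x < y → z * x < z * y
  *-monoˡ-< 0<z x<y = ≰⇒> λ zy≤zx → <⇒≱ x<y (*-cancelˡ-≤ 0<z zy≤zx)

  /-*-cancel : ∀ x {y} → 0# < y → x / y * y ≡ x
  /-*-cancel x {y} 0<y = trans (*-assoc x (y ⁻¹) y)
    (trans (cong (λ u → x * u) (*-inverseˡ (>⇒≢0 0<y))) (*-identityʳ x))

  ≤/⇒*≤ : ∀ {x y z} → 0# < z → x ≤ y / z → x * z ≤ y
  ≤/⇒*≤ {y = y} 0<z p = subst (_ ≤_) (/-*-cancel y 0<z) (*-monoʳ-≤ (<⇒≤ 0<z) p)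

  *≤⇒≤/ : ∀ {x y z} → 0# < z → x * z ≤ y → x ≤ y / z
  *≤⇒≤/ {x} {y} {z} 0<z p = *-cancelˡ-≤ 0<z
    (subst₂ _≤_ (*-comm x z) (trans (sym (/-*-cancel y 0<z)) (*-comm (y / z) z)) p)

  /≤⇒≤* : ∀ {x y z} → 0# < z → y / z ≤ x → y ≤ x * z
  /≤⇒≤* {x} {y} 0<z p = subst (_≤ _) (/-*-cancel y 0<z) (*-monoʳ-≤ (<⇒≤ 0<z) p)

  -- Natural numbers, floors, powers of β and rounded logarithms

  fromℕ-+ : ∀ m n → fromℕ (m ℕ.+ n) ≡ fromℕ m + fromℕ n
  fromℕ-+ m n = MonoidMult.×-homo-+ +-monoid 1# m n

  fromℕ-* : ∀ m n → fromℕ (m ℕ.* n) ≡ fromℕ m * fromℕ n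
  fromℕ-* = SemiringMult.×1-homo-* semiring

  fromℕ-1 : fromℕ 1 ≡ 1#
  fromℕ-1 = +-identityʳ 1#

  fromℕ-nonNeg : ∀ n → 0# ≤ fromℕ n
  fromℕ-nonNeg zero    = ≤-refl
  fromℕ-nonNeg (suc n) = +-nonNeg 0≤1 (fromℕ-nonNeg n)

  fromℕ-mono-≤ : ∀ {m n} → m ℕ.≤ n → fromℕ m ≤ fromℕ n
  fromℕ-mono-≤ {n = n} ℕ.z≤n = fromℕ-nonNeg n
  fromℕ-mono-≤ (ℕ.s≤s m≤n) = +-monoʳ-≤ 1# (fromℕ-mono-≤ m≤n)

  n<1+n : ∀ n → fromℕ n < fromℕ (suc n)
  n<1+n n = subst (fromℕ n <_) (+-comm (fromℕ n) 1#) (x<x+y 0<1)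

  fromℕ-cancel-< : ∀ {m n} → fromℕ m < fromℕ n → m ℕ.< n
  fromℕ-cancel-< {m} {n} p with m ℕₚ.<? n
  ... | yes m<n = m<n
  ... | no m≮n = contradiction (fromℕ-mono-≤ (ℕₚ.≮⇒≥ m≮n)) (<⇒≱ p)

  1≤fromℕ : ∀ {n} → 1 ℕ.≤ n → 1# ≤ fromℕ n
  1≤fromℕ {n} 1≤n = subst (_≤ fromℕ n) fromℕ-1 (fromℕ-mono-≤ 1≤n)

  fromℕ-pos : ∀ {n} → 1 ℕ.≤ n → 0# < fromℕ n
  fromℕ-pos 1≤n = <-≤-trans 0<1 (1≤fromℕ 1≤n)

  -- The search runs downwards from `n` and stops at the first `m` with `f m ≤ x`; that it passed
  -- `suc m` gives the upper bound, so `f` may be arbitrary. Floors and rounded logarithms are both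
  -- instances.
  bracket : (f : ℕ → Carrier) (x : Carrier) (n : ℕ) → f 0 ≤ x → x < f n →
            ∃[ m ] f m ≤ x × x < f (suc m)
  bracket f x zero lo hi = contradiction lo (<⇒≱ hi)
  bracket f x (suc n) lo hi with f n ≤? x
  ... | yes p = n , p , hi
  ... | no ¬p = bracket f x n lo (≰⇒> ¬p)

  abstract
    floor : ∀ x → 0# ≤ x → ∃[ m ] IsFloor x m
    floor x 0≤x = let n , x≤n = archimedean x in
      bracket fromℕ x (suc n) 0≤x (≤-<-trans x≤n (n<1+n n))

  ^-pos : ∀ {x} n → 0# < x → 0# < x ^ n
  ^-pos zero    0<x = 0<1
  ^-pos (suc n) 0<x = *-pos 0<x (^-pos n 0<x)

  ^⁻¹-inverseʳ : ∀ {x} n → 0# < x → x ^ n * x ⁻¹ ^ n ≡ 1#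
  ^⁻¹-inverseʳ zero 0<x = *-identityˡ 1#
  ^⁻¹-inverseʳ {x} (suc n) 0<x = begin-equality
    x * x ^ n * (x ⁻¹ * x ⁻¹ ^ n)    ≡⟨ *-assoc x (x ^ n) _ ⟩
    x * (x ^ n * (x ⁻¹ * x ⁻¹ ^ n))  ≡⟨ cong (λ u → x * u) (sym (*-assoc (x ^ n) (x ⁻¹) _)) ⟩
    x * (x ^ n * x ⁻¹ * x ⁻¹ ^ n)    ≡⟨ cong (λ u → x * (u * x ⁻¹ ^ n)) (*-comm (x ^ n) (x ⁻¹)) ⟩
    x * (x ⁻¹ * x ^ n * x ⁻¹ ^ n)    ≡⟨ cong (λ u → x * u) (*-assoc (x ⁻¹) (x ^ n) _) ⟩
    x * (x ⁻¹ * (x ^ n * x ⁻¹ ^ n))  ≡⟨ sym (*-assoc x (x ⁻¹) _) ⟩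
    x * x ⁻¹ * (x ^ n * x ⁻¹ ^ n)    ≡⟨ cong₂ _*_ (*-inverseʳ x (>⇒≢0 0<x)) (^⁻¹-inverseʳ n 0<x) ⟩
    1# * 1#                          ≡⟨ *-identityˡ 1# ⟩
    1#                               ∎

  module Powers {ε : Carrier} (0<ε : 0# < ε) where
    β : Carrier
    β = 1# + ε

    1<β : 1# < β
    1<β = x<x+y 0<ε

    0<β : 0# < β
    0<β = <-≤-trans 0<1 (<⇒≤ 1<β)

    0≤β : 0# ≤ β
    0≤β = <⇒≤ 0<β

    x≤βx : ∀ {x} → 0# ≤ x → x ≤ β * x
    x≤βx {x} 0≤x = subst (_≤ β * x) (*-identityˡ x) (*-monoʳ-≤ 0≤x (<⇒≤ 1<β))

    1≤β^ : ∀ n → 1# ≤ β ^ n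
    1≤β^ zero    = ≤-refl
    1≤β^ (suc n) = ≤-trans (1≤β^ n) (x≤βx (<⇒≤ (^-pos n 0<β)))

    β^-mono-≤ : ∀ {m n} → m ℕ.≤ n → β ^ m ≤ β ^ n
    β^-mono-≤ {n = n} ℕ.z≤n = 1≤β^ n
    β^-mono-≤ (ℕ.s≤s m≤n) = *-monoˡ-≤ 0≤β (β^-mono-≤ m≤n)

    β^-cancel-< : ∀ {m n} → β ^ m < β ^ n → m ℕ.< n
    β^-cancel-< {m} {n} p with m ℕₚ.<? n
    ... | yes m<n = m<n
    ... | no m≮n = contradiction (β^-mono-≤ (ℕₚ.≮⇒≥ m≮n)) (<⇒≱ p)

    -- Bernoulli's inequality. It turns the Archimedean axiom into unboundedness of the powers of β,
    -- which replaces the existence of logarithms.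
    bernoulli : ∀ n → 1# + fromℕ n * ε ≤ β ^ n
    bernoulli zero = ≤-reflexive (trans (cong (λ u → 1# + u) (zeroˡ ε)) (+-identityʳ 1#))
    bernoulli (suc n) = begin
      1# + (1# + fromℕ n) * ε          ≡⟨ cong (λ u → 1# + u) (distribʳ ε 1# (fromℕ n)) ⟩
      1# + (1# * ε + fromℕ n * ε)      ≡⟨ cong (λ u → 1# + u) (+-comm (1# * ε) _) ⟩
      1# + (fromℕ n * ε + 1# * ε)      ≡⟨ sym (+-assoc 1# _ _) ⟩
      1# + fromℕ n * ε + 1# * ε        ≤⟨ +-mono-≤ (bernoulli n) (*-monoʳ-≤ (<⇒≤ 0<ε) (1≤β^ n)) ⟩
      β ^ n + β ^ n * ε                ≡⟨ cong₂ _+_ (sym (*-identityˡ (β ^ n))) (*-comm (β ^ n) ε) ⟩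
      1# * β ^ n + ε * β ^ n           ≡⟨ sym (distribʳ (β ^ n) 1# ε) ⟩
      β * β ^ n                        ∎

    β^-unbounded : ∀ x → ∃[ n ] x < β ^ n
    β^-unbounded x = let n , x/ε≤n = archimedean (x / ε) in n , (begin-strict
      x                   ≤⟨ /≤⇒≤* 0<ε x/ε≤n ⟩
      fromℕ n * ε         <⟨ x<x+y 0<1 ⟩
      fromℕ n * ε + 1#    ≡⟨ +-comm _ 1# ⟩
      1# + fromℕ n * ε    ≤⟨ bernoulli n ⟩
      β ^ n               ∎)

    abstract
      floorLog : ∀ x → 1# ≤ x → ∃[ m ] IsFloorLog β x (+ m)
      floorLog x 1≤x = let n , x<β^n = β^-unbounded x
                           m , lo , hi = bracket (β ^_) x n 1≤x x<β^n
                       in m , 1<β , lo , hi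

      -- As `x` exceeds 1 strictly, the result is at least 1, so its predecessor is again a natural
      -- exponent and no negative power of β occurs.
      ceilLog : ∀ x → 1# < x → ∃[ m ] IsCeilLog β x (+ m)
      ceilLog x 1<x = let n , x<β^n = β^-unbounded x in go n (<⇒≤ x<β^n)
        where
        go : ∀ n → x ≤ β ^ n → ∃[ m ] IsCeilLog β x (+ m)
        go zero x≤1 = contradiction x≤1 (<⇒≱ 1<x)
        go (suc n) x≤β^ with x ≤? β ^ n
        ... | yes p = go n p
        ... | no ¬p = suc n , 1<β , ≰⇒> ¬p , x≤β^

    β⁻¹^-pos : ∀ n → 0# < β ⁻¹ ^ n
    β⁻¹^-pos n = ^-pos n (⁻¹-pos 0<β)

    β^ᶻ-neg : ∀ n → β ^ᶻ (ℤ.- (+ n)) ≡ β ⁻¹ ^ n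
    β^ᶻ-neg zero    = refl
    β^ᶻ-neg (suc n) = refl

  sum-mono-≤ : ∀ {n} {f g : Fin n → Carrier} → (∀ i → f i ≤ g i) → sum f ≤ sum g
  sum-mono-≤ {zero}  f≤g = ≤-refl
  sum-mono-≤ {suc n} f≤g = +-mono-≤ (f≤g zero) (sum-mono-≤ (f≤g ∘ suc))

  sum-nonNeg : ∀ {n} {f : Fin n → Carrier} → (∀ i → 0# ≤ f i) → 0# ≤ sum f
  sum-nonNeg {zero}  0≤f = ≤-refl
  sum-nonNeg {suc n} 0≤f = +-nonNeg (0≤f zero) (sum-nonNeg (0≤f ∘ suc))

  -- Adds in the order of an accumulating loop, the newest term last, whereas `sum` splits off the
  -- first term.
  partialSum : (ℕ → Carrier) → ℕ → Carrier
  partialSum f zero    = 0#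
  partialSum f (suc m) = partialSum f m + f m

  partialSum-suc : ∀ f m → partialSum f (suc m) ≡ f 0 + partialSum (f ∘ suc) m
  partialSum-suc f zero    = +-comm 0# (f 0)
  partialSum-suc f (suc m) = trans (cong (_+ f (suc m)) (partialSum-suc f m)) (+-assoc (f 0) _ _)

  partialSum≡sum : ∀ f n → partialSum f n ≡ sum {n} (f ∘ toℕ)
  partialSum≡sum f zero    = refl
  partialSum≡sum f (suc n) = trans (partialSum-suc f n) (cong (λ u → f 0 + u) (partialSum≡sum (f ∘ suc) n))

-- Booleans and enumeration of finite function spaces

does⇒ : ∀ {p} {P : Set p} (P? : Dec P) → does P? ≡ true → P
does⇒ (yes p) _ = p

does-false⇒ : ∀ {p} {P : Set p} (P? : Dec P) → does P? ≡ false → ¬ P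
does-false⇒ (no ¬p) _ = ¬p

⇒≤ : ∀ {x y} → (x ≡ true → y ≡ true) → x Bool.≤ y
⇒≤ {false} {y} _ = Boolₚ.≤-minimum y
⇒≤ {true}  x⇒y = subst (true Bool.≤_) (sym (x⇒y refl)) Bool.b≤b

≤⇒ : ∀ {x y} → x Bool.≤ y → x ≡ true → y ≡ true
≤⇒ Bool.b≤b x≡true = x≡true

functions : ∀ {a} {A : Set a} → List A → ∀ n → List (Fin n → A)
functions as zero    = Vector.[] ∷ []
functions as (suc n) = cartesianProductWith Vector._∷_ as (functions as n)

-- Without function extensionality a function is listed only up to pointwise agreement. Stating this
-- for a relation `R` allows a second application, from rows to whole solutions.
functions-complete : ∀ {a r} {A : Set a} {R : A → A → Set r} {as : List A} →
  (∀ a → Any (R a) as) → ∀ {n} (f : Fin n → A) → Any (λ g → ∀ i → R (f i) (g i)) (functions as n)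
functions-complete complete {zero}  f = here λ ()
functions-complete complete {suc n} f = Anyₚ.cartesianProductWith⁺ Vector._∷_
  (λ r rs → λ { zero → r ; (suc i) → rs i })
  (complete (f zero)) (functions-complete complete (f ∘ suc))

-- For the last row of a solution and items sorted by profit, the least index is a most profitable
-- item ever used: the right guess.
firstTrue : ∀ {n} (z : Fin n → Bool) → (∀ j → z j ≡ false) ⊎
  (∃[ k ] z k ≡ true × (∀ j → z j ≡ true → k Fin.≤ j))
firstTrue {zero} z = inj₁ λ ()
firstTrue {suc n} z with z zero in eq
... | true = inj₂ (zero , eq , λ _ _ → ℕ.z≤n)
... | false with firstTrue (z ∘ suc)
...   | inj₁ none = inj₁ λ { zero → eq ; (suc j) → none j }
...   | inj₂ (k , zk , least) = inj₂ (suc k , zk , λ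
        { zero z0 → contradiction (trans (sym eq) z0) λ () ; (suc j) zj → ℕ.s≤s (least j zj) })

-- Keeping a sequence constant between special times

-- hold c f follows f at the times t for which the number T ∸ t of remaining
-- times is special, and keeps its last value in between, starting from c.
module Hold (special : ℕ → Bool) where

  private variable
    a r : Level
    A B : Set a
    T : ℕ

  hold : A → (Fin T → A) → Fin T → A
  hold {T = suc T} c f zero    = if special (suc T) then f zero else c
  hold             c f (suc t) = hold (hold c f zero) (f ∘ suc) t

  -- `previous` with an arbitrary starting value instead of b₀ = 0.
  before : A → (Fin T → A) → Fin T → A
  before c f zero    = c
  before c f (suc t) = f (inject₁ t)

  hold-special : (c : A) (f : Fin T → A) (t : Fin T) →
    special (T ℕ.∸ toℕ t) ≡ true → hold c f t ≡ f t
  hold-special c f zero    eq rewrite eq = refl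
  hold-special c f (suc t) eq = hold-special (hold c f zero) (f ∘ suc) t eq

  hold-skip : (c : A) (f : Fin T → A) (t : Fin T) →
    special (T ℕ.∸ toℕ t) ≡ false → hold c f t ≡ before c (hold c f) t
  hold-skip c f zero          eq rewrite eq = refl
  hold-skip c f (suc zero)    eq = hold-skip (hold c f zero) (f ∘ suc) zero eq
  hold-skip c f (suc (suc t)) eq = hold-skip (hold c f zero) (f ∘ suc) (suc t) eq

  -- Parametricity: which entries are kept depends on the times alone, so two related sequences stay
  -- related. Hence held rows fit into held capacities, and holding a solution means holding each
  -- item separately.
  hold-rel : (R : A → B → Set r) {c : A} {d : B} {f : Fin T → A} {g : Fin T → B} →
    R c d → (∀ t → R (f t) (g t)) → ∀ t → R (hold c f t) (hold d g t)
  hold-rel {T = suc T} R Rcd Rfg zero with special (suc T)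
  ... | true  = Rfg zero
  ... | false = Rcd
  hold-rel R Rcd Rfg (suc t) = hold-rel R (hold-rel R Rcd Rfg zero) (Rfg ∘ suc) t

  module Monotone (_≼_ : A → A → Set r) (≼-refl : ∀ {x} → x ≼ x)
                  (≼-trans : ∀ {x y z} → x ≼ y → y ≼ z → x ≼ z) where

    hold-lower : ∀ {c} {f : Fin T → A} → (∀ {s t} → s Fin.≤ t → f s ≼ f t) →
      (∀ t → c ≼ f t) → ∀ t → c ≼ hold c f t
    -- The first held value is the starting value for the tail, so this restores the hypothesis
    -- `c ≼ f t` in the inductions below.
    hold₀-upper : ∀ {c} {f : Fin (suc T) → A} → (∀ {s t} → s Fin.≤ t → f s ≼ f t) →
      (∀ t → c ≼ f t) → ∀ t → hold c f zero ≼ f t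

    hold₀-upper {T = T} mono c≼f t with special (suc T)
    ... | true  = mono ℕ.z≤n
    ... | false = c≼f t

    hold-lower {T = suc T} mono c≼f zero with special (suc T)
    ... | true  = c≼f zero
    ... | false = ≼-refl
    hold-lower mono c≼f (suc t) = ≼-trans (hold-lower mono c≼f zero)
      (hold-lower (mono ∘ ℕ.s≤s) (hold₀-upper mono c≼f ∘ suc) t)

    hold-upper : ∀ {c} {f : Fin T → A} → (∀ {s t} → s Fin.≤ t → f s ≼ f t) →
      (∀ t → c ≼ f t) → ∀ t → hold c f t ≼ f t
    hold-upper mono c≼f zero    = hold₀-upper mono c≼f zero
    hold-upper mono c≼f (suc t) = hold-upper (mono ∘ ℕ.s≤s) (hold₀-upper mono c≼f ∘ suc) t

    hold-mono : ∀ {c} {f : Fin T → A} → (∀ {s t} → s Fin.≤ t → f s ≼ f t) →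
      (∀ t → c ≼ f t) → ∀ {s t} → s Fin.≤ t → hold c f s ≼ hold c f t
    hold-mono mono c≼f {zero}  {zero}  s≤t = ≼-refl
    hold-mono mono c≼f {zero}  {suc t} s≤t =
      hold-lower (mono ∘ ℕ.s≤s) (hold₀-upper mono c≼f ∘ suc) t
    hold-mono mono c≼f {suc s} {suc t} (ℕ.s≤s s≤t) =
      hold-mono (mono ∘ ℕ.s≤s) (hold₀-upper mono c≼f ∘ suc) s≤t

-- Solutions, profits and maxima

module KnapsackProperties {c ℓ : Level} (K : ArchimedeanOrderedField c ℓ) where
  open ArchimedeanOrderedField K
  open FieldProperties K
  open Knapsack K
  open ≤-Reasoning

  ind : Bool → Carrier
  ind b = if b then 1# else 0#

  ind-nonNeg : ∀ b → 0# ≤ ind b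
  ind-nonNeg true  = 0≤1
  ind-nonNeg false = ≤-refl

  maximal : ∀ {a s} {A : Set a} {S : Pred A s} → Decidable S → (f : A → Carrier) (as : List A) →
    All (¬_ ∘ S) as ⊎ (∃[ m ] S m × All (λ a → S a → f a ≤ f m) as)
  maximal S? f [] = inj₁ []
  maximal S? f (a ∷ as) with S? a | maximal S? f as
  ... | no ¬Sa | inj₁ none = inj₁ (¬Sa ∷ none)
  ... | yes Sa | inj₁ none =
    inj₂ (a , Sa , (λ _ → ≤-refl) ∷ All.map (λ ¬S S → contradiction S ¬S) none)
  ... | no ¬Sa | inj₂ (m , Sm , max) = inj₂ (m , Sm , (λ Sa → contradiction Sa ¬Sa) ∷ max)
  ... | yes Sa | inj₂ (m , Sm , max) with f a ≤? f m
  ...   | yes fa≤fm = inj₂ (m , Sm , (λ _ → fa≤fm) ∷ max)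
  ...   | no fa≰fm  = inj₂ (a , Sa , (λ _ → ≤-refl) ∷ All.map (λ le Sx → ≤-trans (le Sx) (≰⇒≥ fa≰fm)) max)

  infix 4 _≋_
  _≋_ : ∀ {n T} → Solution n T → Solution n T → Set
  x ≋ y = ∀ t i → x t i ≡ y t i

  solutions : ∀ n T → List (Solution n T)
  solutions n T = functions (functions (true ∷ false ∷ []) n) T

  solutions-complete : ∀ {n T} (x : Solution n T) → Any (x ≋_) (solutions n T)
  solutions-complete = functions-complete (functions-complete {R = _≡_}
    λ { true → here refl ; false → there (here refl) })

  ᵀ-cong : ∀ {n} (v : Fin n → Carrier) {y z : Fin n → Bool} → (∀ i → y i ≡ z i) → v ᵀ y ≡ v ᵀ z
  ᵀ-cong v y≗z = sum-cong-≗ λ i → cong (λ u → v i * ind u) (y≗z i)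

  sum-zero : ∀ {n} {f : Fin n → Carrier} → (∀ i → f i ≡ 0#) → sum f ≡ 0#
  sum-zero {zero}  f≡0 = refl
  sum-zero {suc n} f≡0 = trans (cong₂ _+_ (f≡0 zero) (sum-zero (f≡0 ∘ suc))) (+-identityʳ 0#)

  ᵀ-∅ : ∀ {n} (v : Fin n → Carrier) {z : Fin n → Bool} → (∀ i → z i ≡ false) → v ᵀ z ≡ 0#
  ᵀ-∅ v empty = sum-zero λ i → trans (cong (λ u → v i * ind u) (empty i)) (zeroʳ (v i))

  ∑∑-mono-≤-* : ∀ {n T} (r s : Carrier) {f g : Fin T → Fin n → Carrier} →
    (∀ t i → r * f t i ≤ s * g t i) → r * sum (λ t → sum (f t)) ≤ s * sum (λ t → sum (g t))
  ∑∑-mono-≤-* r s {f} {g} le = begin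
    r * sum (λ t → sum (f t))          ≡⟨ eq r f ⟩
    sum (λ t → sum (λ i → r * f t i))  ≤⟨ sum-mono-≤ (λ t → sum-mono-≤ (le t)) ⟩
    sum (λ t → sum (λ i → s * g t i))  ≡⟨ sym (eq s g) ⟩
    s * sum (λ t → sum (g t))          ∎
    where
    eq : ∀ x (h : Fin _ → Fin _ → Carrier) → x * sum (λ t → sum (h t)) ≡ sum (λ t → sum (λ i → x * h t i))
    eq x h = trans (*-distribˡ-sum x (λ t → sum (h t))) (sum-cong-≗ λ t → *-distribˡ-sum x (h t))

  -- `output` separated from the memory; the two agree by computation.
  fromInsertionTimes : ∀ {n T} → (Fin n → ℕ) → Solution n T
  fromInsertionTimes a t i = does (a i ℕₚ.≤? toℕ t)

  remaining : ∀ T a → sum {T} (λ t → ind (does (a ℕₚ.≤? toℕ t))) ≡ fromℕ (T ℕ.∸ a)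
  remaining zero zero = refl
  remaining zero (suc a) = refl
  remaining (suc T) zero = cong (λ u → 1# + u) (remaining T zero)
  remaining (suc T) (suc zero) = trans (+-identityˡ _) (remaining T zero)
  remaining (suc T) (suc (suc a)) = trans (+-identityˡ _) (remaining T (suc a))

  module _ {n T : ℕ} (I : Instance n T) where
    open Instance I

    private variable x y : Solution n T

    profit-cong : x ≋ y → profit I x ≡ profit I y
    profit-cong x≋y = sum-cong-≗ λ t → ᵀ-cong p (x≋y t)

    profit-nonNeg : ∀ x → 0# ≤ profit I x
    profit-nonNeg x = sum-nonNeg λ t → sum-nonNeg λ i → *-nonNeg (<⇒≤ (p-pos i)) (ind-nonNeg (x t i))

    profit-byItem : ∀ x → profit I x ≡ sum (λ i → p i * sum (λ t → ind (x t i)))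
    profit-byItem x = trans (∑-comm (λ t i → p i * ind (x t i)))
      (sum-cong-≗ λ i → sym (*-distribˡ-sum (p i) (λ t → ind (x t i))))

    -- An item earns its profit once for each time from its insertion on. Truncated subtraction
    -- gives 0 for items that are never inserted. The formula has n terms instead of n T, which is
    -- what `evaluate` relies on.
    profit-insertion : ∀ a → profit I (fromInsertionTimes a) ≡ sum (λ i → p i * fromℕ (T ℕ.∸ a i))
    profit-insertion a = trans (profit-byItem (fromInsertionTimes a))
      (sum-cong-≗ λ i → cong (λ u → p i * u) (remaining T (a i)))

    Feasible-resp : x ≋ y → Feasible I x → Feasible I y
    Feasible-resp x≋y fx = record
      { capacity = λ t → subst (_≤ b t) (ᵀ-cong w (x≋y t)) (capacity t)
      ; nested   = λ s t eq i → subst₂ Bool._≤_ (x≋y s i) (x≋y t i) (nested s t eq i)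
      }
      where open Feasible fx

    feasible? : Decidable (Feasible I)
    feasible? x = map′ (λ (c , n) → record { capacity = c ; nested = n })
                       (λ f → Feasible.capacity f , Feasible.nested f)
      (Finₚ.all? (λ t → w ᵀ x t ≤? b t) ×-dec
       Finₚ.all? (λ s → Finₚ.all? λ t → (toℕ t ℕₚ.≟ suc (toℕ s)) →-dec
         Finₚ.all? λ i → x s i Boolₚ.≤? x t i))

    oneIn? : Decidable (OneIn I)
    oneIn? x = Finₚ.any? λ t → Finₚ.any? λ i →
      (suc (toℕ t) ℕₚ.≟ T) ×-dec ((x t i Boolₚ.≟ true) ×-dec (p i ≟ 1#))

    OneIn-resp : x ≋ y → OneIn I x → OneIn I y
    OneIn-resp x≋y (t , i , last , xti , pi≡1) = t , i , last , trans (sym (x≋y t i)) xti , pi≡1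

    -- Up to `≋` there are finitely many solutions, so a decidable property that respects `≋` can be
    -- searched exhaustively; `x` shows that the search does not come back empty.
    maximum : {S : Pred (Solution n T) _} → Decidable S → (∀ {x y} → x ≋ y → S x → S y) →
      ∀ x → S x → ∃[ v ] IsMaximum I S v
    maximum {S} S? S-resp x Sx with maximal S? (profit I) (solutions n T)
    ... | inj₁ none = let y , x≋y , ¬Sy = find none (solutions-complete x)
                      in contradiction (S-resp x≋y Sx) ¬Sy
      where
      find : ∀ {xs} → All (¬_ ∘ S) xs → Any (x ≋_) xs → ∃[ y ] x ≋ y × ¬ S y
      find (¬Sy ∷ _)  (here x≋y)  = _ , x≋y , ¬Sy
      find (_ ∷ none) (there any) = find none any
    ... | inj₂ (m , Sm , max) = profit I m , (m , Sm , refl) , λ y Sy → bound max Sy (solutions-complete y)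
      where
      bound : ∀ {xs y} → All (λ z → S z → profit I z ≤ profit I m) xs → S y → Any (y ≋_) xs →
              profit I y ≤ profit I m
      bound (le ∷ _)  Sy (here y≋z)  =
        ≤-trans (≤-reflexive (profit-cong y≋z)) (le (S-resp y≋z Sy))
      bound (_ ∷ max) Sy (there any) = bound max Sy any

    insertion-nested : ∀ a (s t : Fin T) → toℕ t ≡ suc (toℕ s) → ∀ i →
      fromInsertionTimes {n} {T} a s i Bool.≤ fromInsertionTimes a t i
    insertion-nested a s t t≡1+s i = ⇒≤ λ a≤s → dec-true (a i ℕₚ.≤? toℕ t)
      (ℕₚ.≤-trans (does⇒ (a i ℕₚ.≤? toℕ s) a≤s)
        (subst (toℕ s ℕ.≤_) (sym t≡1+s) (ℕₚ.n≤1+n _)))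

    -- The empty solution is the first champion among the guesses.
    never-feasible : ∀ a → (∀ i → T ℕ.≤ a i) → Feasible I (fromInsertionTimes a)
    never-feasible a T≤a = record
      { capacity = λ t → ≤-trans (≤-reflexive (ᵀ-∅ w (never t))) (b-nonNeg t)
      ; nested = insertion-nested a }
      where
      never : ∀ t i → does (a i ℕₚ.≤? toℕ t) ≡ false
      never t i = dec-false (a i ℕₚ.≤? toℕ t)
        (ℕₚ.<⇒≱ (ℕₚ.<-≤-trans (Finₚ.toℕ<n t) (T≤a i)))

    never-profit : ∀ a → (∀ i → T ℕ.≤ a i) → profit I (fromInsertionTimes a) ≡ 0#
    never-profit a T≤a = trans (profit-insertion a) (sum-zero λ i → trans
      (cong (λ u → p i * fromℕ u) (ℕₚ.m≤n⇒m∸n≡0 (T≤a i))) (zeroʳ (p i)))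

    Feasible-mono : Feasible I x → ∀ {s t} i → s Fin.≤ t → x s i Bool.≤ x t i
    Feasible-mono {x} fx {s} {t} i s≤t = go t (ℕₚ.≤⇒≤′ s≤t) refl
      where
      open Feasible fx
      go : ∀ {m} t → toℕ s ℕ.≤′ m → toℕ t ≡ m → x s i Bool.≤ x t i
      go t (ℕ.≤′-reflexive s≡m) t≡m =
        Boolₚ.≤-reflexive (cong (λ u → x u i) (Finₚ.toℕ-injective (trans s≡m (sym t≡m))))
      go (suc t) (ℕ.≤′-step s≤m) t≡1+m = Boolₚ.≤-trans
        (go (inject₁ t) s≤m (trans (Finₚ.toℕ-inject₁ t) (ℕₚ.suc-injective t≡1+m)))
        (nested (inject₁ t) (suc t) (cong suc (sym (Finₚ.toℕ-inject₁ t))) i)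

    module _ (π : Permutation′ n) where

      permute : Instance n T
      permute = record
        { p = p ∘ (π ⟨$⟩ʳ_) ; w = w ∘ (π ⟨$⟩ʳ_) ; b = b
        ; p-pos = p-pos ∘ (π ⟨$⟩ʳ_) ; w-pos = w-pos ∘ (π ⟨$⟩ʳ_)
        ; b-nonNeg = b-nonNeg ; b-mono = b-mono }

      permuteSolution : Solution n T → Solution n T
      permuteSolution x t = x t ∘ (π ⟨$⟩ʳ_)

      ᵀ-permute : ∀ v z → v ᵀ z ≡ (v ∘ (π ⟨$⟩ʳ_)) ᵀ (z ∘ (π ⟨$⟩ʳ_))
      ᵀ-permute v z = sum-permute (λ i → v i * ind (z i)) π

      permute-feasible : ∀ {x} → Feasible I x → Feasible permute (permuteSolution x)
      permute-feasible {x} fx = record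
        { capacity = λ t → subst (_≤ b t) (ᵀ-permute w (x t)) (capacity t)
        ; nested = λ s t eq i → nested s t eq (π ⟨$⟩ʳ i) }
        where open Feasible fx

      unpermute-feasible : ∀ {x} → Feasible permute (permuteSolution x) → Feasible I x
      unpermute-feasible {x} fx = record
        { capacity = λ t → subst (_≤ b t) (sym (ᵀ-permute w (x t))) (capacity t)
        ; nested = λ s t eq i → subst (λ j → x s j Bool.≤ x t j) (inverseʳ π) (nested s t eq (π ⟨$⟩ˡ i)) }
        where open Feasible fx

      permute-profit : ∀ x → profit I x ≡ profit permute (permuteSolution x)
      permute-profit x = sum-cong-≗ λ t → ᵀ-permute p (x t)

  last : ∀ T → Fin (suc T)
  last T = Fin.fromℕ T

  -- Delaying to special times and rounding of profits

  module Rounding {ε : Carrier} (0<ε : 0# < ε) where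
    open Powers 0<ε

    abstract
      logℕ : ℕ → ℕ
      logℕ zero    = 0
      logℕ (suc s) = proj₁ (floorLog (fromℕ (suc s)) (1≤fromℕ {suc s} (ℕ.s≤s ℕ.z≤n)))

      logℕ-correct : ∀ {s} → 1 ℕ.≤ s → IsFloorLog β (fromℕ s) (+ logℕ s)
      logℕ-correct {suc s} _ = proj₂ (floorLog (fromℕ (suc s)) (1≤fromℕ {suc s} (ℕ.s≤s ℕ.z≤n)))

    β^logℕ≤ : ∀ {s} → 1 ℕ.≤ s → β ^ logℕ s ≤ fromℕ s
    β^logℕ≤ 1≤s = proj₁ (proj₂ (logℕ-correct 1≤s))

    <β^1+logℕ : ∀ {s} → 1 ℕ.≤ s → fromℕ s < β * β ^ logℕ s
    <β^1+logℕ 1≤s = proj₂ (proj₂ (logℕ-correct 1≤s))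

    -- s = ⌈β^j⌉ for some j
    special : ℕ → Bool
    special s = not (does (β ^ logℕ s ≤? fromℕ (s ℕ.∸ 1)))

    open Hold special public

    -- 1 = ⌈β^0⌉. So holding never alters the last row, and an item used there stays in use.
    special-1 : special 1 ≡ true
    special-1 = cong not (dec-false (β ^ logℕ 1 ≤? 0#) (<⇒≱ (^-pos (logℕ 1) 0<β)))

    -- An integer below ⌈β^(j+1)⌉ is below β^(j+1), so the rounded logarithm of `s` is at most `j`
    -- and its power is at most ⌈β^j⌉ ≤ s - 1. It suffices to test this one power: if any power lies
    -- in (s - 1, s], then so does the largest one that is at most `s`.
    between-ceilings : ∀ {j lo hi s} → IsCeil (β ^ j) lo → IsCeil (β ^ suc j) hi →
      lo ℕ.< s → s ℕ.< hi → special s ≡ false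
    between-ceilings {j} {lo} {hi} {suc s} (β^j≤lo , _) (_ , hi<β^1+j+1) (ℕ.s≤s lo≤s) 1+s<hi =
      cong not (dec-true (β ^ logℕ (suc s) ≤? fromℕ s) (begin
        β ^ logℕ (suc s)  ≤⟨ β^-mono-≤ (ℕ.s≤s⁻¹ (β^-cancel-< {logℕ (suc s)} {suc j} (begin-strict
          β ^ logℕ (suc s)  ≤⟨ β^logℕ≤ {suc s} 1≤1+s ⟩
          fromℕ (suc s)     <⟨ 1+s<β^1+j ⟩
          β ^ suc j         ∎))) ⟩
        β ^ j             ≤⟨ β^j≤lo ⟩
        fromℕ lo          ≤⟨ fromℕ-mono-≤ lo≤s ⟩
        fromℕ s           ∎))
      where
      1≤1+s : 1 ℕ.≤ suc s
      1≤1+s = ℕ.s≤s ℕ.z≤n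
      1+s<β^1+j : fromℕ (suc s) < β ^ suc j
      1+s<β^1+j = ≰⇒> λ β^1+j≤1+s → <⇒≱ hi<β^1+j+1 (begin
        β ^ suc j + 1#       ≤⟨ +-monoˡ-≤ 1# β^1+j≤1+s ⟩
        fromℕ (suc s) + 1#   ≡⟨ +-comm (fromℕ (suc s)) 1# ⟩
        fromℕ (suc (suc s))  ≤⟨ fromℕ-mono-≤ 1+s<hi ⟩
        fromℕ hi             ∎)

    sum-true : ∀ {T} {u : Fin T → Bool} → (∀ t → u t ≡ true) → sum (ind ∘ u) ≡ fromℕ T
    sum-true {zero}  all = refl
    sum-true {suc T} all = cong₂ _+_ (cong ind (all zero)) (sum-true (all ∘ suc))

    hold-true : ∀ {T} {u : Fin T → Bool} → (∀ t → u t ≡ true) → ∀ t → hold true u t ≡ true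
    hold-true {u = u} all t =
      hold-rel (λ a b → a ≡ true) {true} {true} {u} {u} refl all t

    -- At a special time all remaining times count from now on. Otherwise β^⌊log (T+1)⌋ ≤ T, so `T`
    -- has at least the same rounded logarithm: waiting one time does not weaken the bound. With one
    -- time left the second case is impossible.
    hold-true-count : ∀ {T} c {u : Fin (suc T) → Bool} → (∀ t → u t ≡ true) →
      β ^ logℕ (suc T) ≤ sum (ind ∘ hold c u)
    -- This comparison is what `special (suc T)` unfolds to, so the split also decides the first
    -- value of `hold`.
    hold-true-count {T} c {u} all with β ^ logℕ (suc T) ≤? fromℕ T
    ... | no _ = begin
      β ^ logℕ (suc T)                               ≤⟨ β^logℕ≤ {suc T} (ℕ.s≤s ℕ.z≤n) ⟩
      fromℕ (suc T)                                  ≡⟨ sym (cong₂ _+_ (cong ind (all zero)) (sum-true (λ t →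
        subst (λ a → hold a (u ∘ suc) t ≡ true) (sym (all zero)) (hold-true (all ∘ suc) t)))) ⟩
      ind (u zero) + sum (ind ∘ hold (u zero) (u ∘ suc))  ∎
    hold-true-count {zero} c {u} all | yes le = contradiction le (<⇒≱ (^-pos (logℕ 1) 0<β))
    hold-true-count {suc T} c {u} all | yes le = begin
      β ^ logℕ (suc (suc T))                ≤⟨ β^-mono-≤ (ℕ.s≤s⁻¹ (β^-cancel-< {logℕ (2 ℕ.+ T)} {suc (logℕ (suc T))}
                                                 (≤-<-trans le (<β^1+logℕ {suc T} (ℕ.s≤s ℕ.z≤n))))) ⟩
      β ^ logℕ (suc T)                      ≤⟨ hold-true-count c (all ∘ suc) ⟩
      sum (ind ∘ hold c (u ∘ suc))          ≤⟨ x≤y+x (ind-nonNeg c) ⟩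
      ind c + sum (ind ∘ hold c (u ∘ suc))  ∎

    -- Times before the insertion count nothing on either side. The recursion strips them, with
    -- `false` still as starting value, until `suc T` is the number of times remaining at the
    -- insertion; this is less than β times the power counted by `hold-true-count`.
    hold-count : ∀ {T} {u : Fin T → Bool} → (∀ {s t} → s Fin.≤ t → u s Bool.≤ u t) →
      sum (ind ∘ u) ≤ β * sum (ind ∘ hold false u)
    hold-count {zero} mono = ≤-reflexive (sym (zeroʳ β))
    hold-count {suc T} {u} mono = go (u zero) refl
      where
      go : ∀ b → u zero ≡ b → sum (ind ∘ u) ≤ β * sum (ind ∘ hold false u)
      go true u0 = begin
        sum (ind ∘ u)                 ≡⟨ sum-true all ⟩
        fromℕ (suc T)                 ≤⟨ <⇒≤ (<β^1+logℕ {suc T} (ℕ.s≤s ℕ.z≤n)) ⟩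
        β * β ^ logℕ (suc T)          ≤⟨ *-monoˡ-≤ 0≤β (hold-true-count false all) ⟩
        β * sum (ind ∘ hold false u)  ∎
        where
        all : ∀ t → u t ≡ true
        all t = ≤⇒ (mono ℕ.z≤n) u0
      go false u0 = begin
        ind (u zero) + sum (ind ∘ u ∘ suc)    ≡⟨ trans (cong (λ a → ind a + sum (ind ∘ u ∘ suc)) u0) (+-identityˡ _) ⟩
        sum (ind ∘ u ∘ suc)                   ≤⟨ hold-count (mono ∘ ℕ.s≤s) ⟩
        β * sum (ind ∘ hold false (u ∘ suc))  ≡⟨ cong (λ a → β * sum (ind ∘ hold a (u ∘ suc))) (sym h0) ⟩
        β * sum (ind ∘ hold (hold false u zero) (u ∘ suc))
                                              ≤⟨ *-monoˡ-≤ 0≤β (x≤y+x (ind-nonNeg (hold false u zero))) ⟩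
        β * sum (ind ∘ hold false u)          ∎
        where
        h0 : hold false u zero ≡ false
        h0 with special (suc T)
        ... | true  = u0
        ... | false = refl

    -- Here `a` is the profit of the guessed item and `b` that of the item to be rounded. Rounding
    -- `b / a` up to a power of `β ⁻¹` means rounding the logarithm of `a / b` down, and as `a / b`
    -- exceeds 1 in the second case, the result is a natural number, as the machine demands.
    IsExponent : Carrier → Carrier → ℕ → Set (c ⊔ ℓ)
    IsExponent a b e = a ≤ b × e ≡ 0 ⊎ (¬ a ≤ b) × IsFloorLog β (a / b) (+ e)

    abstract
      exponent : ∀ a {b} → 0# < b → ∃[ e ] IsExponent a b e
      exponent a {b} 0<b with a ≤? b
      ... | yes a≤b = 0 , inj₁ (a≤b , refl)
      ... | no a≰b = let m , log = floorLog (a / b)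
                           (*≤⇒≤/ 0<b (≤-trans (≤-reflexive (*-identityˡ b)) (≰⇒≥ a≰b)))
                     in m , inj₂ (a≰b , log)

    -- min (b / a) 1 rounded up to a power of β ⁻¹
    rounded : ∀ a {b} → 0# < b → Carrier
    rounded a 0<b = β ⁻¹ ^ proj₁ (exponent a 0<b)

    module _ (a : Carrier) {b : Carrier} (0<b : 0# < b) where
      private
        e : ℕ
        e = proj₁ (exponent a 0<b)

        β^*rounded : ∀ x → β ^ e * (x * rounded a 0<b) ≡ x
        β^*rounded x = begin-equality
          β ^ e * (x * β ⁻¹ ^ e)  ≡⟨ *-comm (β ^ e) _ ⟩
          x * β ⁻¹ ^ e * β ^ e    ≡⟨ *-assoc x _ _ ⟩
          x * (β ⁻¹ ^ e * β ^ e)  ≡⟨ cong (λ u → x * u) (trans (*-comm _ (β ^ e)) (^⁻¹-inverseʳ e 0<β)) ⟩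
          x * 1#                  ≡⟨ trans (*-comm x 1#) (*-identityˡ x) ⟩
          x                       ∎

      rounded-≡1 : a ≤ b → rounded a 0<b ≡ 1#
      rounded-≡1 a≤b with exponent a 0<b
      ... | _ , inj₁ (_ , refl) = refl
      ... | _ , inj₂ (a≰b , _) = contradiction a≤b a≰b

      -- This upper bound holds for every item, as the returned solution may use any of them. The
      -- lower bound `≤-rounded` is confined to items no more profitable than the guessed one, and
      -- the competitor uses only such items.
      rounded-≤ : a * rounded a 0<b ≤ β * b
      rounded-≤ with exponent a 0<b | β^*rounded a
      ... | _ , inj₁ (a≤b , refl) | _ = begin
        a * 1#  ≡⟨ trans (*-comm a 1#) (*-identityˡ a) ⟩
        a       ≤⟨ a≤b ⟩
        b       ≤⟨ x≤βx (<⇒≤ 0<b) ⟩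
        β * b   ∎
      ... | e , inj₂ (_ , _ , _ , hi) | cancel = *-cancelˡ-≤ (^-pos e 0<β) (begin
        β ^ e * (a * β ⁻¹ ^ e)  ≡⟨ cancel ⟩
        a                       ≤⟨ /≤⇒≤* 0<b (<⇒≤ hi) ⟩
        β * β ^ e * b           ≡⟨ cong (_* b) (*-comm β (β ^ e)) ⟩
        β ^ e * β * b           ≡⟨ *-assoc (β ^ e) β b ⟩
        β ^ e * (β * b)         ∎)

      ≤-rounded : b ≤ a → b ≤ a * rounded a 0<b
      ≤-rounded b≤a with exponent a 0<b | β^*rounded a
      ... | _ , inj₁ (_ , refl) | _ = ≤-trans b≤a (≤-reflexive (trans (sym (*-identityˡ a)) (*-comm 1# a)))
      ... | e , inj₂ (_ , _ , lo , _) | cancel = *-cancelˡ-≤ (^-pos e 0<β) (begin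
        β ^ e * b               ≤⟨ ≤/⇒*≤ 0<b lo ⟩
        a                       ≡⟨ sym cancel ⟩
        β ^ e * (a * β ⁻¹ ^ e)  ∎)

    β⁻¹^-anti : ∀ {m n} → m ℕ.≤ n → β ⁻¹ ^ n ≤ β ⁻¹ ^ m
    β⁻¹^-anti {m} {n} m≤n = *-cancelˡ-≤ (^-pos n 0<β) (begin
      β ^ n * β ⁻¹ ^ n  ≡⟨ trans (^⁻¹-inverseʳ n 0<β) (sym (^⁻¹-inverseʳ m 0<β)) ⟩
      β ^ m * β ⁻¹ ^ m  ≤⟨ *-monoʳ-≤ (<⇒≤ (β⁻¹^-pos m)) (β^-mono-≤ m≤n) ⟩
      β ^ n * β ⁻¹ ^ m  ∎)

    -- A more profitable item has a smaller ratio to `a` above it, hence a smaller exponent; cut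
    -- profits equal 1, the largest value there is. So sorted profits stay sorted.
    rounded-mono : ∀ a {b d} (0<b : 0# < b) (0<d : 0# < d) → b ≤ d → rounded a 0<b ≤ rounded a 0<d
    rounded-mono a {b} {d} 0<b 0<d b≤d with exponent a 0<b | exponent a 0<d
    ... | e , _ | _ , inj₁ (_ , refl) = β⁻¹^-anti {0} {e} ℕ.z≤n
    ... | _ , inj₁ (a≤b , _) | _ , inj₂ (a≰d , _) = contradiction (≤-trans a≤b b≤d) a≰d
    ... | e , inj₂ (_ , _ , _ , hi) | f , inj₂ (_ , _ , lo , _) =
      β⁻¹^-anti {f} {e} (ℕ.s≤s⁻¹ (β^-cancel-< {f} {suc e} (*-cancel-<
        (begin-strict
          d * β ^ f        ≡⟨ *-comm d _ ⟩
          β ^ f * d        ≤⟨ ≤/⇒*≤ 0<d lo ⟩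
          a                ≡⟨ sym (/-*-cancel a 0<b) ⟩
          a / b * b        ≡⟨ *-comm (a / b) b ⟩
          b * (a / b)      <⟨ *-monoˡ-< 0<b hi ⟩
          b * β ^ suc e    ≤⟨ *-monoʳ-≤ (<⇒≤ (^-pos (suc e) 0<β)) b≤d ⟩
          d * β ^ suc e    ∎))))
      where
      *-cancel-< : ∀ {x y} → d * x < d * y → x < y
      *-cancel-< dx<dy = ≰⇒> λ y≤x → <⇒≱ dx<dy (*-monoˡ-≤ (<⇒≤ 0<d) y≤x)

    -- Arithmetic of the approximation factors

    swap : ∀ u v z → u * (v * z) ≡ v * (u * z)
    swap u v z = trans (sym (*-assoc u v z)) (trans (cong (_* z) (*-comm u v)) (*-assoc v u z))

    1-4ε 1-2ε : Carrier
    1-4ε = 1# - fromℕ 4 * ε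
    1-2ε = 1# - fromℕ 2 * ε

    x-[y+ε]+ε : ∀ x y → x - (y + ε) + ε ≡ x - y
    x-[y+ε]+ε x y = begin-equality
      x + - (y + ε) + ε    ≡⟨ cong (λ u → x + u + ε) (sym (-‿+-comm y ε)) ⟩
      x + (- y - ε) + ε    ≡⟨ cong (_+ ε) (sym (+-assoc x (- y) (- ε))) ⟩
      x - y - ε + ε        ≡⟨ -‿cancelʳ (x - y) ε ⟩
      x - y                ∎

    2ε≡ε+ε : fromℕ 2 * ε ≡ ε + ε
    2ε≡ε+ε = begin-equality
      (1# + fromℕ 1) * ε  ≡⟨ cong (λ u → (1# + u) * ε) fromℕ-1 ⟩
      (1# + 1#) * ε       ≡⟨ distribʳ ε 1# 1# ⟩
      1# * ε + 1# * ε     ≡⟨ cong₂ _+_ (*-identityˡ ε) (*-identityˡ ε) ⟩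
      ε + ε               ∎

    4ε≡2ε+ε+ε : fromℕ 4 * ε ≡ fromℕ 2 * ε + ε + ε
    4ε≡2ε+ε+ε = begin-equality
      fromℕ (2 ℕ.+ 2) * ε        ≡⟨ cong (_* ε) (fromℕ-+ 2 2) ⟩
      (fromℕ 2 + fromℕ 2) * ε    ≡⟨ distribʳ ε _ _ ⟩
      fromℕ 2 * ε + fromℕ 2 * ε  ≡⟨ cong (λ u → fromℕ 2 * ε + u) 2ε≡ε+ε ⟩
      fromℕ 2 * ε + (ε + ε)      ≡⟨ sym (+-assoc _ ε ε) ⟩
      fromℕ 2 * ε + ε + ε        ∎

    1-4ε+ε+ε : 1-4ε + ε + ε ≡ 1-2ε
    1-4ε+ε+ε = begin-equality
      1# - fromℕ 4 * ε + ε + ε            ≡⟨ cong (λ u → 1# - u + ε + ε) 4ε≡2ε+ε+ε ⟩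
      1# - (fromℕ 2 * ε + ε + ε) + ε + ε  ≡⟨ cong (_+ ε) (x-[y+ε]+ε 1# (fromℕ 2 * ε + ε)) ⟩
      1# - (fromℕ 2 * ε + ε) + ε          ≡⟨ x-[y+ε]+ε 1# (fromℕ 2 * ε) ⟩
      1# - fromℕ 2 * ε                    ∎

    1-2ε≤1 : 1-2ε ≤ 1#
    1-2ε≤1 = begin
      1# - fromℕ 2 * ε                ≤⟨ x≤x+y (*-nonNeg (fromℕ-nonNeg 2) (<⇒≤ 0<ε)) ⟩
      1# - fromℕ 2 * ε + fromℕ 2 * ε  ≡⟨ -‿cancelʳ 1# (fromℕ 2 * ε) ⟩
      1#                              ∎

    βx≤x+ε : ∀ {x} → x ≤ 1# → β * x ≤ x + ε
    βx≤x+ε {x} x≤1 = begin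
      (1# + ε) * x     ≡⟨ distribʳ x 1# ε ⟩
      1# * x + ε * x   ≤⟨ +-mono-≤ (≤-reflexive (*-identityˡ x)) (*-monoˡ-≤ (<⇒≤ 0<ε) x≤1) ⟩
      x + ε * 1#       ≡⟨ cong (λ u → x + u) (trans (*-comm ε 1#) (*-identityˡ ε)) ⟩
      x + ε            ∎

    -- Multiplying a number of at most 1 by β adds at most ε, so the two factors lead from 1 - 4ε
    -- over 1 - 3ε to 1 - 2ε. The sign of 1 - 4ε does not enter.
    ββ[1-4ε]≤1-2ε : β * (β * 1-4ε) ≤ 1-2ε
    ββ[1-4ε]≤1-2ε = begin
      β * (β * 1-4ε)   ≤⟨ *-monoˡ-≤ 0≤β (βx≤x+ε (≤-trans (x≤x+y (<⇒≤ 0<ε)) 1-3ε≤1)) ⟩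
      β * (1-4ε + ε)   ≤⟨ βx≤x+ε 1-3ε≤1 ⟩
      1-4ε + ε + ε     ≡⟨ 1-4ε+ε+ε ⟩
      1-2ε             ∎
      where
      1-3ε≤1 : 1-4ε + ε ≤ 1#
      1-3ε≤1 = ≤-trans (x≤x+y (<⇒≤ 0<ε)) (≤-trans (≤-reflexive 1-4ε+ε+ε) 1-2ε≤1)

    1-4ε≤1-2ε : 1-4ε ≤ 1-2ε
    1-4ε≤1-2ε = ≤-trans (x≤x+y (<⇒≤ 0<ε)) (≤-trans (x≤x+y (<⇒≤ 0<ε)) (≤-reflexive 1-4ε+ε+ε))

    -- The well-behaved instance of a guess

    module Guess {n T : ℕ} (J : Instance n (suc T))
                 (sorted : ∀ {i j} → i Fin.≤ j → Instance.p J j ≤ Instance.p J i) (k : Fin n) where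
      open Instance J

      module HoldBool = Monotone Bool._≤_ Boolₚ.≤-refl Boolₚ.≤-trans
      module HoldCarrier = Monotone _≤_ ≤-refl ≤-trans

      -- An item j more profitable than k gets profit 1 but stays available, as
      -- p k * p′ j ≤ β * p j holds for it too.
      p′ : Fin n → Carrier
      p′ j = rounded (p k) (p-pos j)

      -- Items and weights are kept and the capacities do not mention `k`: between two guesses only
      -- the profits have to be rewritten.
      guess : Instance n (suc T)
      guess = record
        { p = p′ ; w = w ; b = hold 0# b
        ; p-pos = λ j → β⁻¹^-pos (proj₁ (exponent (p k) (p-pos j))) ; w-pos = w-pos
        ; b-nonNeg = HoldCarrier.hold-lower b-mono b-nonNeg
        ; b-mono = HoldCarrier.hold-mono b-mono b-nonNeg }

      guess-wellBehaved : WellBehaved guess ε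
      guess-wellBehaved = record
        { normalized = record
          -- The first item is at least as profitable as `k`, so cutting alone normalizes the
          -- profits.
          { first≡1 = λ i i≡0 → rounded-≡1 (p k) (p-pos i) (sorted (subst (ℕ._≤ toℕ k) (sym i≡0) ℕ.z≤n))
          ; decreasing = λ {i} {j} i≤j → rounded-mono (p k) (p-pos j) (p-pos i) (sorted i≤j) }
        ; ε1 = ε1
        -- Since j is at least 1, it is a successor, and the two ceilings belong to consecutive
        -- powers.
        ; ε2 = λ { t (suc j , _ , _ , _ , _ , _ , _ , lo , hi , lo< , <hi) →
            trans (hold-skip 0# b t (between-ceilings {j} lo hi lo< <hi)) (before≡previous t) } }
        where
        before≡previous : ∀ t → before 0# (hold 0# b) t ≡ previous guess t
        before≡previous zero    = refl
        before≡previous (suc t) = refl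
        0<T : 0# < fromℕ (suc T)
        0<T = fromℕ-pos {suc T} (ℕ.s≤s ℕ.z≤n)
        ε1 : ∀ i →
          (∃[ j ] ∃[ m ] IsCeilLog β (fromℕ (suc T) / ε) m × + j ℤ.≤ m × p′ i ≡ β ^ᶻ (ℤ.- (+ j)))
          ⊎ p′ i ≤ ε / fromℕ (suc T)
        -- Every new profit is a power of `β ⁻¹`; only the range of its exponent is in question. A
        -- profit above ε/T has β^e < T/ε. This also gives T/ε > 1, as `ceilLog` requires.
        ε1 i with p′ i ≤? ε / fromℕ (suc T)
        ... | yes small = inj₂ small
        ... | no ¬small = inj₁ (e , + proj₁ log , proj₂ log , ℤ.+≤+ e≤m , sym (β^ᶻ-neg e))
          where
          e : ℕ
          e = proj₁ (exponent (p k) (p-pos i))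
          β^e<T/ε : β ^ e < fromℕ (suc T) / ε
          β^e<T/ε = ≰⇒> λ T/ε≤β^e → ¬small (*≤⇒≤/ 0<T (begin
            β ⁻¹ ^ e * fromℕ (suc T)  ≤⟨ *-monoˡ-≤ (<⇒≤ (β⁻¹^-pos e)) (/≤⇒≤* 0<ε T/ε≤β^e) ⟩
            β ⁻¹ ^ e * (β ^ e * ε)    ≡⟨ sym (*-assoc _ _ ε) ⟩
            β ⁻¹ ^ e * β ^ e * ε      ≡⟨ cong (_* ε) (trans (*-comm _ (β ^ e)) (^⁻¹-inverseʳ e 0<β)) ⟩
            1# * ε                    ≡⟨ *-identityˡ ε ⟩
            ε                         ∎))
          log : ∃[ m ] IsCeilLog β (fromℕ (suc T) / ε) (+ m)
          log = ceilLog (fromℕ (suc T) / ε) (≤-<-trans (1≤β^ e) β^e<T/ε)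
          e≤m : e ℕ.≤ proj₁ log
          e≤m = ℕₚ.<⇒≤ (β^-cancel-< {e} {proj₁ log} (<-≤-trans β^e<T/ε (proj₂ (proj₂ (proj₂ log)))))

      guess-feasible⇒feasible : ∀ {y} → Feasible guess y → Feasible J y
      guess-feasible⇒feasible fy = record
        { capacity = λ t → ≤-trans (capacity t) (HoldCarrier.hold-upper b-mono b-nonNeg t)
        ; nested = nested }
        where open Feasible fy

      Candidate : (Solution n (suc T) → Set (c ⊔ ℓ))
      Candidate x = Feasible guess x × OneIn guess x

      module _ {x : Solution n (suc T)} (fx : Feasible J x)
               (xk : x (last T) k ≡ true) (first : ∀ j → x (last T) j ≡ true → k Fin.≤ j) where
        open Feasible fx

        x′ : Solution n (suc T)
        x′ = hold (λ _ → false) x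

        x′-item : ∀ t i → x′ t i ≡ hold false (λ s → x s i) t
        x′-item t i = hold-rel (λ z a → z i ≡ a) {λ _ → false} {false} {x} {λ s → x s i} refl (λ _ → refl) t

        x′-mono : ∀ {s t} i → s Fin.≤ t → x′ s i Bool.≤ x′ t i
        x′-mono {s} {t} i s≤t = subst₂ Bool._≤_ (sym (x′-item s i)) (sym (x′-item t i))
          (HoldBool.hold-mono (Feasible-mono J fx i) (λ _ → Boolₚ.≤-minimum _) s≤t)

        x′≤x : ∀ t i → x′ t i Bool.≤ x t i
        x′≤x t i = subst (Bool._≤ x t i) (sym (x′-item t i))
          (HoldBool.hold-upper (Feasible-mono J fx i) (λ _ → Boolₚ.≤-minimum _) t)

        x′-candidate : Candidate x′
        x′-candidate = record
            -- Rows and capacities are held at the same times; until the first special time an empty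
            -- row meets capacity 0.
            { capacity = hold-rel (λ z d → w ᵀ z ≤ d) (≤-reflexive (ᵀ-∅ w λ _ → refl)) capacity
            ; nested = λ s t eq i → x′-mono i (ℕₚ.≤-trans (ℕₚ.n≤1+n _) (ℕₚ.≤-reflexive (sym eq))) }
          , last T , k , cong suc (Finₚ.toℕ-fromℕ T)
          , trans (cong (λ z → z k) (hold-special (λ _ → false) x (last T)
              (trans (cong (λ s → special (suc T ℕ.∸ s)) (Finₚ.toℕ-fromℕ T))
                (trans (cong special (ℕₚ.m+n∸n≡m 1 T)) special-1)))) xk
          , rounded-≡1 (p k) (p-pos k) ≤-refl

        x≤βx′ : profit J x ≤ β * profit J x′
        x≤βx′ = begin
          profit J x ≡⟨ profit-byItem J x ⟩
          sum (λ i → p i * sum (λ t → ind (x t i)))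
            ≤⟨ sum-mono-≤ (λ i → *-monoˡ-≤ (<⇒≤ (p-pos i)) (hold-count (Feasible-mono J fx i))) ⟩
          sum (λ i → p i * (β * sum (λ t → ind (hold false (λ s → x s i) t))))
            ≡⟨ sum-cong-≗ (λ i → trans (swap (p i) β _) (cong (λ u → β * (p i * u))
                 (sum-cong-≗ λ t → cong ind (sym (x′-item t i))))) ⟩
          sum (λ i → β * (p i * sum (λ t → ind (x′ t i))))
            ≡⟨ sym (*-distribˡ-sum β (λ i → p i * sum (λ t → ind (x′ t i)))) ⟩
          β * sum (λ i → p i * sum (λ t → ind (x′ t i)))
            ≡⟨ cong (λ u → β * u) (sym (profit-byItem J x′)) ⟩
          β * profit J x′ ∎

        x′≤p*x′ : profit J x′ ≤ p k * profit guess x′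
        x′≤p*x′ = subst (_≤ p k * profit guess x′) (*-identityˡ (profit J x′))
          (∑∑-mono-≤-* 1# (p k) λ t j → item t j (x′ t j) refl)
          where
          item : ∀ t j b → x′ t j ≡ b → 1# * (p j * ind b) ≤ p k * (p′ j * ind b)
          item t j false _ = ≤-reflexive (trans (trans (*-identityˡ _) (zeroʳ (p j)))
            (sym (trans (cong (λ u → p k * u) (zeroʳ (p′ j))) (zeroʳ (p k)))))
          -- An item of `x′` is in `x` at that time and so at the last time, whence it does not
          -- precede `k` and is no more profitable.
          item t j true x′tj = begin
            1# * (p j * 1#)    ≡⟨ trans (*-identityˡ _) (*-identityʳ (p j)) ⟩
            p j                ≤⟨ ≤-rounded (p k) (p-pos j) (sorted (first j
                                    (≤⇒ (Feasible-mono J fx j (Finₚ.≤fromℕ t)) (≤⇒ (x′≤x t j) x′tj)))) ⟩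
            p k * p′ j         ≡⟨ cong (λ u → p k * u) (sym (*-identityʳ (p′ j))) ⟩
            p k * (p′ j * 1#)  ∎

        -- `x′` competes for the maximum of the guessed instance, and `y` is compared with that
        -- maximum. To avoid division, both sides carry two factors β, which are cancelled at the
        -- end.
        guess-good : ∀ {y} → AtLeast_TimesMaxOf guess 1-2ε Candidate y → 1-4ε * profit J x ≤ profit J y
        guess-good {y} good with 0# ≤? 1-4ε
        -- With a negative factor the left side is at most 0; the estimates of the other case
        -- multiply by it.
        ... | no ¬0≤ = begin
          1-4ε * profit J x  ≤⟨ *-monoʳ-≤ (profit-nonNeg J x) (≰⇒≥ ¬0≤) ⟩
          0# * profit J x    ≡⟨ zeroˡ _ ⟩
          0#                 ≤⟨ profit-nonNeg J y ⟩
          profit J y         ∎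
        ... | yes 0≤1-4ε = *-cancelˡ-≤ 0<β (*-cancelˡ-≤ 0<β (begin
          β * (β * (1-4ε * V))    ≡⟨ trans (cong (λ u → β * u) (sym (*-assoc β 1-4ε V)))
                                       (sym (*-assoc β (β * 1-4ε) V)) ⟩
          β * (β * 1-4ε) * V      ≤⟨ *-mono-≤ (*-nonNeg 0≤β (*-nonNeg 0≤β 0≤1-4ε))
                                        (*-nonNeg 0≤β (*-nonNeg 0≤pk (profit-nonNeg guess x′)))
                                        ββ[1-4ε]≤1-2ε (≤-trans x≤βx′ (*-monoˡ-≤ 0≤β x′≤p*x′)) ⟩
          1-2ε * (β * (p k * profit guess x′))
                                  ≤⟨ *-monoˡ-≤ 0≤1-2ε (*-monoˡ-≤ 0≤β (*-monoˡ-≤ 0≤pk (proj₂ (proj₂ max) x′ x′-candidate))) ⟩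
          1-2ε * (β * (p k * v))  ≡⟨ trans (swap 1-2ε β _) (cong (λ u → β * u) (swap 1-2ε (p k) v)) ⟩
          β * (p k * (1-2ε * v))  ≤⟨ *-monoˡ-≤ 0≤β (*-monoˡ-≤ 0≤pk (good v (proj₂ max))) ⟩
          β * (p k * profit guess y)
                                  ≤⟨ *-monoˡ-≤ 0≤β (∑∑-mono-≤-* (p k) β item) ⟩
          β * (β * profit J y)    ∎))
          where
          V : Carrier
          V = profit J x
          0≤pk : 0# ≤ p k
          0≤pk = <⇒≤ (p-pos k)
          0≤1-2ε : 0# ≤ 1-2ε
          0≤1-2ε = ≤-trans 0≤1-4ε 1-4ε≤1-2ε
          max : ∃[ v ] IsMaximum guess Candidate v
          max = maximum guess (λ z → feasible? guess z ×-dec oneIn? guess z)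
            (λ z≋z′ (fz , oz) → Feasible-resp guess z≋z′ fz , OneIn-resp guess z≋z′ oz) x′ x′-candidate
          v : Carrier
          v = proj₁ max
          item : ∀ t j → p k * (p′ j * ind (y t j)) ≤ β * (p j * ind (y t j))
          item t j = begin
            p k * (p′ j * ind (y t j))  ≡⟨ sym (*-assoc (p k) (p′ j) _) ⟩
            p k * p′ j * ind (y t j)    ≤⟨ *-monoʳ-≤ (ind-nonNeg (y t j)) (rounded-≤ (p k) (p-pos j)) ⟩
            β * p j * ind (y t j)       ≡⟨ *-assoc β (p j) _ ⟩
            β * (p j * ind (y t j))     ∎

∨-falseˡ : ∀ {x y} → x ∨ y ≡ false → x ≡ false
∨-falseˡ {false} _ = refl

∨-falseʳ : ∀ {x y} → x ∨ y ≡ false → y ≡ false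
∨-falseʳ {false} y≡false = y≡false

-- Frame properties of programs

module MachineProperties {c ℓ : Level} (K : ArchimedeanOrderedField c ℓ) where
  open ArchimedeanOrderedField K using (Carrier; fromℕ; _≤?_; IsFloorLog; IsFloor)
  open Machine K

  -- Boolean functions of the syntax, so that for a concrete program and array the absence of writes
  -- is proved by `refl`.
  writesᴺ writesᴿ : Program → ℕ → Bool
  writesᴺ skip                     b = false
  writesᴺ (a [ i ]≔ᴺ e)            b = b ≡ᵇ a
  writesᴺ (a [ i ]≔ᴿ e)            b = false
  writesᴺ (a [ i ]≔⌊ e ⌋)          b = b ≡ᵇ a
  writesᴺ (a [ i ]≔⌊log d , e ⌋)   b = b ≡ᵇ a
  writesᴺ (P ⨟ Q)                  b = writesᴺ P b ∨ writesᴺ Q b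
  writesᴺ (when t then P else Q)   b = writesᴺ P b ∨ writesᴺ Q b
  writesᴺ (while t loop P)         b = writesᴺ P b

  writesᴿ skip                     b = false
  writesᴿ (a [ i ]≔ᴺ e)            b = false
  writesᴿ (a [ i ]≔ᴿ e)            b = b ≡ᵇ a
  writesᴿ (a [ i ]≔⌊ e ⌋)          b = false
  writesᴿ (a [ i ]≔⌊log d , e ⌋)   b = false
  writesᴿ (P ⨟ Q)                  b = writesᴿ P b ∨ writesᴿ Q b
  writesᴿ (when t then P else Q)   b = writesᴿ P b ∨ writesᴿ Q b
  writesᴿ (while t loop P)         b = writesᴿ P b

  -- The frame condition. Indexing it by the program makes it available for every run through
  -- `⇓-unchanged`, with no list of arrays to maintain.
  record Unchanged (P : Program) (σ σ′ : Memory) : Set c where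
    constructor unchanged
    field
      sameᴺ : ∀ a → writesᴺ P a ≡ false → ∀ i → natural σ′ a i ≡ natural σ a i
      sameᴿ : ∀ a → writesᴿ P a ≡ false → ∀ i → real σ′ a i ≡ real σ a i
  open Unchanged public

  private variable
    P Q : Program
    σ σ₁ σ₂ : Memory

  update-other : ∀ {x} {A : Set x} (f : ℕ → ℕ → A) {a i v a′} → (a′ ≡ᵇ a) ≡ false →
    ∀ i′ → update f a i v a′ i′ ≡ f a′ i′
  update-other f a′≢a i′ rewrite a′≢a = refl

  Unchanged-trans : Unchanged P σ σ₁ → Unchanged P σ₁ σ₂ → Unchanged P σ σ₂
  Unchanged-trans (unchanged n r) (unchanged n′ r′) = unchanged
    (λ a eq i → trans (n′ a eq i) (n a eq i)) (λ a eq i → trans (r′ a eq i) (r a eq i))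

  Unchanged-weaken : (∀ a → writesᴺ Q a ≡ false → writesᴺ P a ≡ false) →
    (∀ a → writesᴿ Q a ≡ false → writesᴿ P a ≡ false) → Unchanged P σ σ₁ → Unchanged Q σ σ₁
  Unchanged-weaken n r (unchanged n′ r′) = unchanged (λ a → n′ a ∘ n a) (λ a → r′ a ∘ r a)

  ⇓-unchanged : ∀ {k} → P ∣ σ ⇓ σ₁ ∣ k → Unchanged P σ σ₁
  ⇓-unchanged ⇓skip = unchanged (λ _ _ _ → refl) (λ _ _ _ → refl)
  ⇓-unchanged {σ = σ} ⇓assignᴺ = unchanged (λ _ → update-other (natural σ)) (λ _ _ _ → refl)
  ⇓-unchanged {σ = σ} ⇓assignᴿ = unchanged (λ _ _ _ → refl) (λ _ → update-other (real σ))
  ⇓-unchanged {σ = σ} (⇓floor _) = unchanged (λ _ → update-other (natural σ)) (λ _ _ _ → refl)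
  ⇓-unchanged {σ = σ} (⇓log _) = unchanged (λ _ → update-other (natural σ)) (λ _ _ _ → refl)
  ⇓-unchanged (⇓seq {P} {Q} p q) = Unchanged-trans
    (Unchanged-weaken (λ _ → ∨-falseˡ) (λ _ → ∨-falseˡ) (⇓-unchanged p))
    (Unchanged-weaken (λ a → ∨-falseʳ {writesᴺ P a}) (λ a → ∨-falseʳ {writesᴿ P a}) (⇓-unchanged q))
  ⇓-unchanged (⇓when-true _ p) = Unchanged-weaken (λ _ → ∨-falseˡ) (λ _ → ∨-falseˡ) (⇓-unchanged p)
  ⇓-unchanged (⇓when-false {P = P} _ q) =
    Unchanged-weaken (λ a → ∨-falseʳ {writesᴺ P a}) (λ a → ∨-falseʳ {writesᴿ P a}) (⇓-unchanged q)
  ⇓-unchanged (⇓while-true _ p w) = Unchanged-trans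
    (Unchanged-weaken (λ _ → id) (λ _ → id) (⇓-unchanged p)) (⇓-unchanged w)
  ⇓-unchanged (⇓while-false _) = unchanged (λ _ _ _ → refl) (λ _ _ _ → refl)

  ⇓-cost : ∀ {k k′} → k ≡ k′ → P ∣ σ ⇓ σ₁ ∣ k → P ∣ σ ⇓ σ₁ ∣ k′
  ⇓-cost refl p = p

  -- Renaming the arrays of a program

  module Renaming (ρ : ℕ → ℕ) (ρ-reflects : ∀ a b → (ρ a ≡ᵇ ρ b) ≡ (a ≡ᵇ b)) where

    renameᴺ : NExp → NExp
    renameᴺ (lit k)   = lit k
    renameᴺ (a [ e ]) = ρ a [ renameᴺ e ]
    renameᴺ (d ⊕ e)   = renameᴺ d ⊕ renameᴺ e
    renameᴺ (d ⊖ e)   = renameᴺ d ⊖ renameᴺ e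
    renameᴺ (d ⊗ e)   = renameᴺ d ⊗ renameᴺ e

    renameᴿ : RExp → RExp
    renameᴿ (nat e)   = nat (renameᴺ e)
    renameᴿ (a [ e ]) = ρ a [ renameᴺ e ]
    renameᴿ (d ⊕ e)   = renameᴿ d ⊕ renameᴿ e
    renameᴿ (d ⊖ e)   = renameᴿ d ⊖ renameᴿ e
    renameᴿ (d ⊗ e)   = renameᴿ d ⊗ renameᴿ e
    renameᴿ (d ⊘ e)   = renameᴿ d ⊘ renameᴿ e
    renameᴿ (d ↑ e)   = renameᴿ d ↑ renameᴺ e

    renameᵀ : Test → Test
    renameᵀ (d ≤ᴺ e) = renameᴺ d ≤ᴺ renameᴺ e
    renameᵀ (d ≤ᴿ e) = renameᴿ d ≤ᴿ renameᴿ e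

    rename : Program → Program
    rename skip                   = skip
    rename (a [ i ]≔ᴺ e)          = ρ a [ renameᴺ i ]≔ᴺ renameᴺ e
    rename (a [ i ]≔ᴿ e)          = ρ a [ renameᴺ i ]≔ᴿ renameᴿ e
    rename (a [ i ]≔⌊ e ⌋)        = ρ a [ renameᴺ i ]≔⌊ renameᴿ e ⌋
    rename (a [ i ]≔⌊log d , e ⌋) = ρ a [ renameᴺ i ]≔⌊log renameᴿ d , renameᴿ e ⌋
    rename (P ⨟ Q)                = rename P ⨟ rename Q
    rename (when t then P else Q) = when renameᵀ t then rename P else rename Q
    rename (while t loop P)       = while renameᵀ t loop rename P

    rename-writesᴺ : ∀ {b} → (∀ a → (b ≡ᵇ ρ a) ≡ false) → ∀ P → writesᴺ (rename P) b ≡ false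
    rename-writesᴺ new skip                   = refl
    rename-writesᴺ new (a [ i ]≔ᴺ e)          = new a
    rename-writesᴺ new (a [ i ]≔ᴿ e)          = refl
    rename-writesᴺ new (a [ i ]≔⌊ e ⌋)        = new a
    rename-writesᴺ new (a [ i ]≔⌊log d , e ⌋) = new a
    rename-writesᴺ new (P ⨟ Q)                = cong₂ _∨_ (rename-writesᴺ new P) (rename-writesᴺ new Q)
    rename-writesᴺ new (when t then P else Q) = cong₂ _∨_ (rename-writesᴺ new P) (rename-writesᴺ new Q)
    rename-writesᴺ new (while t loop P)       = rename-writesᴺ new P

    rename-writesᴿ : ∀ {b} → (∀ a → (b ≡ᵇ ρ a) ≡ false) → ∀ P → writesᴿ (rename P) b ≡ false
    rename-writesᴿ new skip                   = refl
    rename-writesᴿ new (a [ i ]≔ᴺ e)          = refl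
    rename-writesᴿ new (a [ i ]≔ᴿ e)          = new a
    rename-writesᴿ new (a [ i ]≔⌊ e ⌋)        = refl
    rename-writesᴿ new (a [ i ]≔⌊log d , e ⌋) = refl
    rename-writesᴿ new (P ⨟ Q)                = cong₂ _∨_ (rename-writesᴿ new P) (rename-writesᴿ new Q)
    rename-writesᴿ new (when t then P else Q) = cong₂ _∨_ (rename-writesᴿ new P) (rename-writesᴿ new Q)
    rename-writesᴿ new (while t loop P)       = rename-writesᴿ new P

    costᴺ-rename : ∀ e → costᴺ (renameᴺ e) ≡ costᴺ e
    costᴺ-rename (lit k)   = refl
    costᴺ-rename (a [ e ]) = cong suc (costᴺ-rename e)
    costᴺ-rename (d ⊕ e)   = cong suc (cong₂ ℕ._+_ (costᴺ-rename d) (costᴺ-rename e))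
    costᴺ-rename (d ⊖ e)   = cong suc (cong₂ ℕ._+_ (costᴺ-rename d) (costᴺ-rename e))
    costᴺ-rename (d ⊗ e)   = cong suc (cong₂ ℕ._+_ (costᴺ-rename d) (costᴺ-rename e))

    costᴿ-rename : ∀ e → costᴿ (renameᴿ e) ≡ costᴿ e
    costᴿ-rename (nat e)   = cong suc (costᴺ-rename e)
    costᴿ-rename (a [ e ]) = cong suc (costᴺ-rename e)
    costᴿ-rename (d ⊕ e)   = cong suc (cong₂ ℕ._+_ (costᴿ-rename d) (costᴿ-rename e))
    costᴿ-rename (d ⊖ e)   = cong suc (cong₂ ℕ._+_ (costᴿ-rename d) (costᴿ-rename e))
    costᴿ-rename (d ⊗ e)   = cong suc (cong₂ ℕ._+_ (costᴿ-rename d) (costᴿ-rename e))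
    costᴿ-rename (d ⊘ e)   = cong suc (cong₂ ℕ._+_ (costᴿ-rename d) (costᴿ-rename e))
    costᴿ-rename (d ↑ e)   = cong suc (cong₂ ℕ._+_ (costᴿ-rename d) (costᴺ-rename e))

    costᵀ-rename : ∀ t → costᵀ (renameᵀ t) ≡ costᵀ t
    costᵀ-rename (d ≤ᴺ e) = cong suc (cong₂ ℕ._+_ (costᴺ-rename d) (costᴺ-rename e))
    costᵀ-rename (d ≤ᴿ e) = cong suc (cong₂ ℕ._+_ (costᴿ-rename d) (costᴿ-rename e))

    infix 4 _≈_
    -- Nothing is said about arrays of `τ` outside the image of `ρ`; the caller keeps its own data
    -- there.
    record _≈_ (τ σ : Memory) : Set c where
      constructor simulates
      field
        ≈ᴺ : ∀ a i → natural τ (ρ a) i ≡ natural σ a i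
        ≈ᴿ : ∀ a i → real τ (ρ a) i ≡ real σ a i
    open _≈_ public

    module _ {τ σ : Memory} (τ≈σ : τ ≈ σ) where

      ⟦renameᴺ⟧ : ∀ e → ⟦ renameᴺ e ⟧ᴺ τ ≡ ⟦ e ⟧ᴺ σ
      ⟦renameᴺ⟧ (lit k)   = refl
      ⟦renameᴺ⟧ (a [ e ]) = trans (cong (natural τ (ρ a)) (⟦renameᴺ⟧ e)) (≈ᴺ τ≈σ a _)
      ⟦renameᴺ⟧ (d ⊕ e)   = cong₂ ℕ._+_ (⟦renameᴺ⟧ d) (⟦renameᴺ⟧ e)
      ⟦renameᴺ⟧ (d ⊖ e)   = cong₂ ℕ._∸_ (⟦renameᴺ⟧ d) (⟦renameᴺ⟧ e)
      ⟦renameᴺ⟧ (d ⊗ e)   = cong₂ ℕ._*_ (⟦renameᴺ⟧ d) (⟦renameᴺ⟧ e)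

      open ArchimedeanOrderedField K using (_+_; _*_; _-_; _/_; _^_)

      ⟦renameᴿ⟧ : ∀ e → ⟦ renameᴿ e ⟧ᴿ τ ≡ ⟦ e ⟧ᴿ σ
      ⟦renameᴿ⟧ (nat e)   = cong fromℕ (⟦renameᴺ⟧ e)
      ⟦renameᴿ⟧ (a [ e ]) = trans (cong (real τ (ρ a)) (⟦renameᴺ⟧ e)) (≈ᴿ τ≈σ a _)
      ⟦renameᴿ⟧ (d ⊕ e)   = cong₂ _+_ (⟦renameᴿ⟧ d) (⟦renameᴿ⟧ e)
      ⟦renameᴿ⟧ (d ⊖ e)   = cong₂ _-_ (⟦renameᴿ⟧ d) (⟦renameᴿ⟧ e)
      ⟦renameᴿ⟧ (d ⊗ e)   = cong₂ _*_ (⟦renameᴿ⟧ d) (⟦renameᴿ⟧ e)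
      ⟦renameᴿ⟧ (d ⊘ e)   = cong₂ _/_ (⟦renameᴿ⟧ d) (⟦renameᴿ⟧ e)
      ⟦renameᴿ⟧ (d ↑ e)   = cong₂ _^_ (⟦renameᴿ⟧ d) (⟦renameᴺ⟧ e)

      ⟦renameᵀ⟧ : ∀ t → ⟦ renameᵀ t ⟧ᵀ τ ≡ ⟦ t ⟧ᵀ σ
      ⟦renameᵀ⟧ (d ≤ᴺ e) = cong₂ (λ x y → does (x ℕₚ.≤? y)) (⟦renameᴺ⟧ d) (⟦renameᴺ⟧ e)
      ⟦renameᵀ⟧ (d ≤ᴿ e) = cong₂ (λ x y → does (x ≤? y)) (⟦renameᴿ⟧ d) (⟦renameᴿ⟧ e)

      update-rename : ∀ {x} {A : Set x} {f g : ℕ → ℕ → A} {a i j u v} →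
        (∀ a i → f (ρ a) i ≡ g a i) → i ≡ j → u ≡ v →
        ∀ a′ i′ → update f (ρ a) i u (ρ a′) i′ ≡ update g a j v a′ i′
      update-rename {a = a} {j = j} {v = v} f≈g refl refl a′ i′ =
        cong₂ (λ s r → if s Bool.∧ does (i′ ℕₚ.≟ j) then v else r) (ρ-reflects a′ a) (f≈g a′ i′)

      writeᴺ-rename : ∀ {a i j u v} → i ≡ j → u ≡ v → writeᴺ τ (ρ a) i u ≈ writeᴺ σ a j v
      writeᴺ-rename i≡j u≡v = simulates (update-rename {f = natural τ} (≈ᴺ τ≈σ) i≡j u≡v) (≈ᴿ τ≈σ)

      writeᴿ-rename : ∀ {a i j u v} → i ≡ j → u ≡ v → writeᴿ τ (ρ a) i u ≈ writeᴿ σ a j v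
      writeᴿ-rename i≡j u≡v = simulates (≈ᴺ τ≈σ) (update-rename {f = real τ} (≈ᴿ τ≈σ) i≡j u≡v)

    -- Costs count nodes of expressions, which renaming preserves, so the simulation takes the same
    -- number of steps and inherits the time bound.
    ⇓-rename : ∀ {P σ σ′ k τ} → P ∣ σ ⇓ σ′ ∣ k → τ ≈ σ →
      ∃[ τ′ ] (rename P ∣ τ ⇓ τ′ ∣ k) × τ′ ≈ σ′
    ⇓-rename ⇓skip τ≈σ = _ , ⇓skip , τ≈σ
    ⇓-rename (⇓assignᴺ {i = i} {e}) τ≈σ = _ ,
      ⇓-cost (cong suc (cong₂ ℕ._+_ (costᴺ-rename i) (costᴺ-rename e))) ⇓assignᴺ ,
      writeᴺ-rename τ≈σ (⟦renameᴺ⟧ τ≈σ i) (⟦renameᴺ⟧ τ≈σ e)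
    ⇓-rename (⇓assignᴿ {i = i} {e}) τ≈σ = _ ,
      ⇓-cost (cong suc (cong₂ ℕ._+_ (costᴺ-rename i) (costᴿ-rename e))) ⇓assignᴿ ,
      writeᴿ-rename τ≈σ (⟦renameᴺ⟧ τ≈σ i) (⟦renameᴿ⟧ τ≈σ e)
    ⇓-rename (⇓floor {i = i} {e} {m} fl) τ≈σ = _ ,
      ⇓-cost (cong suc (cong₂ ℕ._+_ (costᴺ-rename i) (costᴿ-rename e)))
        (⇓floor (subst (λ x → IsFloor x m) (sym (⟦renameᴿ⟧ τ≈σ e)) fl)) ,
      writeᴺ-rename τ≈σ (⟦renameᴺ⟧ τ≈σ i) refl
    ⇓-rename (⇓log {i = i} {d} {e} {m} lg) τ≈σ = _ ,
      ⇓-cost (cong suc (cong₂ ℕ._+_ (costᴺ-rename i)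
          (cong₂ ℕ._+_ (costᴿ-rename d) (costᴿ-rename e))))
        (⇓log (subst₂ (λ x y → IsFloorLog x y (+ m)) (sym (⟦renameᴿ⟧ τ≈σ d)) (sym (⟦renameᴿ⟧ τ≈σ e)) lg)) ,
      writeᴺ-rename τ≈σ (⟦renameᴺ⟧ τ≈σ i) refl
    ⇓-rename (⇓seq p q) τ≈σ =
      let _ , p′ , τ≈σ₁ = ⇓-rename p τ≈σ
          _ , q′ , τ≈σ₂ = ⇓-rename q τ≈σ₁
      in _ , ⇓seq p′ q′ , τ≈σ₂
    ⇓-rename (⇓when-true {t = t} {k = k} t≡ p) τ≈σ =
      let _ , p′ , τ≈σ₁ = ⇓-rename p τ≈σ
      in _ , ⇓-cost (cong (ℕ._+ k) (costᵀ-rename t))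
               (⇓when-true (trans (⟦renameᵀ⟧ τ≈σ t) t≡) p′) , τ≈σ₁
    ⇓-rename (⇓when-false {t = t} {k = k} t≡ p) τ≈σ =
      let _ , p′ , τ≈σ₁ = ⇓-rename p τ≈σ
      in _ , ⇓-cost (cong (ℕ._+ k) (costᵀ-rename t))
               (⇓when-false (trans (⟦renameᵀ⟧ τ≈σ t) t≡) p′) , τ≈σ₁
    ⇓-rename (⇓while-true {t = t} {k₁ = k₁} {k₂} t≡ p w) τ≈σ =
      let _ , p′ , τ≈σ₁ = ⇓-rename p τ≈σ
          _ , w′ , τ≈σ₂ = ⇓-rename w τ≈σ₁
      in _ , ⇓-cost (cong (ℕ._+ (k₁ ℕ.+ k₂)) (costᵀ-rename t))
               (⇓while-true (trans (⟦renameᵀ⟧ τ≈σ t) t≡) p′ w′) , τ≈σ₂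
    ⇓-rename (⇓while-false {t = t} t≡) τ≈σ =
      _ , ⇓-cost (costᵀ-rename t) (⇓while-false (trans (⟦renameᵀ⟧ τ≈σ t) t≡)) , τ≈σ

  -- Total-correctness rules with upper bounds on the running time

  Runs : ∀ {r} → Program → Memory → ℕ → (Memory → Set r) → Set (c ⊔ ℓ ⊔ r)
  Runs P σ k R = ∃[ σ′ ] ∃[ k′ ] (P ∣ σ ⇓ σ′ ∣ k′) × k′ ℕ.≤ k × R σ′

  private variable
    r s : Level
    R : Memory → Set r
    S : Memory → Set s
    k k₁ k₂ a : ℕ
    i e : NExp
    d f : RExp
    t : Test

  runs-skip : R σ → Runs skip σ 1 R
  runs-skip Rσ = _ , _ , ⇓skip , ℕₚ.≤-refl , Rσ

  runs-assignᴺ : R (writeᴺ σ a (⟦ i ⟧ᴺ σ) (⟦ e ⟧ᴺ σ)) →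
    Runs (a [ i ]≔ᴺ e) σ (suc (costᴺ i ℕ.+ costᴺ e)) R
  runs-assignᴺ Rσ = _ , _ , ⇓assignᴺ , ℕₚ.≤-refl , Rσ

  runs-assignᴿ : R (writeᴿ σ a (⟦ i ⟧ᴺ σ) (⟦ f ⟧ᴿ σ)) →
    Runs (a [ i ]≔ᴿ f) σ (suc (costᴺ i ℕ.+ costᴿ f)) R
  runs-assignᴿ Rσ = _ , _ , ⇓assignᴿ , ℕₚ.≤-refl , Rσ

  runs-log : ∀ m → IsFloorLog (⟦ d ⟧ᴿ σ) (⟦ f ⟧ᴿ σ) (+ m) → R (writeᴺ σ a (⟦ i ⟧ᴺ σ) m) →
    Runs (a [ i ]≔⌊log d , f ⌋) σ (suc (costᴺ i ℕ.+ (costᴿ d ℕ.+ costᴿ f))) R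
  runs-log m log Rσ = _ , _ , ⇓log log , ℕₚ.≤-refl , Rσ

  runs-seq : Runs P σ k₁ (λ σ₁ → Runs Q σ₁ k₂ R) → Runs (P ⨟ Q) σ (k₁ ℕ.+ k₂) R
  runs-seq (_ , _ , p , p≤ , _ , _ , q , q≤ , Rσ) = _ , _ , ⇓seq p q , ℕₚ.+-mono-≤ p≤ q≤ , Rσ

  runs-when : (⟦ t ⟧ᵀ σ ≡ true → Runs P σ k₁ R) → (⟦ t ⟧ᵀ σ ≡ false → Runs Q σ k₂ R) →
    Runs (when t then P else Q) σ (costᵀ t ℕ.+ (k₁ ℕ.⊔ k₂)) R
  runs-when {t = t} {σ = σ} {k₁ = k₁} {k₂ = k₂} p q with ⟦ t ⟧ᵀ σ in eq
  ... | true  = let _ , _ , p , p≤ , Rσ = p refl in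
    _ , _ , ⇓when-true eq p , ℕₚ.+-monoʳ-≤ (costᵀ t) (ℕₚ.≤-trans p≤ (ℕₚ.m≤m⊔n k₁ k₂)) , Rσ
  ... | false = let _ , _ , q , q≤ , Rσ = q refl in
    _ , _ , ⇓when-false eq q , ℕₚ.+-monoʳ-≤ (costᵀ t) (ℕₚ.≤-trans q≤ (ℕₚ.m≤n⊔m k₁ k₂)) , Rσ

  runs-≤ : k₁ ℕ.≤ k₂ → Runs P σ k₁ R → Runs P σ k₂ R
  runs-≤ k₁≤k₂ (_ , _ , p , p≤ , Rσ) = _ , _ , p , ℕₚ.≤-trans p≤ k₁≤k₂ , Rσ

  -- The rule of consequence, which in addition hands over the frame condition of the run just
  -- completed.
  runs-mono : (∀ σ′ → Unchanged P σ σ′ → R σ′ → S σ′) → Runs P σ k R → Runs P σ k S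
  runs-mono R⇒S (σ′ , _ , p , p≤ , Rσ) = _ , _ , p , p≤ , R⇒S σ′ (⇓-unchanged p) Rσ

  for_below_loop_ : ℕ → ℕ → Program → Program
  for c below d loop B =
    c [ lit 0 ]≔ᴺ lit 0 ⨟
    while lit 1 ⊕ c [ lit 0 ] ≤ᴺ d [ lit 0 ] loop (B ⨟ c [ lit 0 ]≔ᴺ lit 1 ⊕ c [ lit 0 ])

  module _ {c d : ℕ} {B : Program} {N : ℕ} {σ₀ : Memory} (Inv : ℕ → Memory → Set r)
           (c∉B : writesᴺ B c ≡ false) (d∉B : writesᴺ B d ≡ false) (d≢c : (d ≡ᵇ c) ≡ false)
           (bound : natural σ₀ d 0 ≡ N)
           (step : ∀ j σ → j ℕ.< N → natural σ c 0 ≡ j →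
                   Unchanged (for c below d loop B) σ₀ σ → Inv j σ →
                   -- The increment follows the body, so the invariant is demanded for whatever
                   -- value the counter may receive.
                   Runs B σ k (λ σ′ → ∀ x → Inv (suc j) (writeᴺ σ′ c 0 x))) where
    private
      For Body : Program
      For  = for c below d loop B
      Body = B ⨟ c [ lit 0 ]≔ᴺ lit 1 ⊕ c [ lit 0 ]

      body∉ᴺ : ∀ a → writesᴺ For a ≡ false → writesᴺ Body a ≡ false
      body∉ᴺ a = ∨-falseʳ {a ≡ᵇ c}

      d∉For : writesᴺ For d ≡ false
      d∉For rewrite d≢c | d∉B = refl

      counter : ∀ (f : ℕ → ℕ → ℕ) v → update f c 0 v c 0 ≡ v
      counter f v rewrite dec-true (c ℕₚ.≟ c) refl = refl

      iteration-cost : ∀ m {k₁ k₂} → k₁ ℕ.≤ k → k₂ ℕ.≤ m ℕ.* (k ℕ.+ 13) ℕ.+ 7 →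
        7 ℕ.+ (k₁ ℕ.+ 6 ℕ.+ k₂) ℕ.≤ k ℕ.+ 13 ℕ.+ m ℕ.* (k ℕ.+ 13) ℕ.+ 7
      iteration-cost m {k₁} {k₂} k₁≤k k₂≤ = begin
        7 ℕ.+ (k₁ ℕ.+ 6 ℕ.+ k₂)                       ≤⟨ ℕₚ.+-monoʳ-≤ 7 (ℕₚ.+-mono-≤ (ℕₚ.+-monoˡ-≤ 6 k₁≤k) k₂≤) ⟩
        7 ℕ.+ (k ℕ.+ 6 ℕ.+ (m ℕ.* (k ℕ.+ 13) ℕ.+ 7))  ≡⟨ arith k (m ℕ.* (k ℕ.+ 13)) ⟩
        k ℕ.+ 13 ℕ.+ m ℕ.* (k ℕ.+ 13) ℕ.+ 7           ∎
        where
        open ℕₚ.≤-Reasoning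
        arith : ∀ k x → 7 ℕ.+ (k ℕ.+ 6 ℕ.+ (x ℕ.+ 7)) ≡ k ℕ.+ 13 ℕ.+ x ℕ.+ 7
        arith = solve-∀

      while-runs : ∀ m j σ → m ℕ.+ j ≡ N → natural σ c 0 ≡ j → Unchanged For σ₀ σ → Inv j σ →
        Runs (while lit 1 ⊕ c [ lit 0 ] ≤ᴺ d [ lit 0 ] loop Body) σ (m ℕ.* (k ℕ.+ 13) ℕ.+ 7) (Inv N)
      while-runs zero j σ refl c≡j un inv = _ , _ , ⇓while-false (dec-false (_ ℕₚ.≤? _) λ 1+c≤d →
          ℕₚ.1+n≰n (subst₂ (λ x y → suc x ℕ.≤ y) c≡j (trans (sameᴺ un d d∉For 0) bound) 1+c≤d))
        , ℕₚ.≤-refl , inv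
      while-runs (suc m) j σ m+j≡N c≡j un inv =
        let σ₁ , k₁ , run , k₁≤k , inv₁ = step j σ j<N c≡j un inv
            σ₂ , k₂ , run₂ , k₂≤ , inv₂ = while-runs m (suc j) (writeᴺ σ₁ c 0 (suc (natural σ₁ c 0)))
               (trans (ℕₚ.+-suc m j) m+j≡N)
               (trans (counter (natural σ₁) _) (cong suc (trans (sameᴺ (⇓-unchanged run) c c∉B 0) c≡j)))
               (Unchanged-trans un
                 (Unchanged-weaken {Q = For} {P = Body} body∉ᴺ (λ a → id) (⇓-unchanged (⇓seq run ⇓assignᴺ))))
               (inv₁ _)
        in σ₂ , _ , ⇓while-true (dec-true (_ ℕₚ.≤? _)
            (subst₂ ℕ._≤_ (cong suc (sym c≡j)) (sym (trans (sameᴺ un d d∉For 0) bound)) j<N))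
            (⇓seq run ⇓assignᴺ) run₂
          , iteration-cost m k₁≤k k₂≤ , inv₂
        where
        j<N : j ℕ.< N
        j<N = subst (suc j ℕ.≤_) m+j≡N (ℕ.s≤s (ℕₚ.m≤n+m j m))

    -- Initialization costs 3 and the final, failing test 7. Each round costs 7 for the test, `k`
    -- for the body and 6 for the increment.
    runs-for : Inv 0 (writeᴺ σ₀ c 0 0) → Runs For σ₀ (10 ℕ.+ N ℕ.* (k ℕ.+ 13)) (Inv N)
    runs-for inv₀ =
      let σ₁ , k₁ , run , k₁≤ , inv = while-runs N 0 (writeᴺ σ₀ c 0 0) (ℕₚ.+-identityʳ N)
             (counter (natural σ₀) 0)
             (Unchanged-weaken {Q = For} {P = c [ lit 0 ]≔ᴺ lit 0} (λ a → ∨-falseˡ) (λ _ _ → refl)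
               (⇓-unchanged ⇓assignᴺ)) inv₀
      in σ₁ , _ , ⇓seq ⇓assignᴺ run , ℕₚ.≤-trans (ℕₚ.+-monoʳ-≤ 3 k₁≤)
        (ℕₚ.≤-reflexive (cong (3 ℕ.+_) (ℕₚ.+-comm (N ℕ.* (k ℕ.+ 13)) 7))) , inv

-- Contents of arrays after an assignment

m<1+n∧m≢n⇒m<n : ∀ {m n} → m ℕ.< suc n → m ≢ n → m ℕ.< n
m<1+n∧m≢n⇒m<n (ℕ.s≤s m≤n) m≢n = ℕₚ.≤∧≢⇒< m≤n m≢n

-- The left-hand sides of the following four lemmas are what reading an array
-- after an assignment to it reduces to.

fill : ∀ {a} {A : Set a} {n m idx} (f : ℕ → A) {g : Fin n → A} {v : A} → idx ≡ m →
  (∀ i → toℕ i ℕ.< m → f (toℕ i) ≡ g i) → (∀ i → idx ≡ toℕ i → v ≡ g i) →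
  ∀ i → toℕ i ℕ.< suc m → (if does (toℕ i ℕₚ.≟ idx) then v else f (toℕ i)) ≡ g i
fill {m = m} f refl old new i i<1+m with toℕ i ℕₚ.≟ m
... | yes i≡m rewrite dec-true (toℕ i ℕₚ.≟ m) i≡m = new i (sym i≡m)
... | no i≢m rewrite dec-false (toℕ i ℕₚ.≟ m) i≢m = old i (m<1+n∧m≢n⇒m<n i<1+m i≢m)

scatter : ∀ {a} {A : Set a} {n m idx} (f : ℕ → A) {g : Fin n → A} {v : A} (π : Permutation′ n) {x} →
  idx ≡ toℕ (π ⟨$⟩ʳ x) → toℕ x ≡ m →
  (∀ i → toℕ i ℕ.< m → f (toℕ (π ⟨$⟩ʳ i)) ≡ g i) → v ≡ g x →
  ∀ i → toℕ i ℕ.< suc m →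
  (if does (toℕ (π ⟨$⟩ʳ i) ℕₚ.≟ idx) then v else f (toℕ (π ⟨$⟩ʳ i))) ≡ g i
scatter f {g} π {x} refl refl old new i i<1+m with i Finₚ.≟ x
... | yes i≡x rewrite dec-true (toℕ (π ⟨$⟩ʳ i) ℕₚ.≟ toℕ (π ⟨$⟩ʳ x)) (cong (λ y → toℕ (π ⟨$⟩ʳ y)) i≡x) =
  trans new (cong g (sym i≡x))
... | no i≢x rewrite dec-false (toℕ (π ⟨$⟩ʳ i) ℕₚ.≟ toℕ (π ⟨$⟩ʳ x))
    (λ eq → i≢x (trans (sym (inverseˡ π)) (trans (cong (π ⟨$⟩ˡ_) (Finₚ.toℕ-injective eq)) (inverseˡ π)))) =
  old i (m<1+n∧m≢n⇒m<n i<1+m (i≢x ∘ Finₚ.toℕ-injective))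

swapped : ∀ {a} {A : Set a} {n idx idx′} (f : ℕ → A) {i j : Fin n} → idx ≡ toℕ i → idx′ ≡ toℕ j →
  ∀ x → (if does (toℕ x ℕₚ.≟ idx′) then f idx else
         if does (toℕ x ℕₚ.≟ idx) then f idx′ else f (toℕ x)) ≡ f (toℕ (Components.transpose i j x))
swapped f {i} {j} refl refl x with x Finₚ.≟ i | x Finₚ.≟ j
... | yes refl | yes refl rewrite dec-true (toℕ x ℕₚ.≟ toℕ x) refl = refl
... | yes refl | no x≢j rewrite dec-false (toℕ x ℕₚ.≟ toℕ j) (x≢j ∘ Finₚ.toℕ-injective)
    | dec-true (toℕ x ℕₚ.≟ toℕ x) refl = refl
... | no x≢i | yes refl rewrite dec-true (toℕ x ℕₚ.≟ toℕ x) refl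
    | dec-true (x Finₚ.≟ x) refl = refl
... | no x≢i | no x≢j rewrite dec-false (toℕ x ℕₚ.≟ toℕ j) (x≢j ∘ Finₚ.toℕ-injective)
    | dec-false (toℕ x ℕₚ.≟ toℕ i) (x≢i ∘ Finₚ.toℕ-injective)
    | dec-false (x Finₚ.≟ j) x≢j = refl

beyond : ∀ {a} {A : Set a} {n m idx} (f : ℕ → A) {g : Fin n → A} {v : A} → idx ≡ m →
  (∀ i → m ℕ.≤ toℕ i → f (toℕ i) ≡ g i) →
  ∀ i → suc m ℕ.≤ toℕ i → (if does (toℕ i ℕₚ.≟ idx) then v else f (toℕ i)) ≡ g i
beyond {m = m} f refl rest i m<i rewrite dec-false (toℕ i ℕₚ.≟ m) (ℕₚ.>⇒≢ m<i) = rest i (ℕₚ.<⇒≤ m<i)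

lift : (ℕ → ℕ) → ℕ → ℕ
lift f zero    = zero
lift f (suc a) = suc (f a)

lift-reflects : ∀ {f} → (∀ a b → (f a ≡ᵇ f b) ≡ (a ≡ᵇ b)) → ∀ a b → (lift f a ≡ᵇ lift f b) ≡ (a ≡ᵇ b)
lift-reflects r zero    zero    = refl
lift-reflects r zero    (suc b) = refl
lift-reflects r (suc a) zero    = refl
lift-reflects r (suc a) (suc b) = r a b

lift-fresh : ∀ {f b} → (∀ a → (b ≡ᵇ f a) ≡ false) → ∀ a → (suc b ≡ᵇ lift f a) ≡ false
lift-fresh new zero    = refl
lift-fresh new (suc a) = new a

extend : ∀ {a} {A : Set a} {n m} {f g : Fin n → A} →
  (∀ i → toℕ i ℕ.< m → f i ≡ g i) → (∀ i → toℕ i ≡ m → f i ≡ g i) →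
  ∀ i → toℕ i ℕ.< suc m → f i ≡ g i
extend {m = m} old new i i<1+m with toℕ i ℕₚ.≟ m
... | yes i≡m = new i i≡m
... | no i≢m = old i (m<1+n∧m≢n⇒m<n i<1+m i≢m)

-- Keeps the input and output arrays 0, …, 3 and frees 4, …, 15.  Reads of arrays
-- named by distinct numerals then reduce by computation.
shift : ℕ → ℕ
shift = lift (lift (lift (lift (12 ℕ.+_))))

shift-reflects : ∀ a b → (shift a ≡ᵇ shift b) ≡ (a ≡ᵇ b)
shift-reflects = lift-reflects (lift-reflects (lift-reflects (lift-reflects λ _ _ → refl)))

shift-fresh : ∀ {b} → (∀ a → (b ≡ᵇ 12 ℕ.+ a) ≡ false) → ∀ a → (4 ℕ.+ b ≡ᵇ shift a) ≡ false
shift-fresh new = lift-fresh (lift-fresh (lift-fresh (lift-fresh new)))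

-- The program of the reduction and its cost

module Algorithm {c ℓ : Level} (K : ArchimedeanOrderedField c ℓ) where
  open ArchimedeanOrderedField K
  open FieldProperties K
  open KnapsackProperties K
  open MachineProperties K
  open Renaming shift shift-reflects
  open Knapsack K
  open Machine K
  open Computation K using (Holds; output; ComputesWithin)
  open Holds hiding (n-cell; T-cell; p-cell)

  cellᴺ : ℕ → NExp
  cellᴺ a = a [ lit 0 ]

  cellᴿ : ℕ → RExp
  cellᴿ a = a [ lit 0 ]

  i j : NExp
  i = cellᴺ 5
  j = cellᴺ 6

  -- Private arrays.  Natural: 4 the sorting permutation, 5 and 6 loop counters,
  -- 7 a temporary, 8 the best insertion times, 9 and 10 copies of n and T.
  -- Field: 4, 5, 6 copies of p, w, b; 7 the sorted profits, 8 the number 1 + ε,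
  -- 9 an accumulator, 10 the best profit.

  constants copy sort gather reduceCapacities restoreCapacities restoreItems : Program
  constants =
    9 [ lit 0 ]≔ᴺ cellᴺ 0 ⨟
    10 [ lit 0 ]≔ᴺ cellᴺ 1 ⨟
    8 [ lit 0 ]≔ᴿ nat (lit 1) ⊕ cellᴿ 0
  copy = for 6 below 9 loop
    ( 4 [ j ]≔ᴺ j
    ⨟ 4 [ j ]≔ᴿ 1 [ j ]
    ⨟ 5 [ j ]≔ᴿ 2 [ j ]
    ⨟ 8 [ j ]≔ᴺ cellᴺ 10)
  sort = for 5 below 9 loop for 6 below 9 loop
    -- Loops always start at 0, so the positions up to `i` are skipped here. Only the permutation is
    -- rearranged; the profits are read through it.
    when j ≤ᴺ i then skip else
    when 1 [ 4 [ j ] ] ≤ᴿ 1 [ 4 [ i ] ] then skip else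
    ( 7 [ lit 0 ]≔ᴺ 4 [ i ]
    ⨟ 4 [ i ]≔ᴺ 4 [ j ]
    ⨟ 4 [ j ]≔ᴺ cellᴺ 7)
  gather = for 6 below 9 loop
    ( 7 [ j ]≔ᴿ 4 [ 4 [ j ] ]
    ⨟ 2 [ j ]≔ᴿ 5 [ 4 [ j ] ])
  reduceCapacities =
    9 [ lit 0 ]≔ᴿ nat (lit 0) ⨟
    for 6 below 10 loop
    ( 6 [ j ]≔ᴿ 3 [ j ]
    ⨟ 7 [ lit 0 ]≔⌊log cellᴿ 8 , nat (cellᴺ 10 ⊖ j) ⌋
    ⨟ (when cellᴿ 8 ↑ cellᴺ 7 ≤ᴿ nat (cellᴺ 10 ⊖ j ⊖ lit 1)
       then 3 [ j ]≔ᴿ cellᴿ 9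
       else (9 [ lit 0 ]≔ᴿ 3 [ j ])))
  restoreCapacities = for 6 below 10 loop (3 [ j ]≔ᴿ 6 [ j ])
  restoreItems = for 6 below 9 loop
    ( 1 [ j ]≔ᴿ 4 [ j ]
    ⨟ 2 [ j ]≔ᴿ 5 [ j ]
    -- The best insertion times refer to sorted positions; this hands them back to the original
    -- items.
    ⨟ 2 [ 4 [ j ] ]≔ᴺ 8 [ j ])

  roundProfits evaluate keepBest : Program
  roundProfits = for 6 below 9 loop
    ( (when 7 [ i ] ≤ᴿ 7 [ j ]
       then 7 [ lit 0 ]≔ᴺ lit 0
       else (7 [ lit 0 ]≔⌊log cellᴿ 8 , 7 [ i ] ⊘ 7 [ j ] ⌋))
    ⨟ 1 [ j ]≔ᴿ (nat (lit 1) ⊘ cellᴿ 8) ↑ cellᴺ 7)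
  evaluate =
    9 [ lit 0 ]≔ᴿ nat (lit 0) ⨟
    for 6 below 9 loop (9 [ lit 0 ]≔ᴿ cellᴿ 9 ⊕ 7 [ j ] ⊗ nat (cellᴺ 10 ⊖ 2 [ j ]))
  keepBest =
    when cellᴿ 9 ≤ᴿ cellᴿ 10 then skip else
    ( 10 [ lit 0 ]≔ᴿ cellᴿ 9
    ⨟ for 6 below 9 loop (8 [ j ]≔ᴺ 2 [ j ]))

  prepare finish : Program
  prepare = constants ⨟ copy ⨟ sort ⨟ gather ⨟ reduceCapacities
  finish = restoreCapacities ⨟ restoreItems

  tryAll reduction : Program → Program
  tryAll P =
    10 [ lit 0 ]≔ᴿ nat (lit 0) ⨟
    for 5 below 9 loop (roundProfits ⨟ rename P ⨟ evaluate ⨟ keepBest)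
  reduction P = prepare ⨟ tryAll P ⨟ finish

  -- Loop bodies are rounded up to 30 or 60 steps, to which `runs-for` adds 13 per round: 43 and 73.
  -- A loop adds 10 once, 14 includes an assignment of cost 4, and 19 also a test of cost 5.
  prepareCost finishCost : ℕ → ℕ → ℕ
  prepareCost n T =
    20 ℕ.+ (10 ℕ.+ n ℕ.* 43 ℕ.+ (10 ℕ.+ n ℕ.* (10 ℕ.+ n ℕ.* 73 ℕ.+ 13) ℕ.+ (10 ℕ.+ n ℕ.* 43 ℕ.+ (14 ℕ.+ T ℕ.* 73))))
  finishCost n T = 10 ℕ.+ T ℕ.* 43 ℕ.+ (10 ℕ.+ n ℕ.* 43)

  bodyCost tryAllCost : ℕ → ℕ → ℕ
  bodyCost n G = 10 ℕ.+ n ℕ.* 73 ℕ.+ (G ℕ.+ (14 ℕ.+ n ℕ.* 43 ℕ.+ (19 ℕ.+ n ℕ.* 43)))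
  tryAllCost n G = 14 ℕ.+ n ℕ.* (bodyCost n G ℕ.+ 13)

  reductionCost : ℕ → ℕ → ℕ → ℕ
  reductionCost n T G = prepareCost n T ℕ.+ (tryAllCost n G ℕ.+ finishCost n T)

  fromℕ-cost : ∀ C {k n T G v} → k ℕ.≤ C ℕ.* (T ℕ.+ n ℕ.* (n ℕ.+ G)) → fromℕ G ≤ v →
    fromℕ k ≤ fromℕ C * (fromℕ T + fromℕ n * (fromℕ n + v))
  fromℕ-cost C {k} {n} {T} {G} {v} k≤ G≤v = begin
    fromℕ k                                                 ≤⟨ fromℕ-mono-≤ k≤ ⟩
    fromℕ (C ℕ.* (T ℕ.+ n ℕ.* (n ℕ.+ G)))                   ≡⟨ fromℕ-* C _ ⟩
    fromℕ C * fromℕ (T ℕ.+ n ℕ.* (n ℕ.+ G))                 ≡⟨ cong (λ u → fromℕ C * u) (fromℕ-+ T _) ⟩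
    fromℕ C * (fromℕ T + fromℕ (n ℕ.* (n ℕ.+ G)))           ≡⟨ cong (λ u → fromℕ C * (fromℕ T + u)) (fromℕ-* n _) ⟩
    fromℕ C * (fromℕ T + fromℕ n * fromℕ (n ℕ.+ G))         ≡⟨ cong (λ u → fromℕ C * (fromℕ T + fromℕ n * u)) (fromℕ-+ n G) ⟩
    fromℕ C * (fromℕ T + fromℕ n * (fromℕ n + fromℕ G))
      ≤⟨ *-monoˡ-≤ (fromℕ-nonNeg C) (+-monoʳ-≤ (fromℕ T) (*-monoˡ-≤ (fromℕ-nonNeg n) (+-monoʳ-≤ (fromℕ n) G≤v))) ⟩
    fromℕ C * (fromℕ T + fromℕ n * (fromℕ n + v))           ∎
    where open ≤-Reasoning

  -- The constant 440 is 208 + 232, the coefficients of n and n². The linear term is absorbed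
  -- because n is positive, the constant term because T is; what is left of 440 for T and n G is
  -- slack.
  reductionCost-≤ : ∀ {n T} G → 1 ℕ.≤ n → 1 ℕ.≤ T →
    reductionCost n T G ℕ.≤ 440 ℕ.* (T ℕ.+ n ℕ.* (n ℕ.+ G))
  reductionCost-≤ {n} {T} G 1≤n 1≤T = begin
    reductionCost n T G                                            ≡⟨ expand n T G ⟩
    98 ℕ.* 1 ℕ.+ 116 ℕ.* T ℕ.+ (208 ℕ.* (n ℕ.* 1) ℕ.+ 232 ℕ.* (n ℕ.* n)) ℕ.+ n ℕ.* G
      ≤⟨ ℕₚ.+-monoˡ-≤ (n ℕ.* G) (ℕₚ.+-mono-≤ (ℕₚ.+-monoˡ-≤ (116 ℕ.* T) (ℕₚ.*-monoʳ-≤ 98 1≤T))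
           (ℕₚ.+-monoˡ-≤ (232 ℕ.* (n ℕ.* n)) (ℕₚ.*-monoʳ-≤ 208 (ℕₚ.*-monoʳ-≤ n 1≤n)))) ⟩
    98 ℕ.* T ℕ.+ 116 ℕ.* T ℕ.+ (208 ℕ.* (n ℕ.* n) ℕ.+ 232 ℕ.* (n ℕ.* n)) ℕ.+ n ℕ.* G
      ≤⟨ ℕₚ.m≤m+n _ (226 ℕ.* T ℕ.+ 439 ℕ.* (n ℕ.* G)) ⟩
    98 ℕ.* T ℕ.+ 116 ℕ.* T ℕ.+ (208 ℕ.* (n ℕ.* n) ℕ.+ 232 ℕ.* (n ℕ.* n)) ℕ.+ n ℕ.* G ℕ.+ (226 ℕ.* T ℕ.+ 439 ℕ.* (n ℕ.* G))
      ≡⟨ collect n T G ⟩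
    440 ℕ.* (T ℕ.+ n ℕ.* (n ℕ.+ G)) ∎
    where
    open ℕₚ.≤-Reasoning
    expand : ∀ n T G →
      20 ℕ.+ (10 ℕ.+ n ℕ.* 43 ℕ.+ (10 ℕ.+ n ℕ.* (10 ℕ.+ n ℕ.* 73 ℕ.+ 13) ℕ.+ (10 ℕ.+ n ℕ.* 43 ℕ.+ (14 ℕ.+ T ℕ.* 73))))
      ℕ.+ (14 ℕ.+ n ℕ.* (10 ℕ.+ n ℕ.* 73 ℕ.+ (G ℕ.+ (14 ℕ.+ n ℕ.* 43 ℕ.+ (19 ℕ.+ n ℕ.* 43))) ℕ.+ 13)
           ℕ.+ (10 ℕ.+ T ℕ.* 43 ℕ.+ (10 ℕ.+ n ℕ.* 43))) ≡
      98 ℕ.* 1 ℕ.+ 116 ℕ.* T ℕ.+ (208 ℕ.* (n ℕ.* 1) ℕ.+ 232 ℕ.* (n ℕ.* n)) ℕ.+ n ℕ.* G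
    expand = solve-∀
    collect : ∀ n T G →
      98 ℕ.* T ℕ.+ 116 ℕ.* T ℕ.+ (208 ℕ.* (n ℕ.* n) ℕ.+ 232 ℕ.* (n ℕ.* n)) ℕ.+ n ℕ.* G ℕ.+ (226 ℕ.* T ℕ.+ 439 ℕ.* (n ℕ.* G)) ≡
      440 ℕ.* (T ℕ.+ n ℕ.* (n ℕ.+ G))
    collect = solve-∀

  -- Correctness and running time of the pieces

  module _ {n : ℕ} {p w : Fin n → Carrier} {T : ℕ} where

    copy-runs : ∀ σ → natural σ 9 0 ≡ n → natural σ 10 0 ≡ T →
      (∀ x → real σ 1 (toℕ x) ≡ p x) → (∀ x → real σ 2 (toℕ x) ≡ w x) →
      Runs copy σ (10 ℕ.+ n ℕ.* 43) λ σ′ →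
        (∀ x → natural σ′ 4 (toℕ x) ≡ toℕ {n} x) × (∀ x → real σ′ 4 (toℕ x) ≡ p x) ×
        (∀ x → real σ′ 5 (toℕ x) ≡ w x) × (∀ x → natural σ′ 8 (toℕ {n} x) ≡ T)
    copy-runs σ₀ n-cell T-cell p-cell w-cell = runs-mono
      (λ _ _ (c₁ , c₂ , c₃ , c₄) → (λ x → c₁ x (Finₚ.toℕ<n x)) , (λ x → c₂ x (Finₚ.toℕ<n x)) ,
        (λ x → c₃ x (Finₚ.toℕ<n x)) , (λ x → c₄ x (Finₚ.toℕ<n x)))
      (runs-for Inv refl refl refl n-cell
        (λ m σ m<n c≡m un (c₁ , c₂ , c₃ , c₄) → runs-≤ {k₂ = 30} (ℕₚ.≤ᵇ⇒≤ _ 30 tt) $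
          runs-seq $ runs-assignᴺ $ runs-seq $ runs-assignᴿ $ runs-seq $ runs-assignᴿ $ runs-assignᴺ $
          λ _ → fill (natural σ 4) c≡m c₁ (λ _ eq → eq)
              , fill (real σ 4) c≡m c₂ (λ x eq → trans (cong (real σ 1) eq) (trans (sameᴿ un 1 refl _) (p-cell x)))
              , fill (real σ 5) c≡m c₃ (λ x eq → trans (cong (real σ 2) eq) (trans (sameᴿ un 2 refl _) (w-cell x)))
              , fill (natural σ 8) c≡m c₄ (λ x eq → trans (sameᴺ un 10 refl 0) T-cell))
        ((λ _ ()) , (λ _ ()) , (λ _ ()) , (λ _ ())))
      where
      Inv : ℕ → Memory → Set _
      Inv m σ = (∀ x → toℕ x ℕ.< m → natural σ 4 (toℕ x) ≡ toℕ {n} x) ×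
                (∀ x → toℕ x ℕ.< m → real σ 4 (toℕ x) ≡ p x) ×
                (∀ x → toℕ x ℕ.< m → real σ 5 (toℕ x) ≡ w x) ×
                (∀ x → toℕ x ℕ.< m → natural σ 8 (toℕ {n} x) ≡ T)

  -- Exchange sort: all entries before position x are in place, and the entry at
  -- x is the largest one at the positions x, …, m - 1.

  module _ {n : ℕ} where

    SortedBefore : ℕ → (Fin n → Carrier) → Set ℓ
    SortedBefore m q = ∀ x y → toℕ x ℕ.< m → x Fin.≤ y → q y ≤ q x

    LargestAt : Fin n → ℕ → (Fin n → Carrier) → Set ℓ
    LargestAt x m q = ∀ y → toℕ y ℕ.< m → x Fin.≤ y → q y ≤ q x

    LargestAt-suc : ∀ {x m q} → LargestAt x m q →
      (∀ y → toℕ y ≡ m → x Fin.≤ y → q y ≤ q x) → LargestAt x (suc m) q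
    LargestAt-suc {m = m} old new y y<1+m with toℕ y ℕₚ.≟ m
    ... | yes y≡m = new y y≡m
    ... | no y≢m = old y (m<1+n∧m≢n⇒m<n y<1+m y≢m)

    SortedBefore-suc : ∀ {x q} → SortedBefore (toℕ x) q → LargestAt x n q → SortedBefore (suc (toℕ x)) q
    SortedBefore-suc {x} {q} sorted largest z y z<1+x z≤y with z Finₚ.≟ x
    ... | yes refl = largest y (Finₚ.toℕ<n y) z≤y
    ... | no z≢x = sorted z y (m<1+n∧m≢n⇒m<n z<1+x (z≢x ∘ Finₚ.toℕ-injective)) z≤y

    module _ {x y : Fin n} (x<y : x Fin.< y) {q : Fin n → Carrier} where

      private
        τ : Fin n → Fin n
        τ = Components.transpose x y

        τ-view : ∀ z → (z ≡ x × τ z ≡ y) ⊎ (z ≡ y × τ z ≡ x) ⊎ (z ≢ x × z ≢ y × τ z ≡ z)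
        τ-view z with z Finₚ.≟ x
        ... | yes z≡x = inj₁ (z≡x , refl)
        ... | no z≢x with z Finₚ.≟ y
        ...   | yes z≡y = inj₂ (inj₁ (z≡y , refl))
        ...   | no z≢y = inj₂ (inj₂ (z≢x , z≢y , refl))

      swap-SortedBefore : SortedBefore (toℕ x) q → SortedBefore (toℕ x) (q ∘ τ)
      swap-SortedBefore sorted z u z<x z≤u with τ-view z
      ... | inj₁ (refl , _) = contradiction z<x (ℕₚ.<-irrefl refl)
      ... | inj₂ (inj₁ (refl , _)) = contradiction (ℕₚ.<-trans z<x x<y) (ℕₚ.<-irrefl refl)
      ... | inj₂ (inj₂ (_ , _ , τz≡z)) rewrite τz≡z with τ-view u
      ...   | inj₁ (_ , τu≡y) rewrite τu≡y = sorted z y z<x (ℕₚ.<⇒≤ (ℕₚ.<-trans z<x x<y))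
      ...   | inj₂ (inj₁ (_ , τu≡x)) rewrite τu≡x = sorted z x z<x (ℕₚ.<⇒≤ z<x)
      ...   | inj₂ (inj₂ (_ , _ , τu≡u)) rewrite τu≡u = sorted z u z<x z≤u

      swap-LargestAt : q x ≤ q y → LargestAt x (toℕ y) q → LargestAt x (suc (toℕ y)) (q ∘ τ)
      swap-LargestAt qx≤qy largest u u<1+y x≤u with τ-view x
      ... | inj₂ (inj₁ (refl , _)) = contradiction x<y (ℕₚ.<-irrefl refl)
      ... | inj₂ (inj₂ (x≢x , _)) = contradiction refl x≢x
      ... | inj₁ (_ , τx≡y) rewrite τx≡y with τ-view u
      ...   | inj₁ (_ , τu≡y) rewrite τu≡y = ≤-refl
      ...   | inj₂ (inj₁ (_ , τu≡x)) rewrite τu≡x = qx≤qy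
      ...   | inj₂ (inj₂ (_ , u≢y , τu≡u)) rewrite τu≡u =
        ≤-trans (largest u (m<1+n∧m≢n⇒m<n u<1+y (u≢y ∘ Finₚ.toℕ-injective)) x≤u) qx≤qy

    sort-runs : ∀ {p : Fin n → Carrier} σ → natural σ 9 0 ≡ n →
      (∀ x → natural σ 4 (toℕ x) ≡ toℕ x) → (∀ x → real σ 1 (toℕ x) ≡ p x) →
      Runs sort σ (10 ℕ.+ n ℕ.* (10 ℕ.+ n ℕ.* 73 ℕ.+ 13)) λ σ′ → ∃[ π ]
        (∀ x → natural σ′ 4 (toℕ x) ≡ toℕ (π ⟨$⟩ʳ x)) ×
        (∀ {x y} → x Fin.≤ y → p (π ⟨$⟩ʳ y) ≤ p (π ⟨$⟩ʳ x))
    sort-runs {p} σ₀ n-cell identity p-cell = runs-mono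
      (λ _ _ (π , rep , sorted) → π , rep , λ {x} {y} → sorted x y (Finₚ.toℕ<n x))
      (runs-for Outer refl refl refl n-cell outer (Perm.id , identity , λ _ _ ()))
      where
      Represents : Permutation′ n → Memory → Set
      Represents π σ = ∀ x → natural σ 4 (toℕ x) ≡ toℕ (π ⟨$⟩ʳ x)
      Outer : ℕ → Memory → Set ℓ
      Outer m σ = ∃[ π ] Represents π σ × SortedBefore m (p ∘ (π ⟨$⟩ʳ_))
      Inner : Fin n → ℕ → Memory → Set ℓ
      Inner x m σ = ∃[ π ] Represents π σ × SortedBefore (toℕ x) (p ∘ (π ⟨$⟩ʳ_)) × LargestAt x m (p ∘ (π ⟨$⟩ʳ_))
      outer : ∀ m σ → m ℕ.< n → natural σ 5 0 ≡ m → Unchanged sort σ₀ σ → Outer m σ →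
        Runs _ σ (10 ℕ.+ n ℕ.* 73) (λ σ′ → ∀ z → Outer (suc m) (writeᴺ σ′ 5 0 z))
      outer m σ₁ m<n i≡m un₁ (π , rep , sorted) = runs-mono
        (λ _ _ (π , rep , sorted , largest) _ → π , rep ,
          subst (λ m → SortedBefore (suc m) _) x≡m (SortedBefore-suc sorted largest))
        (runs-for (Inner x) refl refl refl (trans (sameᴺ un₁ 9 refl 0) n-cell) inner
          (π , rep , subst (λ m → SortedBefore m _) (sym x≡m) sorted , λ _ ()))
        where
        x : Fin n
        x = Fin.fromℕ< m<n
        x≡m : toℕ x ≡ m
        x≡m = Finₚ.toℕ-fromℕ< m<n
        inner : ∀ m σ → m ℕ.< n → natural σ 6 0 ≡ m → Unchanged _ σ₁ σ → Inner x m σ →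
          Runs _ σ 60 (λ σ′ → ∀ z → Inner x (suc m) (writeᴺ σ′ 6 0 z))
        inner m′ σ m′<n j≡m′ un (π , rep , sorted , largest) = runs-≤ (ℕₚ.≤ᵇ⇒≤ _ 60 tt) $ runs-when
          (λ j≤i → runs-skip λ _ → π , rep , sorted , LargestAt-suc largest λ z z≡m′ x≤z →
            ≤-reflexive (cong (p ∘ (π ⟨$⟩ʳ_)) (Finₚ.toℕ-injective (ℕₚ.≤-antisym
              (subst₂ ℕ._≤_ (trans j≡m′ (sym z≡m′)) i≡x (does⇒ (natural σ 6 0 ℕₚ.≤? natural σ 5 0) j≤i)) x≤z))))
          (λ j≰i → runs-when
            (λ pj≤pi → runs-skip λ _ → π , rep , sorted , LargestAt-suc largest λ z z≡m′ _ →
              subst₂ _≤_ (value (trans j≡m′ (sym z≡m′))) (value i≡x) (does⇒ (_ ≤? _) pj≤pi))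
            (λ pj≰pi → runs-seq $ runs-assignᴺ $ runs-seq $ runs-assignᴺ $ runs-assignᴺ λ _ →
              transpose x y ∘ₚ π
              , (λ z → trans (swapped (natural σ 4) i≡x j≡y z) (rep _))
              , swap-SortedBefore (x<y j≰i) sorted
              , subst (λ m → LargestAt x (suc m) (p ∘ (transpose x y ∘ₚ π ⟨$⟩ʳ_))) y≡m′ (swap-LargestAt (x<y j≰i)
                  (subst₂ _≤_ (value i≡x) (value j≡y) (≰⇒≥ (does-false⇒ (_ ≤? _) pj≰pi)))
                  (subst (λ m → LargestAt x m _) (sym y≡m′) largest))))
          where
          y : Fin n
          y = Fin.fromℕ< m′<n
          y≡m′ : toℕ y ≡ m′
          y≡m′ = Finₚ.toℕ-fromℕ< m′<n
          i≡x : natural σ 5 0 ≡ toℕ x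
          i≡x = trans (sameᴺ un 5 refl 0) (trans i≡m (sym x≡m))
          j≡y : natural σ 6 0 ≡ toℕ y
          j≡y = trans j≡m′ (sym y≡m′)
          value : ∀ {idx z} → idx ≡ toℕ z → real σ 1 (natural σ 4 idx) ≡ p (π ⟨$⟩ʳ z)
          value refl = trans (cong (real σ 1) (rep _))
            (trans (sameᴿ un 1 refl _) (trans (sameᴿ un₁ 1 refl _) (p-cell _)))
          x<y : does (natural σ 6 0 ℕₚ.≤? natural σ 5 0) ≡ false → x Fin.< y
          x<y j≰i = subst₂ ℕ._<_ i≡x j≡y (ℕₚ.≰⇒> (does-false⇒ (natural σ 6 0 ℕₚ.≤? natural σ 5 0) j≰i))

    gather-runs : ∀ {p w : Fin n → Carrier} (π : Permutation′ n) σ → natural σ 9 0 ≡ n →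
      (∀ x → natural σ 4 (toℕ x) ≡ toℕ (π ⟨$⟩ʳ x)) →
      (∀ x → real σ 4 (toℕ x) ≡ p x) → (∀ x → real σ 5 (toℕ x) ≡ w x) →
      Runs gather σ (10 ℕ.+ n ℕ.* 43) λ σ′ →
        (∀ x → real σ′ 7 (toℕ x) ≡ p (π ⟨$⟩ʳ x)) × (∀ x → real σ′ 2 (toℕ x) ≡ w (π ⟨$⟩ʳ x))
    gather-runs {p} {w} π σ₀ n-cell rep p-cell w-cell = runs-mono
      (λ _ _ (c₁ , c₂) → (λ x → c₁ x (Finₚ.toℕ<n x)) , (λ x → c₂ x (Finₚ.toℕ<n x)))
      (runs-for Inv refl refl refl n-cell
        (λ m σ m<n j≡m un (c₁ , c₂) → runs-≤ {k₂ = 30} (ℕₚ.≤ᵇ⇒≤ _ 30 tt) $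
          runs-seq $ runs-assignᴿ $ runs-assignᴿ $ λ _ →
            fill (real σ 7) j≡m c₁ (λ x eq → trans (cong (real σ 4 ∘ natural σ 4) eq)
              (trans (cong (real σ 4) (trans (sameᴺ un 4 refl _) (rep x)))
                     (trans (sameᴿ un 4 refl _) (p-cell _)))) ,
            fill (real σ 2) j≡m c₂ (λ x eq → trans (cong (real σ 5 ∘ natural σ 4) eq)
              (trans (cong (real σ 5) (trans (sameᴺ un 4 refl _) (rep x)))
                     (trans (sameᴿ un 5 refl _) (w-cell _)))))
        ((λ _ ()) , (λ _ ())))
      where
      Inv : ℕ → Memory → Set _
      Inv m σ = (∀ x → toℕ x ℕ.< m → real σ 7 (toℕ x) ≡ p (π ⟨$⟩ʳ x)) ×
                (∀ x → toℕ x ℕ.< m → real σ 2 (toℕ x) ≡ w (π ⟨$⟩ʳ x))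

    evaluate-runs : ∀ {T} {q : Fin n → Carrier} {a : Fin n → ℕ} σ → natural σ 9 0 ≡ n → natural σ 10 0 ≡ T →
      (∀ x → real σ 7 (toℕ x) ≡ q x) → (∀ x → natural σ 2 (toℕ x) ≡ a x) →
      Runs evaluate σ (14 ℕ.+ n ℕ.* 43) λ σ′ →
        real σ′ 9 0 ≡ sum (λ x → q x * fromℕ (T ℕ.∸ a x))
    evaluate-runs {T} {q} {a} σ₀ n-cell T-cell q-cell a-cell = runs-seq $ runs-assignᴿ $ runs-mono
      (λ _ _ acc → trans acc (trans (partialSum≡sum F n) (sum-cong-≗ λ x →
        cong₂ (λ u v → u * fromℕ v) (q-cell x) (cong₂ ℕ._∸_ T-cell (a-cell x)))))
      (runs-for (λ m σ → real σ 9 0 ≡ partialSum F m) refl refl refl n-cell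
        (λ m σ m<n j≡m un acc → runs-≤ {k₂ = 30} (ℕₚ.≤ᵇ⇒≤ _ 30 tt) $ runs-assignᴿ λ _ →
          cong₂ _+_ acc (cong₂ (λ u v → u * fromℕ v)
            (trans (cong (real σ 7) j≡m) (sameᴿ un 7 refl m))
            (cong₂ ℕ._∸_ (sameᴺ un 10 refl 0) (trans (cong (natural σ 2) j≡m) (sameᴺ un 2 refl m)))))
        refl)
      where
      F : ℕ → Carrier
      F m = real σ₀ 7 m * fromℕ (natural σ₀ 10 0 ℕ.∸ natural σ₀ 2 m)

    -- The program compares only the two values, so `Valued` may be any property: the winner has it
    -- because both contestants do.
    keepBest-runs : ∀ {s} (Valued : (Fin n → ℕ) → Carrier → Set s) {a₀ a₁ v₀ v₁} σ → natural σ 9 0 ≡ n →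
      (∀ x → natural σ 8 (toℕ x) ≡ a₀ x) → real σ 10 0 ≡ v₀ → Valued a₀ v₀ →
      (∀ x → natural σ 2 (toℕ x) ≡ a₁ x) → real σ 9 0 ≡ v₁ → Valued a₁ v₁ →
      Runs keepBest σ (19 ℕ.+ n ℕ.* 43) λ σ′ → ∃[ a ] ∃[ v ]
        (∀ x → natural σ′ 8 (toℕ x) ≡ a x) × real σ′ 10 0 ≡ v × Valued a v × v₀ ≤ v × v₁ ≤ v
    keepBest-runs Valued {a₀} {a₁} {v₀} {v₁} σ₀ n-cell a₀-cell v₀-cell val₀ a₁-cell v₁-cell val₁ = runs-when
      (λ v₁≤v₀ → runs-skip (a₀ , v₀ , a₀-cell , v₀-cell , val₀ , ≤-refl ,
        subst₂ _≤_ v₁-cell v₀-cell (does⇒ (_ ≤? _) v₁≤v₀)))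
      (λ v₁≰v₀ → runs-seq $ runs-assignᴿ $ runs-mono
        (λ _ un cells → a₁ , v₁ , (λ x → cells x (Finₚ.toℕ<n x)) , trans (sameᴿ un 10 refl 0) v₁-cell , val₁ ,
          subst₂ _≤_ v₀-cell v₁-cell (≰⇒≥ (does-false⇒ (_ ≤? _) v₁≰v₀)) , ≤-refl)
        (runs-for (λ m σ → ∀ x → toℕ x ℕ.< m → natural σ 8 (toℕ x) ≡ a₁ x) refl refl refl n-cell
          (λ m σ m<n j≡m un cells → runs-≤ {k₂ = 30} (ℕₚ.≤ᵇ⇒≤ _ 30 tt) $ runs-assignᴺ λ _ →
            fill (natural σ 8) j≡m cells λ x eq →
              trans (cong (natural σ 2) eq) (trans (sameᴺ un 2 refl _) (a₁-cell x)))
          λ _ ()))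

    restoreCapacities-runs : ∀ {T} {b : Fin T → Carrier} σ → natural σ 10 0 ≡ T →
      (∀ t → real σ 6 (toℕ t) ≡ b t) →
      Runs restoreCapacities σ (10 ℕ.+ T ℕ.* 43) λ σ′ → ∀ t → real σ′ 3 (toℕ t) ≡ b t
    restoreCapacities-runs {b = b} σ₀ T-cell b-cell = runs-mono
      (λ _ _ cells t → cells t (Finₚ.toℕ<n t))
      (runs-for (λ m σ → ∀ t → toℕ t ℕ.< m → real σ 3 (toℕ t) ≡ b t) refl refl refl T-cell
        (λ m σ m<T j≡m un cells → runs-≤ {k₂ = 30} (ℕₚ.≤ᵇ⇒≤ _ 30 tt) $ runs-assignᴿ λ _ →
          fill (real σ 3) j≡m cells λ t eq →
            trans (cong (real σ 6) eq) (trans (sameᴿ un 6 refl _) (b-cell t)))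
        λ _ ())

    restoreItems-runs : ∀ {p w : Fin n → Carrier} {a : Fin n → ℕ} (π : Permutation′ n) σ → natural σ 9 0 ≡ n →
      (∀ x → natural σ 4 (toℕ x) ≡ toℕ (π ⟨$⟩ʳ x)) →
      (∀ x → real σ 4 (toℕ x) ≡ p x) → (∀ x → real σ 5 (toℕ x) ≡ w x) → (∀ x → natural σ 8 (toℕ x) ≡ a x) →
      Runs restoreItems σ (10 ℕ.+ n ℕ.* 43) λ σ′ →
        (∀ x → real σ′ 1 (toℕ x) ≡ p x) × (∀ x → real σ′ 2 (toℕ x) ≡ w x) ×
        (∀ x → natural σ′ 2 (toℕ (π ⟨$⟩ʳ x)) ≡ a x)
    restoreItems-runs {p} {w} {a} π σ₀ n-cell rep p-cell w-cell a-cell = runs-mono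
      (λ _ _ (c₁ , c₂ , c₃) → (λ x → c₁ x (Finₚ.toℕ<n x)) , (λ x → c₂ x (Finₚ.toℕ<n x)) ,
        (λ x → c₃ x (Finₚ.toℕ<n x)))
      (runs-for Inv refl refl refl n-cell
        (λ m σ m<n j≡m un (c₁ , c₂ , c₃) → runs-≤ {k₂ = 30} (ℕₚ.≤ᵇ⇒≤ _ 30 tt) $
          runs-seq $ runs-assignᴿ $ runs-seq $ runs-assignᴿ $ runs-assignᴺ $ λ _ →
            let x≡m = Finₚ.toℕ-fromℕ< m<n
                j≡x = trans j≡m (sym x≡m)
            in
            fill (real σ 1) j≡m c₁ (λ x eq → trans (cong (real σ 4) eq) (trans (sameᴿ un 4 refl _) (p-cell x))) ,
            fill (real σ 2) j≡m c₂ (λ x eq → trans (cong (real σ 5) eq) (trans (sameᴿ un 5 refl _) (w-cell x))) ,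
            scatter (natural σ 2) π (trans (cong (natural σ 4) j≡x) (trans (sameᴺ un 4 refl _) (rep _)))
              x≡m c₃ (trans (cong (natural σ 8) j≡x) (trans (sameᴺ un 8 refl _) (a-cell _))))
        ((λ _ ()) , (λ _ ()) , (λ _ ())))
      where
      Inv : ℕ → Memory → Set _
      Inv m σ = (∀ x → toℕ x ℕ.< m → real σ 1 (toℕ x) ≡ p x) ×
                (∀ x → toℕ x ℕ.< m → real σ 2 (toℕ x) ≡ w x) ×
                (∀ x → toℕ x ℕ.< m → natural σ 2 (toℕ (π ⟨$⟩ʳ x)) ≡ a x)

  module _ {ε : Carrier} (0<ε : 0# < ε) where
    open Powers 0<ε
    open Rounding 0<ε

    before-suc : ∀ {a} {A : Set a} {T} {c : A} {f : Fin T → A} {s t} → toℕ s ≡ suc (toℕ t) → before c f s ≡ f t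
    before-suc {f = f} {suc s} {t} eq =
      cong f (Finₚ.toℕ-injective (trans (Finₚ.toℕ-inject₁ s) (ℕₚ.suc-injective eq)))

    before-zero : ∀ {a} {A : Set a} {T} {c : A} {f : Fin T → A} {s} → toℕ s ≡ 0 → before c f s ≡ c
    before-zero {s = zero} _ = refl

    reduceCapacities-runs : ∀ {T} {b : Fin T → Carrier} σ → natural σ 10 0 ≡ T → real σ 8 0 ≡ β →
      (∀ t → real σ 3 (toℕ t) ≡ b t) →
      Runs reduceCapacities σ (14 ℕ.+ T ℕ.* 73) λ σ′ →
        (∀ t → real σ′ 6 (toℕ t) ≡ b t) × (∀ t → real σ′ 3 (toℕ t) ≡ hold 0# b t)
    reduceCapacities-runs {T} {b} σ₀ T-cell β-cell b-cell = runs-seq $ runs-assignᴿ $ runs-mono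
      (λ _ _ (c₁ , c₂ , _) → (λ t → c₁ t (Finₚ.toℕ<n t)) , (λ t → c₂ t (Finₚ.toℕ<n t)))
      (runs-for Inv refl refl refl T-cell step
        ((λ _ ()) , (λ _ ()) , (λ t _ → b-cell t) , λ t t≡0 → sym (before-zero t≡0)))
      where
      Inv : ℕ → Memory → Set _
      Inv m σ = (∀ t → toℕ t ℕ.< m → real σ 6 (toℕ t) ≡ b t) ×
                (∀ t → toℕ t ℕ.< m → real σ 3 (toℕ t) ≡ hold 0# b t) ×
                (∀ t → m ℕ.≤ toℕ t → real σ 3 (toℕ t) ≡ b t) ×
                -- The cell holds the value that `hold` repeats if time `t` is not special.
                (∀ t → toℕ t ≡ m → real σ 9 0 ≡ before 0# (hold 0# b) t)
      step : ∀ m σ → m ℕ.< T → natural σ 6 0 ≡ m →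
        Unchanged _ (writeᴿ σ₀ 9 0 0#) σ → Inv m σ →
        Runs _ σ 60 (λ σ′ → ∀ z → Inv (suc m) (writeᴺ σ′ 6 0 z))
      step m σ m<T j≡m un (saved , reduced , rest , current) = runs-≤ (ℕₚ.≤ᵇ⇒≤ _ 60 tt) $
        runs-seq $ runs-assignᴿ $ runs-seq $
        runs-log (logℕ (T ℕ.∸ toℕ t))
          (subst₂ (λ x y → IsFloorLog x y (+ logℕ (T ℕ.∸ toℕ t))) (sym β-eq) (sym (cong fromℕ s-eq)) (logℕ-correct (ℕₚ.m<n⇒0<n∸m t<T))) $
        runs-when
          (λ le → runs-assignᴿ λ _ →
            let skipped = trans (current t t≡m) (sym (hold-skip 0# b t (cong not (trans (sym test) le))))
            in saved′ , fill (real σ 3) j≡m reduced (λ x j≡x → trans skipped (cong (hold 0# b) (same j≡x)))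
               , beyond (real σ 3) j≡m rest , next skipped)
          (λ gt → runs-assignᴿ λ _ →
            let held = trans b-eq (sym (hold-special 0# b t (cong not (trans (sym test) gt))))
            in saved′ , extend reduced (λ x x≡m → trans (cong (real σ 3) (trans x≡m (sym j≡m)))
                 (trans held (cong (hold 0# b) (same (trans j≡m (sym x≡m))))))
               , (λ x m<x → rest x (ℕₚ.<⇒≤ m<x)) , next held)
        where
        t : Fin T
        t = Fin.fromℕ< m<T
        t≡m : toℕ t ≡ m
        t≡m = Finₚ.toℕ-fromℕ< m<T
        t<T : toℕ t ℕ.< T
        t<T = Finₚ.toℕ<n t
        j≡t : natural σ 6 0 ≡ toℕ t
        j≡t = trans j≡m (sym t≡m)
        same : ∀ {x : Fin T} → natural σ 6 0 ≡ toℕ x → t ≡ x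
        same j≡x = Finₚ.toℕ-injective (trans (sym j≡t) j≡x)
        β-eq : real σ 8 0 ≡ β
        β-eq = trans (sameᴿ un 8 refl 0) β-cell
        s-eq : natural σ 10 0 ℕ.∸ natural σ 6 0 ≡ T ℕ.∸ toℕ t
        s-eq = cong₂ ℕ._∸_ (trans (sameᴺ un 10 refl 0) T-cell) j≡t
        b-eq : real σ 3 (natural σ 6 0) ≡ b t
        b-eq = trans (cong (real σ 3) j≡t) (rest t (ℕₚ.≤-reflexive (sym t≡m)))
        test : does (real σ 8 0 ^ logℕ (T ℕ.∸ toℕ t) ≤? fromℕ (natural σ 10 0 ℕ.∸ natural σ 6 0 ℕ.∸ 1)) ≡
               does (β ^ logℕ (T ℕ.∸ toℕ t) ≤? fromℕ (T ℕ.∸ toℕ t ℕ.∸ 1))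
        test = cong₂ (λ x s → does (x ^ logℕ (T ℕ.∸ toℕ t) ≤? fromℕ (s ℕ.∸ 1))) β-eq s-eq
        saved′ : ∀ x → toℕ x ℕ.< suc m → (if does (toℕ x ℕₚ.≟ natural σ 6 0) then
                   real σ 3 (natural σ 6 0) else real σ 6 (toℕ x)) ≡ b x
        saved′ = fill (real σ 6) j≡m saved λ x j≡x → trans b-eq (cong b (same j≡x))
        next : ∀ {v} → v ≡ hold 0# b t → ∀ x → toℕ x ≡ suc m → v ≡ before 0# (hold 0# b) x
        next v≡ x x≡1+m = trans v≡ (sym (before-suc (trans x≡1+m (cong suc (sym t≡m)))))

    roundProfits-runs : ∀ {n} {q : Fin n → Carrier} (q-pos : ∀ x → 0# < q x) (k : Fin n) σ →
      natural σ 9 0 ≡ n → natural σ 5 0 ≡ toℕ k → real σ 8 0 ≡ β → (∀ x → real σ 7 (toℕ x) ≡ q x) →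
      Runs roundProfits σ (10 ℕ.+ n ℕ.* 73) λ σ′ → ∀ x → real σ′ 1 (toℕ x) ≡ rounded (q k) (q-pos x)
    roundProfits-runs {n} {q} q-pos k σ₀ n-cell k-cell β-cell q-cell = runs-mono
      (λ _ _ cells x → cells x (Finₚ.toℕ<n x))
      (runs-for (λ m σ → ∀ x → toℕ x ℕ.< m → real σ 1 (toℕ x) ≡ rounded (q k) (q-pos x)) refl refl refl n-cell
        step λ _ ())
      where
      step : ∀ m σ → m ℕ.< n → natural σ 6 0 ≡ m → Unchanged roundProfits σ₀ σ →
        (∀ x → toℕ x ℕ.< m → real σ 1 (toℕ x) ≡ rounded (q k) (q-pos x)) →
        Runs _ σ 60 (λ σ′ → ∀ (_ : ℕ) x → toℕ x ℕ.< suc m → real σ′ 1 (toℕ x) ≡ rounded (q k) (q-pos x))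
      step m σ m<n j≡m un cells = runs-≤ (ℕₚ.≤ᵇ⇒≤ _ 60 tt) $ runs-seq $ runs-when
        (λ le → runs-assignᴺ $ runs-assignᴿ λ _ → assign (small (subst₂ _≤_ k-eq x-eq (does⇒ (_ ≤? _) le)) (proj₂ E)))
        (λ gt → let log = large (does-false⇒ (_ ≤? _) gt ∘ subst₂ _≤_ (sym k-eq) (sym x-eq)) (proj₂ E) in
          runs-log (proj₁ E)
            (subst₂ (λ x y → IsFloorLog x y (+ proj₁ E)) (sym β-eq) (sym (cong₂ _/_ k-eq x-eq)) log) $
          runs-assignᴿ λ _ → assign refl)
        where
        x : Fin n
        x = Fin.fromℕ< m<n
        j≡x : natural σ 6 0 ≡ toℕ x
        j≡x = trans j≡m (sym (Finₚ.toℕ-fromℕ< m<n))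
        β-eq : real σ 8 0 ≡ β
        β-eq = trans (sameᴿ un 8 refl 0) β-cell
        x-eq : real σ 7 (natural σ 6 0) ≡ q x
        x-eq = trans (cong (real σ 7) j≡x) (trans (sameᴿ un 7 refl _) (q-cell x))
        k-eq : real σ 7 (natural σ 5 0) ≡ q k
        k-eq = trans (cong (real σ 7) (trans (sameᴺ un 5 refl 0) k-cell)) (trans (sameᴿ un 7 refl _) (q-cell k))
        E : ∃[ e ] IsExponent (q k) (q x) e
        E = exponent (q k) (q-pos x)
        small : q k ≤ q x → ∀ {e} → IsExponent (q k) (q x) e → 0 ≡ e
        small _  (inj₁ (_ , e≡0)) = sym e≡0
        small le (inj₂ (gt , _))  = contradiction le gt
        large : ¬ q k ≤ q x → ∀ {e} → IsExponent (q k) (q x) e → IsFloorLog β (q k / q x) (+ e)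
        large gt (inj₁ (le , _))  = contradiction le gt
        large _  (inj₂ (_ , log)) = log
        assign : ∀ {e} → e ≡ proj₁ E → ∀ y → toℕ y ℕ.< suc m →
          (if does (toℕ y ℕₚ.≟ natural σ 6 0) then (fromℕ 1 / real σ 8 0) ^ e else real σ 1 (toℕ y)) ≡
          rounded (q k) (q-pos y)
        assign refl = fill (real σ 1) j≡m cells λ y j≡y → trans
          (cong (_^ proj₁ E) (trans (cong₂ _/_ fromℕ-1 β-eq) (*-identityˡ (β ⁻¹))))
          (cong (λ z → rounded (q k) (q-pos z)) (Finₚ.toℕ-injective (trans (sym j≡x) j≡y)))

    -- The given program works from every memory holding its input, in particular from `τ` as seen
    -- through `shift`. As `shift` fixes the arrays 0 to 3, input and output are found in `τ` under
    -- their usual names.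
    rename-runs : ∀ {n T G} {I : Instance n T} {v} {Good : Solution n T → Set _} (P : Program) →
      ComputesWithin P ε I v Good → v < fromℕ (suc G) → ∀ τ → Holds τ ε I →
      Runs (rename P) τ G λ τ′ → Holds τ′ ε I × ∃[ a ] (∀ x → natural τ′ 2 (toℕ x) ≡ a x) ×
        Feasible I (fromInsertionTimes a) × Good (fromInsertionTimes a)
    rename-runs P computes v<1+G τ holds =
      let σ = mem (λ a → natural τ (shift a)) (λ a → real τ (shift a))
          σ′ , k , run , k≤v , holds′ , feasible , good = computes σ record
            { n-cell = Holds.n-cell holds ; T-cell = Holds.T-cell holds ; ε-cell = ε-cell holds
            ; p-cell = Holds.p-cell holds ; w-cell = w-cell holds ; b-cell = b-cell holds }
          τ′ , run′ , τ′≈σ′ = ⇓-rename run (simulates (λ _ _ → refl) (λ _ _ → refl))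
      -- The bound `v` is a field element: k ≤ v < G + 1 gives k ≤ G.
      in τ′ , k , run′ , ℕ.s≤s⁻¹ (fromℕ-cancel-< (≤-<-trans k≤v v<1+G)) ,
         record
           { n-cell = trans (≈ᴺ τ′≈σ′ 0 0) (Holds.n-cell holds′)
           ; T-cell = trans (≈ᴺ τ′≈σ′ 1 0) (Holds.T-cell holds′)
           ; ε-cell = trans (≈ᴿ τ′≈σ′ 0 0) (ε-cell holds′)
           ; p-cell = λ x → trans (≈ᴿ τ′≈σ′ 1 _) (Holds.p-cell holds′ x)
           ; w-cell = λ x → trans (≈ᴿ τ′≈σ′ 2 _) (w-cell holds′ x)
           ; b-cell = λ x → trans (≈ᴿ τ′≈σ′ 3 _) (b-cell holds′ x) } ,
         (λ x → natural σ′ 2 (toℕ x)) , (λ x → ≈ᴺ τ′≈σ′ 2 _) , feasible , good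

  infixr 2 _⍮_
  _⍮_ : ∀ {P Q σ σ₁ σ₂} → Unchanged P σ σ₁ → Unchanged Q σ₁ σ₂ → Unchanged (P ⨟ Q) σ σ₂
  _⍮_ {P} u₁ u₂ = Unchanged-trans
    (Unchanged-weaken (λ _ → ∨-falseˡ) (λ _ → ∨-falseˡ) u₁)
    (Unchanged-weaken (λ a → ∨-falseʳ {writesᴺ P a}) (λ a → ∨-falseʳ {writesᴿ P a}) u₂)

  constants-runs : ∀ {n T ε} σ → natural σ 0 0 ≡ n → natural σ 1 0 ≡ T → real σ 0 0 ≡ ε →
    Runs constants σ 20 λ σ′ → natural σ′ 9 0 ≡ n × natural σ′ 10 0 ≡ T × real σ′ 8 0 ≡ 1# + ε
  constants-runs σ n-cell T-cell ε-cell = runs-≤ (ℕₚ.≤ᵇ⇒≤ _ 20 tt) $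
    runs-seq $ runs-assignᴺ $ runs-seq $ runs-assignᴺ $ runs-assignᴿ
    (n-cell , T-cell , cong₂ _+_ fromℕ-1 ε-cell)

  module _ (P : Program) where

    -- `P` is a variable, so here the frame condition does not compute. The argument counts from
    -- array 4, the first one that is free: `renamed∉ᴺ 1` concerns array 5.
    renamed∉ᴺ : ∀ b → (∀ a → (b ≡ᵇ 12 ℕ.+ a) ≡ false) → writesᴺ (rename P) (4 ℕ.+ b) ≡ false
    renamed∉ᴺ b new = rename-writesᴺ (shift-fresh {b} new) P

    renamed∉ᴿ : ∀ b → (∀ a → (b ≡ᵇ 12 ℕ.+ a) ≡ false) → writesᴿ (rename P) (4 ℕ.+ b) ≡ false
    renamed∉ᴿ b new = rename-writesᴿ (shift-fresh {b} new) P

    body : Program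
    body = roundProfits ⨟ rename P ⨟ evaluate ⨟ keepBest

    body∉5 : writesᴺ body 5 ≡ false
    body∉5 rewrite renamed∉ᴺ 1 (λ _ → refl) = refl

    body∉9 : writesᴺ body 9 ≡ false
    body∉9 rewrite renamed∉ᴺ 5 (λ _ → refl) = refl

    tryAll∉ᴺ-4 : writesᴺ (tryAll P) 4 ≡ false
    tryAll∉ᴺ-4 rewrite renamed∉ᴺ 0 (λ _ → refl) = refl

    tryAll∉ᴺ-9 : writesᴺ (tryAll P) 9 ≡ false
    tryAll∉ᴺ-9 rewrite renamed∉ᴺ 5 (λ _ → refl) = refl

    tryAll∉ᴺ-10 : writesᴺ (tryAll P) 10 ≡ false
    tryAll∉ᴺ-10 rewrite renamed∉ᴺ 6 (λ _ → refl) = refl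

    tryAll∉ᴿ-4 : writesᴿ (tryAll P) 4 ≡ false
    tryAll∉ᴿ-4 rewrite renamed∉ᴿ 0 (λ _ → refl) = refl

    tryAll∉ᴿ-5 : writesᴿ (tryAll P) 5 ≡ false
    tryAll∉ᴿ-5 rewrite renamed∉ᴿ 1 (λ _ → refl) = refl

    tryAll∉ᴿ-6 : writesᴿ (tryAll P) 6 ≡ false
    tryAll∉ᴿ-6 rewrite renamed∉ᴿ 2 (λ _ → refl) = refl

    tryAll∉ᴿ-7 : writesᴿ (tryAll P) 7 ≡ false
    tryAll∉ᴿ-7 rewrite renamed∉ᴿ 3 (λ _ → refl) = refl

    tryAll∉ᴿ-8 : writesᴿ (tryAll P) 8 ≡ false
    tryAll∉ᴿ-8 rewrite renamed∉ᴿ 4 (λ _ → refl) = refl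

  -- The loop over all guesses

  module _ {ε : Carrier} (0<ε : 0# < ε) {n T : ℕ} (J : Instance n (suc T)) where
    open Powers 0<ε
    open Rounding 0<ε
    open Instance J

    Valued : (Fin n → ℕ) → Carrier → Set (c ⊔ ℓ)
    Valued a v = Feasible J (fromInsertionTimes a) × profit J (fromInsertionTimes a) ≡ v

    -- Competitors are divided by their first item in use: guess `k` answers for those for which it
    -- is right.
    NearOptimalFrom : Fin n → Carrier → Set (c ⊔ ℓ)
    NearOptimalFrom k v = ∀ {x} → Feasible J x → x (last T) k ≡ true →
      (∀ y → x (last T) y ≡ true → k Fin.≤ y) → 1-4ε * profit J x ≤ v

    -- Only the empty solution belongs to no guess, and its profit is 0.
    nearOptimal : ∀ {v} → 0# ≤ v → (∀ k → NearOptimalFrom k v) → ∀ {x} → Feasible J x → 1-4ε * profit J x ≤ v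
    nearOptimal {v} 0≤v from {x} fx with firstTrue (x (last T))
    ... | inj₂ (k , xk , first) = from k fx xk first
    ... | inj₁ none = begin
      1-4ε * profit J x  ≡⟨ cong (λ u → 1-4ε * u) (sum-zero λ t → ᵀ-∅ p λ y → empty t y) ⟩
      1-4ε * 0#          ≡⟨ zeroʳ 1-4ε ⟩
      0#                 ≤⟨ 0≤v ⟩
      v                  ∎
      where
      open ≤-Reasoning
      empty : ∀ t y → x t y ≡ false
      empty t y = Boolₚ.¬-not λ xty → contradiction
        (trans (sym (none y)) (≤⇒ (Feasible-mono J fx y (Finₚ.≤fromℕ t)) xty)) λ ()

  module _ {ε : Carrier} (0<ε : 0# < ε) {n T : ℕ} (J : Instance n (suc T))
           (sorted : ∀ {x y} → x Fin.≤ y → Instance.p J y ≤ Instance.p J x)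
           (P : Program) {v : Carrier} (G : ℕ) (v<1+G : v < fromℕ (suc G)) where
    open Powers 0<ε
    open Rounding 0<ε
    open Instance J
    open Guess J sorted

    -- The input of P apart from the profits, which differ from guess to guess.
    Inputs : Memory → Set c
    Inputs σ = natural σ 0 0 ≡ n × natural σ 1 0 ≡ suc T × real σ 0 0 ≡ ε ×
               (∀ x → real σ 2 (toℕ x) ≡ w x) × (∀ t → real σ 3 (toℕ t) ≡ hold 0# b t)

    -- The stored solution need not stem from the right guess. Being the best so far, it answers for
    -- the competitors of all earlier guesses at once.
    TriedBefore : ℕ → Memory → Set (c ⊔ ℓ)
    TriedBefore m σ = ∃[ a ] ∃[ v ] (∀ x → natural σ 8 (toℕ x) ≡ a x) × real σ 10 0 ≡ v × Valued 0<ε J a v ×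
      (∀ k → toℕ k ℕ.< m → NearOptimalFrom 0<ε J k v)

    tryAll-runs : (∀ k → ComputesWithin P ε (guess k) v (AtLeast_TimesMaxOf (guess k) 1-2ε (Candidate k))) →
      ∀ σ → natural σ 9 0 ≡ n → natural σ 10 0 ≡ suc T → real σ 8 0 ≡ β → (∀ x → real σ 7 (toℕ x) ≡ p x) →
      Inputs σ → (∀ x → natural σ 8 (toℕ {n} x) ≡ suc T) →
      Runs (tryAll P) σ (tryAllCost n G) λ σ′ → Inputs σ′ × TriedBefore n σ′
    tryAll-runs computes σ₀ n-cell T-cell β-cell p-cell inputs₀ never = runs-seq $ runs-assignᴿ $
      runs-for (λ m σ → Inputs σ × TriedBefore m σ) (body∉5 P) (body∉9 P) refl n-cell step
        ( inputs₀ , (λ _ → suc T) , 0# , never , refl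
        , (never-feasible J _ (λ _ → ℕₚ.≤-refl) , never-profit J _ (λ _ → ℕₚ.≤-refl)) , λ _ ())
      where
      step : ∀ m σ → m ℕ.< n → natural σ 5 0 ≡ m → Unchanged _ (writeᴿ σ₀ 10 0 0#) σ →
        Inputs σ × TriedBefore m σ →
        Runs (body P) σ (bodyCost n G) (λ σ′ → ∀ z → Inputs (writeᴺ σ′ 5 0 z) × TriedBefore (suc m) (writeᴺ σ′ 5 0 z))
      step m σ m<n i≡m un ((n₀ , T₀ , ε₀ , w₀ , b₀) , a₀ , v₀ , a₀-cell , v₀-cell , val₀ , tried) =
        runs-seq $ runs-mono (λ σ₁ un₁ p′-cell →
        runs-seq $ runs-mono (λ σ₂ un₂ (holds , a₁ , a₁-cell , feasible , good) →
        let un₁₂ = un₁ ⍮ un₂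
            a₀-cell₂ = λ x → trans (sameᴺ un₁₂ 8 (renamed∉ᴺ P 4 λ _ → refl) _) (a₀-cell x)
            v₀-cell₂ = trans (sameᴿ un₁₂ 10 (renamed∉ᴿ P 6 λ _ → refl) 0) v₀-cell
            n-cell₂ = trans (sameᴺ un₁₂ 9 (renamed∉ᴺ P 5 λ _ → refl) 0) (n-cell′)
        in
        runs-seq $ runs-mono (λ σ₃ un₃ value →
        runs-mono (λ σ₄ un₄ (a , v , a-cell , v-cell , val , v₀≤v , v₁≤v) _ →
          let un₃₄ = un₃ ⍮ un₄ in
          ( trans (sameᴺ un₃₄ 0 refl 0) (Holds.n-cell holds)
          , trans (sameᴺ un₃₄ 1 refl 0) (Holds.T-cell holds)
          , trans (sameᴿ un₃₄ 0 refl 0) (ε-cell holds)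
          , (λ x → trans (sameᴿ un₃₄ 2 refl _) (w-cell holds x))
          , (λ x → trans (sameᴿ un₃₄ 3 refl _) (b-cell holds x)))
          , a , v , a-cell , v-cell , val , λ k′ k′<1+m {x} fx xk′ first → case-≤ k′ k′<1+m
              (λ k′<m → ≤-trans (tried k′ k′<m fx xk′ first) v₀≤v)
              (λ { refl → ≤-trans (guess-good k fx xk′ first {fromInsertionTimes a₁} good) v₁≤v }))
        (keepBest-runs (Valued 0<ε J) σ₃
          (trans (sameᴺ un₃ 9 refl 0) n-cell₂)
          (λ x → trans (sameᴺ un₃ 8 refl _) (a₀-cell₂ x))
          (trans (sameᴿ un₃ 10 refl 0) v₀-cell₂)
          val₀
          (λ x → trans (sameᴺ un₃ 2 refl _) (a₁-cell x))
          (trans value (sym (profit-insertion J a₁)))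
          (guess-feasible⇒feasible k feasible , refl)))
        (evaluate-runs σ₂ n-cell₂
          (trans (sameᴺ un₁₂ 10 (renamed∉ᴺ P 6 λ _ → refl) 0) (trans (sameᴺ un 10 (tryAll∉ᴺ-10 P) 0) T-cell))
          (λ x → trans (sameᴿ un₁₂ 7 (renamed∉ᴿ P 3 λ _ → refl) _) (p-cell′ x)) a₁-cell))
        (rename-runs 0<ε {Good = AtLeast_TimesMaxOf (guess k) 1-2ε (Candidate k)} P (computes k) v<1+G σ₁ record
          { n-cell = trans (sameᴺ un₁ 0 refl 0) n₀
          ; T-cell = trans (sameᴺ un₁ 1 refl 0) T₀
          ; ε-cell = trans (sameᴿ un₁ 0 refl 0) ε₀
          ; p-cell = p′-cell
          ; w-cell = λ x → trans (sameᴿ un₁ 2 refl _) (w₀ x)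
          ; b-cell = λ t → trans (sameᴿ un₁ 3 refl _) (b₀ t) }))
        (roundProfits-runs 0<ε p-pos k σ n-cell′ (trans i≡m (sym k≡m))
          (trans (sameᴿ un 8 (tryAll∉ᴿ-8 P) 0) β-cell) p-cell′)
        where
        k : Fin n
        k = Fin.fromℕ< m<n
        k≡m : toℕ k ≡ m
        k≡m = Finₚ.toℕ-fromℕ< m<n
        n-cell′ : natural σ 9 0 ≡ n
        n-cell′ = trans (sameᴺ un 9 (tryAll∉ᴺ-9 P) 0) n-cell
        p-cell′ : ∀ x → real σ 7 (toℕ x) ≡ p x
        p-cell′ x = trans (sameᴿ un 7 (tryAll∉ᴿ-7 P) _) (p-cell x)
        case-≤ : ∀ {a} {A : Set a} (k′ : Fin n) → toℕ k′ ℕ.< suc m → (toℕ k′ ℕ.< m → A) → (k′ ≡ k → A) → A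
        case-≤ k′ k′<1+m less equal with toℕ k′ ℕₚ.≟ m
        ... | yes k′≡m = equal (Finₚ.toℕ-injective (trans k′≡m (sym k≡m)))
        ... | no k′≢m = less (m<1+n∧m≢n⇒m<n k′<1+m k′≢m)

  reductionCost-bound : ∀ {n T G k v} → 1 ℕ.≤ n → 1 ℕ.≤ T → k ℕ.≤ reductionCost n T G → fromℕ G ≤ v →
    fromℕ k ≤ fromℕ 440 * (fromℕ T + fromℕ n * (fromℕ n + v))
  reductionCost-bound {n} {T} {G} {k} 1≤n 1≤T k≤ G≤v =
    fromℕ-cost 440 {k} {n} {T} {G} (ℕₚ.≤-trans k≤ (reductionCost-≤ {n} {T} G 1≤n 1≤T)) G≤v

  -- Assembling the reduction

  module _ {ε : Carrier} (0<ε : 0# < ε) where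
    open Powers 0<ε
    open Rounding 0<ε

    record Prepared {n T : ℕ} (I : Instance n T) (σ : Memory) : Set (c ⊔ ℓ) where
      open Instance I
      field
        π : Permutation′ n
        sorted : ∀ {x y} → x Fin.≤ y → p (π ⟨$⟩ʳ y) ≤ p (π ⟨$⟩ʳ x)
        order : ∀ x → natural σ 4 (toℕ x) ≡ toℕ (π ⟨$⟩ʳ x)
        never : ∀ x → natural σ 8 (toℕ {n} x) ≡ T
        n-copy : natural σ 9 0 ≡ n
        T-copy : natural σ 10 0 ≡ T
        p-copy : ∀ x → real σ 4 (toℕ x) ≡ p x
        w-copy : ∀ x → real σ 5 (toℕ x) ≡ w x
        b-copy : ∀ t → real σ 6 (toℕ t) ≡ b t
        p-sorted : ∀ x → real σ 7 (toℕ x) ≡ p (π ⟨$⟩ʳ x)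
        w-sorted : ∀ x → real σ 2 (toℕ x) ≡ w (π ⟨$⟩ʳ x)
        b-reduced : ∀ t → real σ 3 (toℕ t) ≡ hold 0# b t
        β-cell : real σ 8 0 ≡ β

    prepare-runs : ∀ {n T} (I : Instance n T) σ → Holds σ ε I →
      Runs prepare σ (prepareCost n T) (Prepared I)
    prepare-runs I σ₀ holds =
      runs-seq $ runs-mono (λ σ₁ un₁ (n₁ , T₁ , β₁) →
      runs-seq $ runs-mono (λ σ₂ un₂ (identity , p₂ , w₂ , never) →
      runs-seq $ runs-mono (λ σ₃ un₃ (π , rep , sorted) →
      runs-seq $ runs-mono (λ σ₄ un₄ (q₄ , w₄) →
      runs-mono (λ σ₅ un₅ (b₅ , b′₅) → record
        { π = π ; sorted = sorted
        ; order = λ x → trans (sameᴺ (un₄ ⍮ un₅) 4 refl _) (rep x)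
        ; never = λ x → trans (sameᴺ (un₃ ⍮ un₄ ⍮ un₅) 8 refl _) (never x)
        ; n-copy = trans (sameᴺ (un₂ ⍮ un₃ ⍮ un₄ ⍮ un₅) 9 refl 0) n₁
        ; T-copy = trans (sameᴺ (un₂ ⍮ un₃ ⍮ un₄ ⍮ un₅) 10 refl 0) T₁
        ; p-copy = λ x → trans (sameᴿ (un₃ ⍮ un₄ ⍮ un₅) 4 refl _) (p₂ x)
        ; w-copy = λ x → trans (sameᴿ (un₃ ⍮ un₄ ⍮ un₅) 5 refl _) (w₂ x)
        ; b-copy = b₅
        ; p-sorted = λ x → trans (sameᴿ un₅ 7 refl _) (q₄ x)
        ; w-sorted = λ x → trans (sameᴿ un₅ 2 refl _) (w₄ x)
        ; b-reduced = b′₅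
        ; β-cell = trans (sameᴿ (un₂ ⍮ un₃ ⍮ un₄ ⍮ un₅) 8 refl 0) β₁ })
      (reduceCapacities-runs 0<ε σ₄
        (trans (sameᴺ (un₂ ⍮ un₃ ⍮ un₄) 10 refl 0) T₁)
        (trans (sameᴿ (un₂ ⍮ un₃ ⍮ un₄) 8 refl 0) β₁)
        (λ t → trans (sameᴿ (un₁ ⍮ un₂ ⍮ un₃ ⍮ un₄) 3 refl _) (b-cell holds t))))
      (gather-runs π σ₃ (trans (sameᴺ (un₂ ⍮ un₃) 9 refl 0) n₁) rep
        (λ x → trans (sameᴿ un₃ 4 refl _) (p₂ x)) (λ x → trans (sameᴿ un₃ 5 refl _) (w₂ x))))
      (sort-runs σ₂ (trans (sameᴺ un₂ 9 refl 0) n₁) identity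
        (λ x → trans (sameᴿ (un₁ ⍮ un₂) 1 refl _) (Holds.p-cell holds x))))
      (copy-runs σ₁ n₁ T₁
        (λ x → trans (sameᴿ un₁ 1 refl _) (Holds.p-cell holds x))
        (λ x → trans (sameᴿ un₁ 2 refl _) (w-cell holds x))))
      (constants-runs σ₀ (Holds.n-cell holds) (Holds.T-cell holds) (ε-cell holds))

    record Finished {n T : ℕ} (I : Instance n T) (π : Permutation′ n) (a : Fin n → ℕ) (σ : Memory) : Set c where
      field
        holds : Holds σ ε I
        insertion : ∀ x → natural σ 2 (toℕ (π ⟨$⟩ʳ x)) ≡ a x

    finish-runs : ∀ {n T} (I : Instance n T) (π : Permutation′ n) {a : Fin n → ℕ} σ →
      natural σ 0 0 ≡ n → natural σ 1 0 ≡ T → real σ 0 0 ≡ ε →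
      natural σ 9 0 ≡ n → natural σ 10 0 ≡ T → (∀ x → natural σ 4 (toℕ x) ≡ toℕ (π ⟨$⟩ʳ x)) →
      (∀ x → real σ 4 (toℕ x) ≡ Instance.p I x) → (∀ x → real σ 5 (toℕ x) ≡ Instance.w I x) →
      (∀ t → real σ 6 (toℕ t) ≡ Instance.b I t) → (∀ x → natural σ 8 (toℕ x) ≡ a x) →
      Runs finish σ (finishCost n T) (Finished I π a)
    finish-runs {n} I π σ₀ n₀ T₀ ε₀ n-copy T-copy order p-copy w-copy b-copy best =
      runs-seq $ runs-mono (λ σ₁ un₁ b₁ →
      runs-mono (λ σ₂ un₂ (p₂ , w₂ , out) → record
        { holds = record
          { n-cell = trans (sameᴺ (un₁ ⍮ un₂) 0 refl 0) n₀
          ; T-cell = trans (sameᴺ (un₁ ⍮ un₂) 1 refl 0) T₀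
          ; ε-cell = trans (sameᴿ (un₁ ⍮ un₂) 0 refl 0) ε₀
          ; p-cell = p₂ ; w-cell = w₂
          ; b-cell = λ t → trans (sameᴿ un₂ 3 refl _) (b₁ t) }
        ; insertion = out })
      (restoreItems-runs π σ₁ (trans (sameᴺ un₁ 9 refl 0) n-copy)
        (λ x → trans (sameᴺ un₁ 4 refl _) (order x))
        (λ x → trans (sameᴿ un₁ 4 refl _) (p-copy x))
        (λ x → trans (sameᴿ un₁ 5 refl _) (w-copy x))
        (λ x → trans (sameᴺ un₁ 8 refl _) (best x))))
      (restoreCapacities-runs {n = n} σ₀ T-copy b-copy)

  module _ (P : Program) {ε : Carrier} (0<ε : 0# < ε) {n T : ℕ} (I : Instance n (suc T)) where
    open Instance I
    open Rounding 0<ε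

    Correct : Memory → Set (c ⊔ ℓ)
    Correct σ = Holds σ ε I × Feasible I (output σ) × AtLeast_TimesMaxOf I 1-4ε (Feasible I) (output σ)

    module _ (π : Permutation′ n) where

      J : Instance n (suc T)
      J = permute I π

      finished-correct : ∀ {a u} → Valued 0<ε J a u → (∀ k → NearOptimalFrom 0<ε J k u) →
        ∀ σ → Finished 0<ε I π a σ → Correct σ
      finished-correct {a} {u} (feasible , profit≡u) near σ finished =
        Finished.holds finished ,
        unpermute-feasible I π {y} (Feasible-resp J a≋y feasible) ,
        λ { _ ((x , fx , refl) , _) → begin
          1-4ε * profit I x                        ≡⟨ cong (λ z → 1-4ε * z) (permute-profit I π x) ⟩
          1-4ε * profit J (permuteSolution I π x)  ≤⟨ nearOptimal 0<ε J 0≤u near (permute-feasible I π fx) ⟩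
          u                                        ≡⟨ sym profit≡u ⟩
          profit J (fromInsertionTimes a)          ≡⟨ profit-cong J a≋y ⟩
          profit J (permuteSolution I π y)         ≡⟨ sym (permute-profit I π y) ⟩
          profit I y                               ∎ }
        where
        open ≤-Reasoning
        y : Solution n (suc T)
        y = output σ
        0≤u : 0# ≤ u
        0≤u = subst (0# ≤_) profit≡u (profit-nonNeg J (fromInsertionTimes a))
        a≋y : fromInsertionTimes a ≋ permuteSolution I π y
        a≋y t x = cong (λ z → does (z ℕₚ.≤? toℕ t)) (sym (Finished.insertion finished x))

    module _ {v : Carrier} (G : ℕ) (v<1+G : v < fromℕ (suc G))
             (computes : ∀ (I : Instance n (suc T)) → WellBehaved I ε → ComputesWithin P ε I v
               (AtLeast_TimesMaxOf I 1-2ε (λ x → Feasible I x × OneIn I x))) where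

      tryFinish-runs : ∀ σ → natural σ 0 0 ≡ n → natural σ 1 0 ≡ suc T → real σ 0 0 ≡ ε →
        Prepared 0<ε I σ → Runs (tryAll P ⨟ finish) σ (tryAllCost n G ℕ.+ finishCost n (suc T)) Correct
      tryFinish-runs σ₀ n₀ T₀ ε₀ prepared =
        runs-seq {k₁ = tryAllCost n G} {k₂ = finishCost n (suc T)} $
        runs-mono (λ σ₁ un₁ ((n₁ , T₁ , ε₁ , _) , a , u , a-cell , _ , valued , tried) →
        runs-mono (λ σ₂ _ → finished-correct π valued (λ k → tried k (Finₚ.toℕ<n k)) σ₂)
        (finish-runs 0<ε I π σ₁ n₁ T₁ ε₁
          (trans (sameᴺ un₁ 9 (tryAll∉ᴺ-9 P) 0) n-copy)
          (trans (sameᴺ un₁ 10 (tryAll∉ᴺ-10 P) 0) T-copy)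
          (λ x → trans (sameᴺ un₁ 4 (tryAll∉ᴺ-4 P) _) (order x))
          (λ x → trans (sameᴿ un₁ 4 (tryAll∉ᴿ-4 P) _) (p-copy x))
          (λ x → trans (sameᴿ un₁ 5 (tryAll∉ᴿ-5 P) _) (w-copy x))
          (λ t → trans (sameᴿ un₁ 6 (tryAll∉ᴿ-6 P) _) (b-copy t))
          a-cell))
        (tryAll-runs 0<ε (J π) sorted P G v<1+G
          (λ k → computes (Guess.guess (J π) sorted k) (Guess.guess-wellBehaved (J π) sorted k))
          σ₀ n-copy T-copy β-cell p-sorted (n₀ , T₀ , ε₀ , w-sorted , b-reduced) never)
        where open Prepared prepared

      reduction-runs : ∀ σ → Holds σ ε I → Runs (reduction P) σ (reductionCost n (suc T) G) Correct
      reduction-runs σ₀ holds = runs-seq {k₁ = prepareCost n (suc T)} {k₂ = tryAllCost n G ℕ.+ finishCost n (suc T)} $ runs-mono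
        (λ σ₁ un₁ prepared → tryFinish-runs σ₁
          (trans (sameᴺ un₁ 0 refl 0) (Holds.n-cell holds))
          (trans (sameᴺ un₁ 1 refl 0) (Holds.T-cell holds))
          (trans (sameᴿ un₁ 0 refl 0) (ε-cell holds)) prepared)
        (prepare-runs 0<ε I σ₀ holds)

    reduction-correct : ∀ {v} → 0# ≤ v → 1 ℕ.≤ n →
      (∀ (I : Instance n (suc T)) → WellBehaved I ε → ComputesWithin P ε I v
        (AtLeast_TimesMaxOf I 1-2ε (λ x → Feasible I x × OneIn I x))) →
      ComputesWithin (reduction P) ε I (fromℕ 440 * (fromℕ (suc T) + fromℕ n * (fromℕ n + v)))
        (AtLeast_TimesMaxOf I 1-4ε (Feasible I))
    reduction-correct {v} 0≤v 1≤n computes σ₀ holds =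
      -- Steps are counted in ℕ, so the time of a call is bounded by ⌊v⌋, which is turned back into
      -- `v` once the total is known.
      let G , G≤v , v<1+G = floor v 0≤v
      in withinBound G G≤v (reduction-runs G v<1+G computes σ₀ holds)
      where
      withinBound : ∀ G → fromℕ G ≤ v → Runs (reduction P) σ₀ (reductionCost n (suc T) G) Correct →
        ∃[ σ ] ∃[ k ] (reduction P ∣ σ₀ ⇓ σ ∣ k) ×
        fromℕ k ≤ fromℕ 440 * (fromℕ (suc T) + fromℕ n * (fromℕ n + v)) × Correct σ
      withinBound G G≤v (σ , k , run , k≤cost , correct) =
        σ , k , run , reductionCost-bound {n} {suc T} {G} 1≤n (ℕ.s≤s ℕ.z≤n) k≤cost G≤v , correct

theorem3 : ∀ {c ℓ} (K : ArchimedeanOrderedField c ℓ) →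
    let open Computation K in
    (g : ℕ → ℕ → Carrier → Carrier) →
    (∀ n T ε → 0# < ε → 0# ≤ g n T ε) →
    (∃ λ (P : Program) →
    ∀ n T .{{_ : NonZero n}} .{{_ : NonZero T}} ε → 0# < ε →
    (I : Instance n T) → WellBehaved I ε →
    ComputesWithin P ε I (g n T ε)
    (AtLeast_TimesMaxOf I (1# - fromℕ 2 * ε)
    (λ x → Feasible I x × OneIn I x))) →
    ∃₂ λ (Q : Program) (C : ℕ) →
    ∀ n T .{{_ : NonZero n}} .{{_ : NonZero T}} ε → 0# < ε →
    (I : Instance n T) →
    ComputesWithin Q ε I
    (fromℕ C * (fromℕ T + fromℕ n * (fromℕ n + g n T ε)))
    (AtLeast_TimesMaxOf I (1# - fromℕ 4 * ε) (Feasible I))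
theorem3 K g g-nonNeg (P , computes) = reduction P , 440 ,
  λ { n@(suc _) T@(suc _) ε 0<ε I →
      reduction-correct P 0<ε I (g-nonNeg n T ε 0<ε) (ℕ.s≤s ℕ.z≤n) (computes n T ε 0<ε) }
  where open Algorithm K
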